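{- Let $m,n$ be positive integers and assume that $n$ is odd. Then $$\sum_{D\in \mathrm{D}(R_{m-1,n-1})} \sqrt{ -1}^{\,h(D)}=\begin{cases}\left(\dfrac{m}{n}\right)&(m\equiv 1\pmod 2),\\[2mm] \left(\dfrac{m/2}{n}\right)&(m\equiv 0\pmod 2),\end{cases}$$ where the right hand side is the Jacobi symbol.
   Context: A board is a finite subset of $\mathbb{Z}\times\mathbb{Z}$; its elements are called squares. For non-negative integers $a,b$, $R_{a,b}=[a]\times[b]$ where $[k]=\{1,\dots,k\}$ (the rectangle of width $a$ and height $b$; it is empty if $a=0$ or $b=0$). A domino tiling of a board $X$ is a set $D$ of subsets of $X$ such that every element of $D$ consists of two adjacent squares of $X$ (squares at Euclidean distance $1$), and every square of $X$ lies in exactly one element of $D$. $\mathrm{D}(X)$ is the set of domino tilings of $X$ (the empty board has exactly one tiling, the empty one). A domino $\{(i,j),(i+1,j)\}$ is horizontal, and $\{(i,j),(i,j+1)\}$ is vertical. For a tiling $D$, $h(D)$ is the number of horizontal dominoes in $D$. -}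

module Defs where

open import Data.Nat using (ℕ; zero; suc; _+_; _*_; _∸_; _%_; _/_; _≤?_; _≟_)
open import Data.Integer as ℤ using (ℤ; +_; -[1+_])
open import Data.Product using (_×_; _,_; proj₁; proj₂)
open import Data.Product.Properties using (≡-dec)
open import Data.Sum using (_⊎_)
open import Data.List using (List; []; _∷_; map; concatMap; upTo; filter; length; _++_; foldr)
open import Data.Bool.ListAction using (any)
open import Data.Bool using (Bool; true; false; if_then_else_)
open import Relation.Binary.PropositionalEquality using (_≡_)
open import Relation.Nullary using (Dec; yes; no; ¬_)
open import Relation.Nullary.Decidable using (_⊎-dec_; ⌊_⌋)
open import Data.List.Relation.Unary.All using (All)

Square : Set
Square = ℕ × ℕ

_≟ˢ_ : (s t : Square) → Dec (s ≡ t)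
_≟ˢ_ = ≡-dec _≟_ _≟_

-- A domino is a two-element set {s , t}; we represent it by the pair (s , t).
Domino : Set
Domino = Square × Square

_∈ᵈ_ : Square → Domino → Set
s ∈ᵈ d = (s ≡ proj₁ d) ⊎ (s ≡ proj₂ d)

_∈ᵈ?_ : (s : Square) (d : Domino) → Dec (s ∈ᵈ d)
s ∈ᵈ? d = (s ≟ˢ proj₁ d) ⊎-dec (s ≟ˢ proj₂ d)

[_] : ℕ → List ℕ
[ k ] = map suc (upTo k)

squares : ℕ → ℕ → List Square
squares a b = concatMap (λ i → map (λ j → (i , j)) [ b ]) [ a ]

-- All dominoes contained in R_{a,b} (pairs of adjacent squares of R_{a,b}),
-- each listed exactly once: horizontal {(i,j),(i+1,j)} and vertical {(i,j),(i,j+1)}.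
horizontalDominoes : ℕ → ℕ → List Domino
horizontalDominoes a b =
  concatMap (λ i → map (λ j → ((i , j) , (suc i , j))) [ b ]) [ a ∸ 1 ]

verticalDominoes : ℕ → ℕ → List Domino
verticalDominoes a b =
  concatMap (λ i → map (λ j → ((i , j) , (i , suc j))) [ b ∸ 1 ]) [ a ]

dominoes : ℕ → ℕ → List Domino
dominoes a b = horizontalDominoes a b ++ verticalDominoes a b

-- all sublists (= all subsets, since the list has no duplicates)
sublists : {A : Set} → List A → List (List A)
sublists [] = [] ∷ []
sublists (x ∷ xs) = map (x ∷_) (sublists xs) ++ sublists xs

coverCount : Square → List Domino → ℕ
coverCount s D = length (filter (s ∈ᵈ?_) D)

IsTiling : ℕ → ℕ → List Domino → Set
IsTiling a b D = All (λ s → coverCount s D ≡ 1) (squares a b)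

isTiling? : (a b : ℕ) (D : List Domino) → Dec (IsTiling a b D)
isTiling? a b D = Data.List.Relation.Unary.All.all? (λ s → coverCount s D ≟ 1) (squares a b)
  where import Data.List.Relation.Unary.All

tilings : ℕ → ℕ → List (List Domino)
tilings a b = filter (isTiling? a b) (sublists (dominoes a b))

IsHorizontal : Domino → Set
IsHorizontal d = proj₂ (proj₁ d) ≡ proj₂ (proj₂ d)

isHorizontal? : (d : Domino) → Dec (IsHorizontal d)
isHorizontal? d = proj₂ (proj₁ d) ≟ proj₂ (proj₂ d)

h : List Domino → ℕ
h D = length (filter isHorizontal? D)

-- Gaussian integers ℤ[√-1] as pairs (real part , imaginary part)

ℤi : Set
ℤi = ℤ × ℤ

_+ᵍ_ : ℤi → ℤi → ℤi
(a , b) +ᵍ (c , d) = (a ℤ.+ c , b ℤ.+ d)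

0ᵍ : ℤi
0ᵍ = (+ 0 , + 0)

toℤi : ℤ → ℤi
toℤi z = (z , + 0)

iPow : ℕ → ℤi
iPow zero = (+ 1 , + 0)
iPow (suc k) with iPow k
... | (a , b) = (ℤ.- b , a)      -- multiplication by √-1

dominoSum : ℕ → ℕ → ℤi
dominoSum a b = foldr (λ D acc → iPow (h D) +ᵍ acc) 0ᵍ (tilings a b)

legendre : ℕ → (p : ℕ) → ℤ
legendre a zero = + 0
legendre a (suc q) with a % suc q ≟ 0
... | yes _ = + 0
... | no _ = if any (λ x → ⌊ (x * x) % suc q ≟ a % suc q ⌋) (upTo (suc q))
             then + 1 else -[1+ 0 ]

-- smallest divisor d ≥ 2 of n (searched in 2 … n); this is a prime when n ≥ 2.
-- smallestFactorPred returns d' with d = suc d' (to make division total).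
smallestFactorPredFrom : (fuel d n : ℕ) → ℕ
smallestFactorPredFrom zero d n = n ∸ 1
smallestFactorPredFrom (suc f) d n with n % suc d ≟ 0
... | yes _ = d
... | no _ = smallestFactorPredFrom f (suc d) n

spf : ℕ → ℕ
spf n = suc (smallestFactorPredFrom n 1 n)

-- Jacobi symbol (a/n) = ∏ (a/p_k) over the prime factorisation n = p_1 ⋯ p_r
-- (with multiplicity), computed by repeatedly splitting off the smallest
-- prime factor; fuel n is enough since n/p ≤ n/2.
jacobiAux : (fuel a n : ℕ) → ℤ
jacobiAux zero a n = + 1
jacobiAux (suc f) a zero = + 1
jacobiAux (suc f) a (suc zero) = + 1
jacobiAux (suc f) a (suc (suc k)) =
  legendre a (spf (suc (suc k))) ℤ.* jacobiAux f a (suc (suc k) / spf (suc (suc k)))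

jacobi : ℕ → ℕ → ℤ
jacobi a n = jacobiAux n a n

module Submission where

-- Write N = n − 1. A transfer operator T on the functions on subsets of a column of height N adds one column
-- to the board; the powers of √-1 are absorbed by giving horizontal dominoes the sign of their row, because the
-- horizontal dominoes of a tiling split equally between odd and even rows when N is even. Conjugation by T is
-- linear on fermionic creation and annihilation operators and is a discrete wave equation there, with Dirichlet
-- conditions at rows 0 and n. D'Alembert's formula shows that every annihilation operator kills T^n applied to
-- the vacuum, so T^n multiplies the vacuum by a scalar ε. With F(m,n) the sum over the tilings, this gives
-- F(m+n,n) = ε F(m,n); inverting T gives F(n−m,n) = ± ε F(m,n); transposing the board gives F(m,n) = ± F(n,m)
-- for odd m and n. These rules run a Euclidean algorithm which the Jacobi symbol obeys as well, with ε = (2/n),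
-- once quadratic reciprocity is known. For primes, reciprocity is proved by Gauss's lemma and Eisenstein's lattice
-- count, Euler's criterion resting on Lagrange's bound for the number of roots of x^h − 1 modulo p = 2h + 1.

open import Defs
open import Data.Nat using (ℕ; zero; suc; s≤s; z≤n; _≤_; _<_; _∸_; _%_; _/_; NonZero; NonTrivial; ⌊_/2⌋)
import Data.Nat.Base as ℕ
import Data.Nat.Properties as ℕ
import Data.Nat.Divisibility as ℕ
import Data.Nat.DivMod as ℕ
import Data.Nat.Tactic.RingSolver as ℕ-Ring
open import Data.Nat.Induction using (<-rec)
open import Data.Nat.ListAction using (product)
open import Data.Nat.ListAction.Properties using (∈⇒∣product)
open import Data.Nat.Primality using (Prime; _Rough_; 2-rough; ∤⇒rough-suc; rough⇒≤; rough∧∣⇒prime; prime⇒nonTrivial; prime⇒irreducible; ¬prime[1]; euclidsLemma)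
open import Data.Integer.Base using (ℤ; +_; -[1+_]; _+_; _*_; -_; 0ℤ; 1ℤ; -1ℤ; _-_; _⊖_; _^_; ∣_∣)
open import Data.Integer.Properties
open import Data.Integer.Divisibility.Signed using (_∣_; divides; ∣⇒∣ᵤ; ∣ᵤ⇒∣; ∣m⇒∣-m; ∣m∣n⇒∣m+n; ∣m∣n⇒∣m-n; ∣n⇒∣m*n; ∣m⇒∣m*n)
open import Data.Integer.Tactic.RingSolver using (solve-∀)
open import Data.Bool.Base using (Bool; true; false; not; _∨_; if_then_else_)
open import Data.Bool.ListAction using (any)
open import Data.Empty using (⊥)
open import Data.List.Base as List using (List; []; _∷_; _++_; upTo; applyUpTo; cartesianProduct; concatMap; foldr; filter; length)
import Data.List.Properties as List
open import Data.List.Membership.Propositional using (_∈_)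
open import Data.List.Membership.Propositional.Properties using (∈-cartesianProduct⁺; ∈-cartesianProduct⁻; ∈-upTo⁺; ∈-upTo⁻; ∈-map⁺; ∈-map⁻; ∈-∃++; ∈-++⁺ˡ; ∈-++⁺ʳ; ∈-++⁻; ∈-applyUpTo⁺; ∈-applyUpTo⁻)
open import Data.List.Relation.Unary.Any using (here; there)
open import Data.List.Relation.Unary.All as All using (All; []; _∷_)
import Data.List.Relation.Unary.All.Properties as All
open import Data.List.Relation.Unary.AllPairs using (AllPairs; []; _∷_)
import Data.List.Relation.Unary.AllPairs.Properties as AllPairs
open import Data.List.Relation.Unary.Unique.Propositional using (Unique)
import Data.List.Relation.Unary.Unique.Propositional.Properties as Unique
open import Data.List.Relation.Binary.Permutation.Propositional as Perm using (_↭_; ↭-refl; ↭-sym; ↭-trans; ↭-reflexive)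
import Data.List.Relation.Binary.Permutation.Propositional.Properties as Perm
open import Data.Product using (_×_; _,_; proj₁; proj₂; ∃-syntax; swap)
open import Data.Sum.Base using (_⊎_; inj₁; inj₂)
open import Data.Unit.Base using (⊤; tt)
open import Data.Vec.Base as Vec using (Vec; []; _∷_; replicate; map)
open import Data.Vec.Properties using (map-replicate)
open import Function.Base using (_∘_)
open import Relation.Binary.Definitions using (tri<; tri≈; tri>)
open import Relation.Binary.PropositionalEquality hiding ([_])
open import Relation.Nullary using (¬_; Dec; yes; no; does; contradiction)
open import Relation.Nullary.Decidable using (dec-true; dec-false; ⌊_⌋)
open import Relation.Unary using (Pred; Decidable)
open import Algebra.Bundles using (CommutativeMonoid)
open import Level using (0ℓ)

-- The fermionic Fock space on a column of squares

-- The row signs of the horizontal dominoes are chosen so that they combine with the Jordan-Wigner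
-- signs to the constant `σ N`, whatever the row (`ann-T`, `cre-T`). For even N this constant is 1,
-- which is what makes conjugation by T the same in every row and keeps all arithmetic in the
-- integers. The inverse of T comes from particle-hole conjugation, the exchange of covered and free
-- squares; negative widths thereby become positive ones. The eigenvalue ε is not read off from a
-- board directly. The board with m = n + 2, treated once by periodicity and once by transposition
-- followed by reflection, expresses ε for n + 2 through ε for n, and quadratic reciprocity gives
-- (2/n) the same recursion. Transposition is available only when width and height are both even. A
-- board of odd width is therefore reflected first, which makes its width even. As a transposed
-- board is wider than it is high, the induction on the height has to cover all widths at once.

Fock : ℕ → Set
Fock N = Vec Bool N → ℤ

variable
  N : ℕ

infix 20 _↾_
_↾_ : Fock (suc N) → Bool → Fock N
(φ ↾ b) s = φ (b ∷ s)

σ : ℕ → ℤ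
σ zero    = 1ℤ
σ (suc n) = - σ n

-- Rows are counted from the head of the vector, starting with 1; row 0 carries the zero operator, which supplies
-- the Dirichlet condition below. The signs are those of the Jordan–Wigner transformation.
ann : ℕ → Fock N → Fock N
ann zero          φ s           = 0ℤ
ann (suc j)       φ []          = 0ℤ
ann (suc zero)    φ (false ∷ s) = φ (true ∷ s)
ann (suc zero)    φ (true ∷ s)  = 0ℤ
ann (suc (suc j)) φ (false ∷ s) = ann (suc j) (φ ↾ false) s
ann (suc (suc j)) φ (true ∷ s)  = - ann (suc j) (φ ↾ true) s

cre : ℕ → Fock N → Fock N
cre zero          φ s           = 0ℤ
cre (suc j)       φ []          = 0ℤ
cre (suc zero)    φ (false ∷ s) = 0ℤ
cre (suc zero)    φ (true ∷ s)  = φ (false ∷ s)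
cre (suc (suc j)) φ (false ∷ s) = cre (suc j) (φ ↾ false) s
cre (suc (suc j)) φ (true ∷ s)  = - cre (suc j) (φ ↾ true) s

-- The set s consists of the squares of a column covered by horizontal dominoes from the column on its right. The
-- head of s is the top row, so a horizontal domino in it has the sign of its height suc N. A vertical domino from
-- a free head square covers the next square, which is what ann 1 expresses.
T : Fock N → Fock N
T         φ []          = φ []
T         φ (true ∷ s)  = T (φ ↾ false) s
T {suc N} φ (false ∷ s) = σ (suc N) * T (φ ↾ true) s + ann 1 (T (φ ↾ false)) s

σ² : ∀ n → σ n * σ n ≡ 1ℤ
σ² zero    = refl
σ² (suc n) = trans (lem (σ n)) (σ² n)
  where lem : ∀ x → - x * - x ≡ x * x
        lem = solve-∀

ann-cong : ∀ j {φ ψ : Fock N} → φ ≗ ψ → ann j φ ≗ ann j ψ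
ann-cong zero          e s           = refl
ann-cong (suc j)       e []          = refl
ann-cong (suc zero)    e (false ∷ s) = e _
ann-cong (suc zero)    e (true ∷ s)  = refl
ann-cong (suc (suc j)) e (false ∷ s) = ann-cong (suc j) (e ∘ _) s
ann-cong (suc (suc j)) e (true ∷ s)  = cong -_ (ann-cong (suc j) (e ∘ _) s)


ann-zero : ∀ j (s : Vec Bool N) → ann j (λ _ → 0ℤ) s ≡ 0ℤ
ann-zero zero          s           = refl
ann-zero (suc j)       []          = refl
ann-zero (suc zero)    (false ∷ s) = refl
ann-zero (suc zero)    (true ∷ s)  = refl
ann-zero (suc (suc j)) (false ∷ s) = ann-zero (suc j) s
ann-zero (suc (suc j)) (true ∷ s)  = cong -_ (ann-zero (suc j) s)

cre-zero : ∀ j (s : Vec Bool N) → cre j (λ _ → 0ℤ) s ≡ 0ℤ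
cre-zero zero          s           = refl
cre-zero (suc j)       []          = refl
cre-zero (suc zero)    (false ∷ s) = refl
cre-zero (suc zero)    (true ∷ s)  = refl
cre-zero (suc (suc j)) (false ∷ s) = cre-zero (suc j) s
cre-zero (suc (suc j)) (true ∷ s)  = cong -_ (cre-zero (suc j) s)

zero-combination : ∀ x → 0ℤ ≡ x * 0ℤ + 0ℤ
zero-combination = solve-∀

neg-combination : ∀ x a b → - (x * a + b) ≡ x * - a + - b
neg-combination = solve-∀

-- The shape `x * φ + ψ` is that of the clause of `T` for a free head square, to which linearity is
-- mostly applied.
ann-linear : ∀ j x (φ ψ : Fock N) s →
  ann j (λ t → x * φ t + ψ t) s ≡ x * ann j φ s + ann j ψ s
ann-linear zero          x φ ψ s           = zero-combination x
ann-linear (suc j)       x φ ψ []          = zero-combination x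
ann-linear (suc zero)    x φ ψ (false ∷ s) = refl
ann-linear (suc zero)    x φ ψ (true ∷ s)  = zero-combination x
ann-linear (suc (suc j)) x φ ψ (false ∷ s) = ann-linear (suc j) x (φ ↾ false) (ψ ↾ false) s
ann-linear (suc (suc j)) x φ ψ (true ∷ s)  =
  trans (cong -_ (ann-linear (suc j) x (φ ↾ true) (ψ ↾ true) s)) (neg-combination x _ _)

cre-linear : ∀ j x (φ ψ : Fock N) s →
  cre j (λ t → x * φ t + ψ t) s ≡ x * cre j φ s + cre j ψ s
cre-linear zero          x φ ψ s           = zero-combination x
cre-linear (suc j)       x φ ψ []          = zero-combination x
cre-linear (suc zero)    x φ ψ (false ∷ s) = zero-combination x
cre-linear (suc zero)    x φ ψ (true ∷ s)  = refl
cre-linear (suc (suc j)) x φ ψ (false ∷ s) = cre-linear (suc j) x (φ ↾ false) (ψ ↾ false) s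
cre-linear (suc (suc j)) x φ ψ (true ∷ s)  =
  trans (cong -_ (cre-linear (suc j) x (φ ↾ true) (ψ ↾ true) s)) (neg-combination x _ _)

cre-cong : ∀ j {φ ψ : Fock N} → φ ≗ ψ → cre j φ ≗ cre j ψ
cre-cong zero          e s           = refl
cre-cong (suc j)       e []          = refl
cre-cong (suc zero)    e (false ∷ s) = refl
cre-cong (suc zero)    e (true ∷ s)  = e _
cre-cong (suc (suc j)) e (false ∷ s) = cre-cong (suc j) (e ∘ _) s
cre-cong (suc (suc j)) e (true ∷ s)  = cong -_ (cre-cong (suc j) (e ∘ _) s)

T-cong : {φ ψ : Fock N} → φ ≗ ψ → T φ ≗ T ψ
T-cong e []          = e []
T-cong e (true ∷ s)  = T-cong (e ∘ _) s
T-cong {suc N} e (false ∷ s) =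
  cong₂ (λ x y → σ (suc N) * x + y) (T-cong (e ∘ _) s) (ann-cong 1 (T-cong (e ∘ _)) s)

T-zero : (s : Vec Bool N) → T (λ _ → 0ℤ) s ≡ 0ℤ
T-zero []          = refl
T-zero (true ∷ s)  = T-zero s
T-zero {suc N} (false ∷ s) = trans
  (cong₂ (λ x y → σ (suc N) * x + y) (T-zero s) (trans (ann-cong 1 T-zero s) (ann-zero 1 s)))
  (sym (zero-combination (σ (suc N))))

T-linear : ∀ x (φ ψ : Fock N) s → T (λ t → x * φ t + ψ t) s ≡ x * T φ s + T ψ s
T-linear x φ ψ []          = refl
T-linear x φ ψ (true ∷ s)  = T-linear x (φ ↾ false) (ψ ↾ false) s
T-linear {suc N} x φ ψ (false ∷ s) = trans
  (cong₂ (λ u v → σ (suc N) * u + v)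
    (T-linear x (φ ↾ true) (ψ ↾ true) s)
    (trans (ann-cong 1 (T-linear x (φ ↾ false) (ψ ↾ false)) s)
           (ann-linear 1 x (T (φ ↾ false)) (T (ψ ↾ false)) s)))
  (lem (σ (suc N)) x _ _ _ _)
  where lem : ∀ c x a b a′ b′ →
              c * (x * a + b) + (x * a′ + b′) ≡ x * (c * a + a′) + (c * b + b′)
        lem = solve-∀

T-scale : ∀ x (φ : Fock N) s → T (λ t → x * φ t) s ≡ x * T φ s
T-scale x φ s = trans (T-cong (λ t → sym (+-identityʳ (x * φ t))) s)
  (trans (T-linear x φ (λ _ → 0ℤ) s) (trans (cong (λ y → x * T φ s + y) (T-zero s)) (+-identityʳ _)))

T-neg : (φ : Fock N) → ∀ s → T (λ t → - φ t) s ≡ - T φ s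
T-neg φ s = trans (T-cong (λ t → sym (-1*i≡-i (φ t))) s) (trans (T-scale -1ℤ φ s) (-1*i≡-i _))

ann-scale : ∀ j x (φ : Fock N) s → ann j (λ t → x * φ t) s ≡ x * ann j φ s
ann-scale j x φ s = trans (ann-cong j (λ t → sym (+-identityʳ (x * φ t))) s)
  (trans (ann-linear j x φ (λ _ → 0ℤ) s) (trans (cong (λ y → x * ann j φ s + y) (ann-zero j s)) (+-identityʳ _)))

-- This and the next two are the canonical anticommutation relations, with one of the two operators
-- in the head row: the recursion of `T` involves no other row.
ann-ann : ∀ j (φ : Fock N) s → ann 1 (ann (suc j) φ) s ≡ - ann (suc j) (ann 1 φ) s
ann-ann j       φ []          = refl
ann-ann zero    φ (false ∷ s) = refl
ann-ann zero    φ (true ∷ s)  = refl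
ann-ann (suc j) φ (false ∷ s) = refl
ann-ann (suc j) φ (true ∷ s)  = sym (cong (-_ ∘ -_) (ann-zero (suc j) s))

ann-cre : ∀ j (φ : Fock N) s → ann 1 (cre (suc (suc j)) φ) s ≡ - cre (suc (suc j)) (ann 1 φ) s
ann-cre j φ []          = refl
ann-cre j φ (false ∷ s) = refl
ann-cre j φ (true ∷ s)  = sym (cong (-_ ∘ -_) (cre-zero (suc j) s))

-- The one relation with anticommutator 1. On a column of height 0 both operators vanish, whence
-- `suc N`.
ann-cre₁ : (φ : Fock (suc N)) → ∀ s → ann 1 (cre 1 φ) s ≡ φ s - cre 1 (ann 1 φ) s
ann-cre₁ φ (false ∷ s) = sym (+-identityʳ (φ (false ∷ s)))
ann-cre₁ φ (true ∷ s)  = sym (+-inverseʳ (φ (true ∷ s)))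

σ-cancel : ∀ n {x y} → x ≡ σ n * y → y ≡ σ n * x
σ-cancel n {x} {y} refl = trans (sym (*-identityˡ y)) (trans (cong (_* y) (sym (σ² n))) (*-assoc (σ n) (σ n) y))

-- A square covered from the right and a square with a forced horizontal domino to the left are
-- equally lost to the rest of the column, so both sides sum over the same fillings. For the sign,
-- the `j` rows above split into squares covered from the right, squares covered towards the left
-- and vertical pairs; the two Jordan-Wigner signs therefore multiply to `σ j`, and the forced
-- domino has the sign of its height `N ∸ j`.
ann-T : ∀ j (φ : Fock N) s → ann (suc j) (T φ) s ≡ σ N * T (cre (suc j) φ) s
ann-T j       φ []          = refl
ann-T {suc N} zero    φ (true ∷ s)  = sym (trans (cong (σ (suc N) *_) (T-zero s)) (*-zeroʳ (σ (suc N))))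
ann-T {suc N} zero    φ (false ∷ s) = sym (trans
  (cong (λ x → σ (suc N) * (σ (suc N) * T (φ ↾ false) s + x)) (trans (ann-cong 1 T-zero s) (ann-zero 1 s)))
  (trans (lem (σ (suc N)) (T (φ ↾ false) s)) (trans (cong (_* T (φ ↾ false) s) (σ² (suc N))) (*-identityˡ _))))
  where lem : ∀ c x → c * (c * x + 0ℤ) ≡ (c * c) * x
        lem = solve-∀
ann-T {suc N} (suc j) φ (true ∷ s)  = trans (cong -_ (ann-T j (φ ↾ false) s)) (neg-distribˡ-* (σ N) _)
ann-T {suc N} (suc j) φ (false ∷ s) = begin
  ann (suc j) (λ t → c * T (φ ↾ true) t + ann 1 (T (φ ↾ false)) t) s
    ≡⟨ ann-linear (suc j) c (T (φ ↾ true)) (ann 1 (T (φ ↾ false))) s ⟩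
  c * ann (suc j) (T (φ ↾ true)) s + ann (suc j) (ann 1 (T (φ ↾ false))) s
    ≡⟨ cong₂ (λ x y → c * x + y) (ann-T j (φ ↾ true) s) swapped ⟩
  c * (σ N * T (cre (suc j) (φ ↾ true)) s) + - (σ N * ann 1 (T (cre (suc j) (φ ↾ false))) s)
    ≡⟨ lem (σ N) _ _ ⟩
  c * (c * - T (cre (suc j) (φ ↾ true)) s + ann 1 (T (cre (suc j) (φ ↾ false))) s)
    ≡⟨ cong (λ x → c * (c * x + ann 1 (T (cre (suc j) (φ ↾ false))) s)) (sym (T-neg (cre (suc j) (φ ↾ true)) s)) ⟩
  c * T (cre (suc (suc j)) φ) (false ∷ s) ∎
  where
  open ≡-Reasoning
  c = σ (suc N)
  lem : ∀ c x y → - c * (c * x) + - (c * y) ≡ - c * (- c * - x + y)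
  lem = solve-∀
  swapped : ann (suc j) (ann 1 (T (φ ↾ false))) s ≡ - (σ N * ann 1 (T (cre (suc j) (φ ↾ false))) s)
  swapped = begin
    ann (suc j) (ann 1 (T (φ ↾ false))) s     ≡⟨ neg-involutive _ ⟨
    - - ann (suc j) (ann 1 (T (φ ↾ false))) s ≡⟨ cong -_ (ann-ann j (T (φ ↾ false)) s) ⟨
    - ann 1 (ann (suc j) (T (φ ↾ false))) s   ≡⟨ cong -_ (ann-cong 1 (ann-T j (φ ↾ false)) s) ⟩
    - ann 1 (λ t → σ N * T (cre (suc j) (φ ↾ false)) t) s ≡⟨ cong -_ (ann-scale 1 (σ N) _ s) ⟩
    - (σ N * ann 1 (T (cre (suc j) (φ ↾ false))) s) ∎

ann₁-three : ∀ x (α β γ : Fock N) s →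
  ann 1 (λ t → x * (α t - β t + γ t)) s ≡ x * (ann 1 α s - ann 1 β s + ann 1 γ s)
ann₁-three x α β γ []          = sym (*-zeroʳ x)
ann₁-three x α β γ (false ∷ s) = refl
ann₁-three x α β γ (true ∷ s)  = sym (*-zeroʳ x)

ann₁-ann₁ : (φ : Fock N) → ∀ s → ann 1 (ann 1 φ) s ≡ 0ℤ
ann₁-ann₁ φ []          = refl
ann₁-ann₁ φ (false ∷ s) = refl
ann₁-ann₁ φ (true ∷ s)  = refl

-- Where the set contains row `suc j`, the left side frees that square, and the three terms are the
-- ways to cover it: by a horizontal domino, by a vertical one with the square below, by a vertical
-- one with the square above. For other sets the left side is 0 and the fillings on the right cancel
-- in pairs. Just outside the column the relation fails, because the term `cre j` survives at
-- `j = N`.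
cre-T : ∀ j → j < N → (φ : Fock N) → ∀ s →
  cre (suc j) (T φ) s ≡ σ N * (T (ann (suc j) φ) s - T (cre (suc (suc j)) φ) s + T (cre j φ) s)
cre-T {suc N} zero _ φ (true ∷ s) = begin
  - σ N * T (φ ↾ true) s + ann 1 (T (φ ↾ false)) s
    ≡⟨ cong₂ _+_ {x = - σ N * T (φ ↾ true) s} refl (ann-T zero (φ ↾ false) s) ⟩
  - σ N * T (φ ↾ true) s + σ N * T (cre 1 (φ ↾ false)) s
    ≡⟨ lem (σ N) _ _ ⟩
  - σ N * (T (φ ↾ true) s - T (cre 1 (φ ↾ false)) s + 0ℤ)
    ≡⟨ cong (λ z → - σ N * (T (φ ↾ true) s - T (cre 1 (φ ↾ false)) s + z)) (T-zero s) ⟨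
  - σ N * (T (φ ↾ true) s - T (cre 1 (φ ↾ false)) s + T (λ _ → 0ℤ) s) ∎
  where
  open ≡-Reasoning
  lem : ∀ c x y → - c * x + c * y ≡ - c * (x - y + 0ℤ)
  lem = solve-∀
cre-T {suc N} zero _ φ (false ∷ s) = sym (begin
  - σ N * ((- σ N * T (λ _ → 0ℤ) s + ann 1 (T (φ ↾ true)) s)
    - (- σ N * T (λ t → - cre 1 (φ ↾ true) t) s + ann 1 (T (cre 1 (φ ↾ false))) s)
    + (- σ N * T (λ _ → 0ℤ) s + ann 1 (T (λ _ → 0ℤ)) s))
    ≡⟨ cong₂ (λ x y → - σ N * ((- σ N * x + ann 1 (T (φ ↾ true)) s)
                 - (- σ N * T (λ t → - cre 1 (φ ↾ true) t) s + ann 1 (T (cre 1 (φ ↾ false))) s)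
                 + (- σ N * x + y))) (T-zero s) (trans (ann-cong 1 T-zero s) (ann-zero 1 s)) ⟩
  - σ N * ((- σ N * 0ℤ + ann 1 (T (φ ↾ true)) s)
    - (- σ N * T (λ t → - cre 1 (φ ↾ true) t) s + ann 1 (T (cre 1 (φ ↾ false))) s)
    + (- σ N * 0ℤ + 0ℤ))
    ≡⟨ cong₂ (λ x y → - σ N * ((- σ N * 0ℤ + ann 1 (T (φ ↾ true)) s) - (- σ N * x + y) + (- σ N * 0ℤ + 0ℤ)))
         (trans (T-neg (cre 1 (φ ↾ true)) s) (cong -_ (σ-cancel N (ann-T zero (φ ↾ true) s))))
         (trans (ann-cong 1 (λ t → σ-cancel N (ann-T zero (φ ↾ false) t)) s)
           (trans (ann-scale 1 (σ N) _ s) (cong (σ N *_) (ann₁-ann₁ (T (φ ↾ false)) s)))) ⟩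
  - σ N * ((- σ N * 0ℤ + a) - (- σ N * - (σ N * a) + σ N * 0ℤ) + (- σ N * 0ℤ + 0ℤ))
    ≡⟨ lem (σ N) a ⟩
  σ N * ((σ N * σ N) * a - a)
    ≡⟨ cong (λ x → σ N * (x * a - a)) (σ² N) ⟩
  σ N * (1ℤ * a - a)
    ≡⟨ lem′ (σ N) a ⟩
  0ℤ ∎)
  where
  open ≡-Reasoning
  a = ann 1 (T (φ ↾ true)) s
  lem : ∀ c a → - c * ((- c * 0ℤ + a) - (- c * - (c * a) + c * 0ℤ) + (- c * 0ℤ + 0ℤ)) ≡ c * ((c * c) * a - a)
  lem = solve-∀
  lem′ : ∀ c a → c * (1ℤ * a - a) ≡ 0ℤ
  lem′ = solve-∀
cre-T {suc N} (suc i) (s≤s i<N) φ (true ∷ s) = begin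
  - cre (suc i) (T (φ ↾ false)) s
    ≡⟨ cong -_ (cre-T i i<N (φ ↾ false) s) ⟩
  - (σ N * (T (ann (suc i) (φ ↾ false)) s - T (cre (suc (suc i)) (φ ↾ false)) s + T (cre i (φ ↾ false)) s))
    ≡⟨ neg-distribˡ-* (σ N) _ ⟩
  - σ N * (T (ann (suc i) (φ ↾ false)) s - T (cre (suc (suc i)) (φ ↾ false)) s + T (cre i (φ ↾ false)) s)
    ≡⟨ cong (λ z → - σ N * (T (ann (suc i) (φ ↾ false)) s - T (cre (suc (suc i)) (φ ↾ false)) s + z)) (low i) ⟩
  - σ N * (T (ann (suc i) (φ ↾ false)) s - T (cre (suc (suc i)) (φ ↾ false)) s + T (cre (suc i) φ) (true ∷ s)) ∎
  where
  open ≡-Reasoning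
  low : ∀ i → T (cre i (φ ↾ false)) s ≡ T (cre (suc i) φ) (true ∷ s)
  low zero    = refl
  low (suc i) = refl
cre-T {suc N} (suc i) (s≤s i<N) φ (false ∷ s) = begin
  cre (suc i) (λ t → - σ N * T (φ ↾ true) t + ann 1 (T (φ ↾ false)) t) s
    ≡⟨ cre-linear (suc i) (- σ N) (T (φ ↾ true)) (ann 1 (T (φ ↾ false))) s ⟩
  - σ N * cre (suc i) (T (φ ↾ true)) s + cre (suc i) (ann 1 (T (φ ↾ false))) s
    ≡⟨ cong₂ (λ x y → - σ N * x + y) (cre-T i i<N (φ ↾ true) s) (swapped i i<N) ⟩
  - σ N * (σ N * (a₁ - b₁ + c₁)) + (extra i - σ N * (a₀ - b₀ + c₀))
    ≡⟨ lem (σ N) a₁ b₁ c₁ a₀ b₀ c₀ (extra i) ⟩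
  - σ N * ((- σ N * - a₁ + a₀) - (- σ N * - b₁ + b₀) + (- σ N * - c₁ + c₀)) + extra i
    ≡⟨ cong₂ (λ x y → - σ N * ((- σ N * x + a₀) - (- σ N * y + b₀) + (- σ N * - c₁ + c₀)) + extra i)
         (T-neg (ann (suc i) (φ ↾ true)) s) (T-neg (cre (suc (suc i)) (φ ↾ true)) s) ⟨
  - σ N * (A - B + (- σ N * - c₁ + c₀)) + extra i
    ≡⟨ low i ⟩
  - σ N * (A - B + T (cre (suc i) φ) (false ∷ s)) ∎
  where
  open ≡-Reasoning
  A = T (ann (suc (suc i)) φ) (false ∷ s)
  B = T (cre (suc (suc (suc i))) φ) (false ∷ s)
  a₁ = T (ann (suc i) (φ ↾ true)) s
  b₁ = T (cre (suc (suc i)) (φ ↾ true)) s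
  c₁ = T (cre i (φ ↾ true)) s
  a₀ = ann 1 (T (ann (suc i) (φ ↾ false))) s
  b₀ = ann 1 (T (cre (suc (suc i)) (φ ↾ false))) s
  c₀ = ann 1 (T (cre i (φ ↾ false))) s
  -- The term from the anticommutator 1 of `ann 1` and `cre 1`; it arises only in the second row.
  -- `low` recognises it as the term of `T (cre 1 φ)` with a horizontal domino in the head row.
  extra : ℕ → ℤ
  extra zero    = T (φ ↾ false) s
  extra (suc _) = 0ℤ
  lem : ∀ c a₁ b₁ c₁ a₀ b₀ c₀ e →
    - c * (c * (a₁ - b₁ + c₁)) + (e - c * (a₀ - b₀ + c₀))
    ≡ - c * ((- c * - a₁ + a₀) - (- c * - b₁ + b₀) + (- c * - c₁ + c₀)) + e
  lem = solve-∀
  hop : ∀ i → i < N → ann 1 (cre (suc i) (T (φ ↾ false))) s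
          ≡ σ N * (ann 1 (T (ann (suc i) (φ ↾ false))) s
                   - ann 1 (T (cre (suc (suc i)) (φ ↾ false))) s + ann 1 (T (cre i (φ ↾ false))) s)
  hop i i<N = trans (ann-cong 1 (cre-T i i<N (φ ↾ false)) s)
                    (ann₁-three (σ N) (T (ann (suc i) (φ ↾ false))) (T (cre (suc (suc i)) (φ ↾ false))) (T (cre i (φ ↾ false))) s)
  flip : ∀ {x y : ℤ} → x ≡ - y → y ≡ - x
  flip {y = y} refl = sym (neg-involutive y)
  swapped : ∀ i → i < N → cre (suc i) (ann 1 (T (φ ↾ false))) s
          ≡ extra i - σ N * (ann 1 (T (ann (suc i) (φ ↾ false))) s
                   - ann 1 (T (cre (suc (suc i)) (φ ↾ false))) s + ann 1 (T (cre i (φ ↾ false))) s)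
  swapped zero i<N@(s≤s _) = trans (lem′ (T (φ ↾ false) s) _) (trans
    (cong (λ x → T (φ ↾ false) s - x) (sym (ann-cre₁ (T (φ ↾ false)) s)))
    (cong (λ x → T (φ ↾ false) s - x) (hop zero i<N)))
    where
    lem′ : ∀ x y → y ≡ x - (x - y)
    lem′ = solve-∀
  swapped (suc i) i<N = trans (flip (ann-cre i (T (φ ↾ false)) s))
    (trans (cong -_ (hop (suc i) i<N)) (sym (+-identityˡ _)))
  low : ∀ i → - σ N * (A - B + (- σ N * - T (cre i (φ ↾ true)) s + ann 1 (T (cre i (φ ↾ false))) s)) + extra i
      ≡ - σ N * (A - B + T (cre (suc i) φ) (false ∷ s))
  low zero = begin
    - σ N * (A - B + (- σ N * - T (λ _ → 0ℤ) s + ann 1 (T (λ _ → 0ℤ)) s)) + e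
      ≡⟨ cong₂ (λ x y → - σ N * (A - B + (- σ N * - x + y)) + e) (T-zero s) (trans (ann-cong 1 T-zero s) (ann-zero 1 s)) ⟩
    - σ N * (A - B + (- σ N * - 0ℤ + 0ℤ)) + e
      ≡⟨ cong₂ _+_ {x = - σ N * (A - B + (- σ N * - 0ℤ + 0ℤ))} refl (trans (sym (*-identityˡ e)) (cong (_* e) (sym (σ² N)))) ⟩
    - σ N * (A - B + (- σ N * - 0ℤ + 0ℤ)) + (σ N * σ N) * e
      ≡⟨ lem″ (σ N) (A - B) e ⟩
    - σ N * (A - B + (- σ N * e + 0ℤ))
      ≡⟨ cong (λ y → - σ N * (A - B + (- σ N * e + y))) (trans (ann-cong 1 T-zero s) (ann-zero 1 s)) ⟨
    - σ N * (A - B + (- σ N * e + ann 1 (T (λ _ → 0ℤ)) s)) ∎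
    where
    e = T (φ ↾ false) s
    lem″ : ∀ c d e → - c * (d + (- c * - 0ℤ + 0ℤ)) + (c * c) * e ≡ - c * (d + (- c * e + 0ℤ))
    lem″ = solve-∀
  low (suc i) = trans (+-identityʳ _)
    (cong (λ z → - σ N * (A - B + (- σ N * z + ann 1 (T (cre (suc i) (φ ↾ false))) s))) (sym (T-neg (cre (suc i) (φ ↾ true)) s)))

-- The wave equation and the quasi-periodicity of the transfer operator

-- Position is `j` and time is `k`. In the application `w j k` is `T^ (n ∸ k) (ann j (T^ k vac))` at
-- a fixed set, the outer power making values at different times comparable. The data at time 1 stay
-- arbitrary: the vanishing at time `n` is due to the two reflections alone.
module DiscreteWave (n : ℕ) (w : ℕ → ℕ → ℤ)
  (w-bottom : ∀ k → w 0 k ≡ 0ℤ)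
  (w-top : ∀ k → k ≤ n → w n k ≡ 0ℤ)
  (w-start : ∀ j → w j 0 ≡ 0ℤ)
  (w-step : ∀ j k → suc j < n → suc (suc k) ≤ n →
    w (suc j) (suc (suc k)) ≡ w (suc j) k - w (suc (suc j)) (suc k) + w j (suc k))
  where

  -- The recursion is d'Alembert's formula at time 1, solved for the latest value; the two initial
  -- zeros are constants of integration.
  profile : ℕ → ℤ
  profile 0             = 0ℤ
  profile 1             = 0ℤ
  profile (suc (suc x)) = w (suc x) 1 - profile x

  -- D'Alembert's solution is a combination of functions of j − k and of j + k; both are determined by the profile
  -- through the reflections at 0 and at n, the latter giving outgoing.
  incoming : ℤ → ℤ
  incoming (+ x)    = profile x
  incoming -[1+ x ] = σ (suc x) * profile (suc x)

  outgoing : ℕ → ℤ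
  outgoing x = σ (x ∸ n) * profile (n ∸ ℕ.∣ n - x ∣)

  closed : ℕ → ℕ → ℤ
  closed j k = incoming (j ⊖ k) - σ k * outgoing (j ℕ.+ k)

  outgoing-below : ∀ {x} → x ≤ n → outgoing x ≡ profile x
  outgoing-below {x} x≤n = begin
    σ (x ∸ n) * profile (n ∸ ℕ.∣ n - x ∣)
      ≡⟨ cong₂ (λ i j → σ i * profile (n ∸ j)) (ℕ.m≤n⇒m∸n≡0 x≤n) (ℕ.m≤n⇒∣n-m∣≡n∸m x≤n) ⟩
    1ℤ * profile (n ∸ (n ∸ x))
      ≡⟨ *-identityˡ _ ⟩
    profile (n ∸ (n ∸ x))
      ≡⟨ cong profile (ℕ.m∸[m∸n]≡n x≤n) ⟩
    profile x ∎
    where open ≡-Reasoning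

  outgoing-above : ∀ t → outgoing (n ℕ.+ t) ≡ σ t * profile (n ∸ t)
  outgoing-above t = cong₂ (λ i j → σ i * profile (n ∸ j)) (ℕ.m+n∸m≡n n t) (ℕ.∣m-m+n∣≡n n t)

  incoming-diff : ∀ {j k} → k ≤ j → incoming (j ⊖ k) ≡ profile (j ∸ k)
  incoming-diff k≤j = cong incoming (⊖-≥ k≤j)

  incoming-neg : ∀ k → incoming (0 ⊖ k) ≡ σ k * profile k
  incoming-neg zero    = refl
  incoming-neg (suc k) = refl

  incoming-reverse : ∀ {j k} → j ≤ k → incoming (j ⊖ k) ≡ σ (k ∸ j) * profile (k ∸ j)
  incoming-reverse {j} {k} j≤k = trans (cong incoming (trans (⊖-≤ j≤k) (sym (⊖-≤ {0} z≤n)))) (incoming-neg (k ∸ j))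

  closed-bottom : ∀ k → k ≤ n → closed 0 k ≡ 0ℤ
  closed-bottom k k≤n =
    trans (cong₂ (λ x y → x - σ k * y) (incoming-neg k) (outgoing-below k≤n)) (+-inverseʳ (σ k * profile k))

  closed-top : ∀ k → k ≤ n → closed n k ≡ 0ℤ
  closed-top k k≤n = begin
    incoming (n ⊖ k) - σ k * outgoing (n ℕ.+ k)
      ≡⟨ cong₂ (λ x y → x - σ k * y) (incoming-diff k≤n) (outgoing-above k) ⟩
    profile (n ∸ k) - σ k * (σ k * profile (n ∸ k))
      ≡⟨ cong (λ x → profile (n ∸ k) - x) (sym (σ-cancel k refl)) ⟩
    profile (n ∸ k) - profile (n ∸ k)
      ≡⟨ +-inverseʳ (profile (n ∸ k)) ⟩
    0ℤ ∎
    where open ≡-Reasoning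

  closed-start : ∀ j → j ≤ n → closed j 0 ≡ 0ℤ
  closed-start j j≤n = begin
    incoming (j ⊖ 0) - 1ℤ * outgoing (j ℕ.+ 0)
      ≡⟨ cong₂ (λ x y → x - 1ℤ * outgoing y) (incoming-diff {j} z≤n) (ℕ.+-identityʳ j) ⟩
    profile j - 1ℤ * outgoing j
      ≡⟨ cong (λ x → profile j - 1ℤ * x) (outgoing-below j≤n) ⟩
    profile j - 1ℤ * profile j
      ≡⟨ lem (profile j) ⟩
    0ℤ ∎
    where
    open ≡-Reasoning
    lem : ∀ x → x - 1ℤ * x ≡ 0ℤ
    lem = solve-∀

  closed-first : ∀ j → suc j < n → closed (suc j) 1 ≡ w (suc j) 1
  closed-first j j<n = begin
    incoming (suc j ⊖ 1) - -1ℤ * outgoing (suc j ℕ.+ 1)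
      ≡⟨ cong₂ (λ x y → x - -1ℤ * outgoing y) (incoming-diff {suc j} (s≤s z≤n)) (ℕ.+-comm (suc j) 1) ⟩
    profile j - -1ℤ * outgoing (suc (suc j))
      ≡⟨ cong (λ x → profile j - -1ℤ * x) (outgoing-below j<n) ⟩
    profile j - -1ℤ * (w (suc j) 1 - profile j)
      ≡⟨ lem (profile j) (w (suc j) 1) ⟩
    w (suc j) 1 ∎
    where
    open ≡-Reasoning
    lem : ∀ x y → x - -1ℤ * (y - x) ≡ y
    lem = solve-∀

  -- Each wave solves the equation by itself. For a function of `j − k` the first two terms on the
  -- right cancel; for `σ k` times a function of `j + k` the first and the last do, and the
  -- remaining minus sign is the reason for the factor `σ k`.
  closed-step : ∀ j k →
    closed (suc j) (suc (suc k)) ≡ closed (suc j) k - closed (suc (suc j)) (suc k) + closed j (suc k)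
  closed-step j k = begin
    incoming (suc j ⊖ suc (suc k)) - - - σ k * outgoing (suc j ℕ.+ suc (suc k))
      ≡⟨ cong₂ (λ x y → incoming x - - - σ k * outgoing y) ([1+m]⊖[1+n]≡m⊖n j (suc k)) (ℕ.+-suc (suc j) (suc k)) ⟩
    a - - - σ k * b
      ≡⟨ lem (incoming (suc j ⊖ k)) (σ k) (outgoing (suc j ℕ.+ k)) a b ⟩
    closed (suc j) k - (incoming (suc j ⊖ k) - - σ k * b) + (a - - σ k * outgoing (suc j ℕ.+ k))
      ≡⟨ cong₂ (λ x y → closed (suc j) k - (incoming x - - σ k * b) + (a - - σ k * outgoing y))
           (sym ([1+m]⊖[1+n]≡m⊖n (suc j) k)) (sym (ℕ.+-suc j k)) ⟩
    closed (suc j) k - closed (suc (suc j)) (suc k) + closed j (suc k) ∎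
    where
    open ≡-Reasoning
    a = incoming (j ⊖ suc k)
    b = outgoing (suc (suc j) ℕ.+ suc k)
    lem : ∀ x c y a b → a - - - c * b ≡ (x - c * y) - (x - - c * b) + (a - - c * y)
    lem = solve-∀

  solution-interior : ∀ k → suc k ≤ n →
    (∀ j → suc j < n → w (suc j) (suc k) ≡ closed (suc j) (suc k)) →
    ∀ j → j ≤ n → w j (suc k) ≡ closed j (suc k)
  solution-interior k k<n interior zero    _   = trans (w-bottom _) (sym (closed-bottom (suc k) k<n))
  solution-interior k k<n interior (suc j) j≤n with ℕ.m≤n⇒m<n∨m≡n j≤n
  ... | inj₁ j<n  = interior j j<n
  ... | inj₂ refl = trans (w-top _ k<n) (sym (closed-top (suc k) k<n))

  solution : ∀ k → k ≤ n → ∀ j → j ≤ n → w j k ≡ closed j k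
  solution zero          _   j j≤n = trans (w-start j) (sym (closed-start j j≤n))
  solution (suc zero)    k<n = solution-interior 0 k<n (λ j j<n → sym (closed-first j j<n))
  solution (suc (suc k)) k<n = solution-interior (suc k) k<n λ j j<n →
    trans (w-step j k j<n k<n) (trans
      (cong₂ (λ x y → x + y)
        (cong₂ _-_ (solution k (ℕ.≤-trans (ℕ.n≤1+n k) k<n′) (suc j) (ℕ.<⇒≤ j<n)) (solution (suc k) k<n′ (suc (suc j)) j<n))
        (solution (suc k) k<n′ j (ℕ.≤-trans (ℕ.n≤1+n j) (ℕ.<⇒≤ j<n))))
      (sym (closed-step j k)))
    where k<n′ = ℕ.<⇒≤ k<n

  -- At time `n` one wave has been reflected at 0 and the other at `n`; both then show the profile
  -- at `n ∸ j`, with equal signs, and their difference vanishes.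
  extinct : ∀ j → j ≤ n → w j n ≡ 0ℤ
  extinct j j≤n = begin
    w j n
      ≡⟨ solution n ℕ.≤-refl j j≤n ⟩
    incoming (j ⊖ n) - σ n * outgoing (j ℕ.+ n)
      ≡⟨ cong₂ (λ x y → x - σ n * y) (incoming-reverse j≤n) (trans (cong outgoing (ℕ.+-comm j n)) (outgoing-above j)) ⟩
    σ (n ∸ j) * profile (n ∸ j) - σ n * (σ j * profile (n ∸ j))
      ≡⟨ cong (λ x → σ (n ∸ j) * profile (n ∸ j) - x) (trans (sym (*-assoc (σ n) (σ j) _)) (cong (_* profile (n ∸ j)) (signs j≤n))) ⟩
    σ (n ∸ j) * profile (n ∸ j) - σ (n ∸ j) * profile (n ∸ j)
      ≡⟨ +-inverseʳ (σ (n ∸ j) * profile (n ∸ j)) ⟩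
    0ℤ ∎
    where
    open ≡-Reasoning
    signs : ∀ {j n} → j ≤ n → σ n * σ j ≡ σ (n ∸ j)
    signs {n = n} z≤n = *-identityʳ (σ n)
    signs {suc j} {suc n} (s≤s j≤n) = trans (lem (σ n) (σ j)) (signs j≤n)
      where
      lem : ∀ x y → - x * - y ≡ x * y
      lem = solve-∀

T^ : ℕ → Fock N → Fock N
T^ zero    φ = φ
T^ (suc k) φ = T (T^ k φ)

vac : Fock N
vac []          = 1ℤ
vac (true ∷ s)  = 0ℤ
vac (false ∷ s) = vac s

full : Fock N
full []          = 1ℤ
full (true ∷ s)  = full s
full (false ∷ s) = 0ℤ

empty : ∀ N → Vec Bool N
empty N = replicate N false

-- The sign of a full column of horizontal dominoes, one in each row.
η : ℕ → ℤ
η zero    = 1ℤ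
η (suc N) = σ (suc N) * η N

-- F a N belongs to the board of width a = m − 1 and height N = n − 1.
F : ℕ → ℕ → ℤ
F a N = T^ a vac (empty N)

T^-+ : ∀ a b (φ : Fock N) → T^ (a ℕ.+ b) φ ≡ T^ a (T^ b φ)
T^-+ zero    b φ = refl
T^-+ (suc a) b φ = cong T (T^-+ a b φ)

T^-cong : ∀ k {φ ψ : Fock N} → φ ≗ ψ → T^ k φ ≗ T^ k ψ
T^-cong zero    e = e
T^-cong (suc k) e = T-cong (T^-cong k e)

T^-scale : ∀ k x (φ : Fock N) s → T^ k (λ t → x * φ t) s ≡ x * T^ k φ s
T^-scale zero    x φ s = refl
T^-scale (suc k) x φ s = trans (T-cong (T^-scale k x φ) s) (T-scale x _ s)

T^-zero : ∀ k (s : Vec Bool N) → T^ k (λ _ → 0ℤ) s ≡ 0ℤ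
T^-zero k s = T^-scale k 0ℤ (λ _ → 0ℤ) s

T-three : (α β γ : Fock N) → ∀ s → T (λ t → α t - β t + γ t) s ≡ T α s - T β s + T γ s
T-three α β γ s = trans (T-cong (λ t → lem (α t) (β t) (γ t)) s) (trans
  (T-linear -1ℤ β _ s) (trans
  (cong (λ x → -1ℤ * T β s + x) (T-linear 1ℤ α γ s)) (sym (lem (T α s) (T β s) (T γ s)))))
  where
  lem : ∀ a b c → a - b + c ≡ -1ℤ * b + (1ℤ * a + c)
  lem = solve-∀

T^-three : ∀ k (α β γ : Fock N) s → T^ k (λ t → α t - β t + γ t) s ≡ T^ k α s - T^ k β s + T^ k γ s
T^-three zero    α β γ s = refl
T^-three (suc k) α β γ s = trans (T-cong (T^-three k α β γ) s) (T-three (T^ k α) (T^ k β) (T^ k γ) s)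

ann-outside : ∀ j (φ : Fock N) s → N < j → ann j φ s ≡ 0ℤ
ann-outside (suc j)       φ []          _         = refl
ann-outside (suc (suc j)) φ (false ∷ s) (s≤s N<j) = ann-outside (suc j) (φ ↾ false) s N<j
ann-outside (suc (suc j)) φ (true ∷ s)  (s≤s N<j) = cong -_ (ann-outside (suc j) (φ ↾ true) s N<j)

ann-vac : ∀ j (s : Vec Bool N) → ann j vac s ≡ 0ℤ
ann-vac zero          s           = refl
ann-vac (suc j)       []          = refl
ann-vac (suc zero)    (false ∷ s) = refl
ann-vac (suc zero)    (true ∷ s)  = refl
ann-vac (suc (suc j)) (false ∷ s) = ann-vac (suc j) s
ann-vac (suc (suc j)) (true ∷ s)  = cong -_ (ann-zero (suc j) s)

-- Uniqueness of the vacuum: being killed by the operator of row `j` means vanishing on all sets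
-- that contain `j`.
annihilated : (φ : Fock N) → (∀ j s → j ≤ N → ann j φ s ≡ 0ℤ) → ∀ s → φ s ≡ φ (empty N) * vac s
annihilated φ z []          = sym (*-identityʳ _)
annihilated φ z (true ∷ s)  = trans (z 1 (false ∷ s) (s≤s z≤n)) (sym (*-zeroʳ (φ (empty _))))
annihilated φ z (false ∷ s) = annihilated (φ ↾ false) (λ { zero s _ → refl ; (suc j) s j≤N → z (suc (suc j)) (false ∷ s) (s≤s j≤N) }) s

compl : Fock N → Fock N
compl φ s = φ (map not s)

compl-ann : (φ : Fock N) → ∀ s → compl (ann 1 φ) s ≡ cre 1 (compl φ) s
compl-ann φ []          = refl
compl-ann φ (true ∷ s)  = refl
compl-ann φ (false ∷ s) = refl

compl-cong : {φ ψ : Fock N} → φ ≗ ψ → compl φ ≗ compl ψ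
compl-cong e s = e (map not s)

compl-compl : (φ : Fock N) → compl (compl φ) ≗ φ
compl-compl φ []          = refl
compl-compl φ (true ∷ s)  = compl-compl (φ ↾ true) s
compl-compl φ (false ∷ s) = compl-compl (φ ↾ false) s

-- T is invertible with inverse `compl ∘ T ∘ compl`. The induction works because `compl` turns
-- `ann 1` into `cre 1`, which `ann-T` carries back through T as `ann 1`.
T-compl : (φ : Fock N) → T (compl (T (compl φ))) ≗ φ
T-compl φ []         = refl
T-compl φ (true ∷ s) = T-compl (φ ↾ true) s
T-compl {suc N} φ (false ∷ s) = begin
  c * T (λ t → c * compl (T (compl φ₀)) t + compl (ann 1 (T (compl φ₁))) t) s + ann 1 (T (compl (T (compl φ₁)))) s
    ≡⟨ cong₂ (λ x y → c * x + y) (T-linear c (compl (T (compl φ₀))) (compl (ann 1 (T (compl φ₁)))) s)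
         (ann-cong 1 (T-compl φ₁) s) ⟩
  c * (c * T (compl (T (compl φ₀))) s + T (compl (ann 1 (T (compl φ₁)))) s) + a
    ≡⟨ cong₂ (λ x y → c * (c * x + y) + a) (T-compl φ₀ s) created ⟩
  c * (c * φ₀ s + σ N * a) + a
    ≡⟨ lem (σ N) (φ₀ s) a ⟩
  (σ N * σ N) * (φ₀ s - a) + a
    ≡⟨ cong (λ x → x * (φ₀ s - a) + a) (σ² N) ⟩
  1ℤ * (φ₀ s - a) + a
    ≡⟨ lem′ (φ₀ s) a ⟩
  φ₀ s ∎
  where
  open ≡-Reasoning
  c = σ (suc N)
  φ₀ = φ ↾ false
  φ₁ = φ ↾ true
  a = ann 1 φ₁ s
  created : T (compl (ann 1 (T (compl φ₁)))) s ≡ σ N * a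
  created = begin
    T (compl (ann 1 (T (compl φ₁)))) s
      ≡⟨ T-cong (compl-ann (T (compl φ₁))) s ⟩
    T (cre 1 (compl (T (compl φ₁)))) s
      ≡⟨ σ-cancel N (ann-T 0 (compl (T (compl φ₁))) s) ⟩
    σ N * ann 1 (T (compl (T (compl φ₁)))) s
      ≡⟨ cong (σ N *_) (ann-cong 1 (T-compl φ₁) s) ⟩
    σ N * a ∎
  lem : ∀ c x a → - c * (- c * x + c * a) + a ≡ (c * c) * (x - a) + a
  lem = solve-∀
  lem′ : ∀ x a → 1ℤ * (x - a) + a ≡ x
  lem′ = solve-∀

T-shift : ∀ k (φ : Fock N) → T^ k (T φ) ≡ T (T^ k φ)
T-shift zero    φ = refl
T-shift (suc k) φ = cong T (T-shift k φ)

T^-compl : ∀ k (φ : Fock N) → T^ k (compl (T^ k (compl φ))) ≗ φ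
T^-compl zero    φ s = compl-compl φ s
T^-compl (suc k) φ s = begin
  T (T^ k (compl (T (T^ k (compl φ))))) s
    ≡⟨ cong (λ f → f s) (T-shift k _) ⟨
  T^ k (T (compl (T (T^ k (compl φ))))) s
    ≡⟨ T^-cong k (T-cong (compl-cong (T-cong (λ t → sym (compl-compl (T^ k (compl φ)) t))))) s ⟩
  T^ k (T (compl (T (compl (compl (T^ k (compl φ))))))) s
    ≡⟨ T^-cong k (T-compl (compl (T^ k (compl φ)))) s ⟩
  T^ k (compl (T^ k (compl φ))) s
    ≡⟨ T^-compl k φ s ⟩
  φ s ∎
  where open ≡-Reasoning

T^-compl′ : ∀ k (φ : Fock N) → compl (T^ k (compl (T^ k φ))) ≗ φ
T^-compl′ k φ s = begin
  compl (T^ k (compl (T^ k φ))) s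
    ≡⟨ compl-cong (T^-cong k (compl-cong (T^-cong k (λ t → sym (compl-compl φ t))))) s ⟩
  compl (T^ k (compl (T^ k (compl (compl φ))))) s
    ≡⟨ compl-cong (T^-compl k (compl φ)) s ⟩
  compl (compl φ) s
    ≡⟨ compl-compl φ s ⟩
  φ s ∎
  where open ≡-Reasoning

T^-injective : ∀ k {φ ψ : Fock N} → T^ k φ ≗ T^ k ψ → φ ≗ ψ
T^-injective k {φ} {ψ} e s = trans (sym (T^-compl′ k φ s))
  (trans (compl-cong (T^-cong k (compl-cong e)) s) (T^-compl′ k ψ s))

compl-vac : (s : Vec Bool N) → compl vac s ≡ full s
compl-vac []          = refl
compl-vac (true ∷ s)  = compl-vac s
compl-vac (false ∷ s) = refl

T-full : (s : Vec Bool N) → T full s ≡ η N * vac s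
T-full []          = refl
T-full {suc N} (true ∷ s)  = trans (T-zero s) (sym (*-zeroʳ (η (suc N))))
T-full {suc N} (false ∷ s) = trans
  (cong₂ (λ x y → σ (suc N) * x + y) (T-full s) (trans (ann-cong 1 T-zero s) (ann-zero 1 s)))
  (trans (+-identityʳ _) (sym (*-assoc (σ (suc N)) (η N) (vac s))))

-- The left side is the power -(k + 1) of T at the vacuum. The first inverse step leads to the full
-- set, with sign `η N`, since a full column of horizontal dominoes is the only filling that `full`
-- admits; conjugation turns the other `k` inverse steps into steps of T.
T^-compl-vac : ∀ k (s : Vec Bool N) → compl (T^ (suc k) (compl vac)) s ≡ η N * compl (T^ k vac) s
T^-compl-vac {N} k s = begin
  T (T^ k (compl vac)) (map not s)         ≡⟨ cong (λ f → f (map not s)) (T-shift k (compl vac)) ⟨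
  T^ k (T (compl vac)) (map not s)         ≡⟨ T^-cong k (λ t → trans (T-cong compl-vac t) (T-full t)) (map not s) ⟩
  T^ k (λ t → η N * vac t) (map not s)     ≡⟨ T^-scale k (η N) vac (map not s) ⟩
  η N * T^ k vac (map not s) ∎
  where open ≡-Reasoning

T-all : ∀ N (φ : Fock N) → T φ (replicate N true) ≡ φ (empty N)
T-all zero    φ = refl
T-all (suc N) φ = T-all N (φ ↾ false)

vac-all : 0 < N → vac (replicate N true) ≡ 0ℤ
vac-all {suc N} _ = refl

module EvenHeight {N : ℕ} (even : σ N ≡ 1ℤ) where

  even-sign : ∀ x → σ N * x ≡ x
  even-sign x = trans (cong (_* x) even) (*-identityˡ x)

  ann-T′ : ∀ j (φ : Fock N) s → T (cre j φ) s ≡ ann j (T φ) s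
  ann-T′ zero    φ s = T-zero s
  ann-T′ (suc j) φ s = sym (trans (ann-T j φ s) (even-sign _))

  -- The wave equation: `cre` is eliminated between `ann-T` and `cre-T`, whose signs `σ N` are 1
  -- here.
  ann-TT : ∀ j → j < N → (φ : Fock N) → ∀ s →
    ann (suc j) (T (T φ)) s
      ≡ T (T (ann (suc j) φ)) s - T (ann (suc (suc j)) (T φ)) s + T (ann j (T φ)) s
  ann-TT j j<N φ s = begin
    ann (suc j) (T (T φ)) s
      ≡⟨ ann-T′ (suc j) (T φ) s ⟨
    T (cre (suc j) (T φ)) s
      ≡⟨ T-cong (λ t → trans (cre-T j j<N φ t) (even-sign _)) s ⟩
    T (λ t → T (ann (suc j) φ) t - T (cre (suc (suc j)) φ) t + T (cre j φ) t) s
      ≡⟨ T-three _ _ _ s ⟩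
    T (T (ann (suc j) φ)) s - T (T (cre (suc (suc j)) φ)) s + T (T (cre j φ)) s
      ≡⟨ cong₂ (λ x y → T (T (ann (suc j) φ)) s - x + y) (T-cong (ann-T′ (suc (suc j)) φ) s) (T-cong (ann-T′ j φ) s) ⟩
    T (T (ann (suc j) φ)) s - T (ann (suc (suc j)) (T φ)) s + T (ann j (T φ)) s ∎
    where open ≡-Reasoning

  -- The walls of the wave are row 0, where the operator is zero by definition, and row `suc N`,
  -- which lies outside the column. At time 0 the wave vanishes because every operator kills the
  -- vacuum.
  ann-T^-vac : ∀ j (s : Vec Bool N) → j ≤ N → ann j (T^ (suc N) vac) s ≡ 0ℤ
  ann-T^-vac j s j≤N = trans
    (cong (λ k → T^ k (ann j (T^ (suc N) vac)) s) (sym (ℕ.n∸n≡0 N)))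
    (DiscreteWave.extinct (suc N) w (λ k → T^-zero (suc N ∸ k) s)
      (λ k _ → trans (T^-cong (suc N ∸ k) (λ t → ann-outside (suc N) _ t ℕ.≤-refl) s) (T^-zero (suc N ∸ k) s))
      (λ j → trans (T^-cong (suc N) (ann-vac j) s) (T^-zero (suc N) s))
      step j (ℕ.m≤n⇒m≤1+n j≤N))
    where
    w : ℕ → ℕ → ℤ
    w j k = T^ (suc N ∸ k) (ann j (T^ k vac)) s
    step : ∀ j k → suc j < suc N → suc (suc k) ≤ suc N →
      w (suc j) (suc (suc k)) ≡ w (suc j) k - w (suc (suc j)) (suc k) + w j (suc k)
    step j k (s≤s j<N) (s≤s k<N) = begin
      T^ m (ann (suc j) (T (T φ))) s
        ≡⟨ T^-cong m (ann-TT j j<N φ) s ⟩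
      T^ m (λ t → T (T (ann (suc j) φ)) t - T (ann (suc (suc j)) (T φ)) t + T (ann j (T φ)) t) s
        ≡⟨ T^-three m _ _ _ s ⟩
      T^ m (T^ 2 (ann (suc j) φ)) s - T^ m (T^ 1 (ann (suc (suc j)) (T φ))) s + T^ m (T^ 1 (ann j (T φ))) s
        ≡⟨ cong₂ _+_ (cong₂ _-_ (shift 2 _ eq₂) (shift 1 _ eq₁)) (shift 1 _ eq₁) ⟩
      w (suc j) k - w (suc (suc j)) (suc k) + w j (suc k) ∎
      where
      open ≡-Reasoning
      φ = T^ k vac
      m = suc N ∸ suc (suc k)
      eq₁ : m ℕ.+ 1 ≡ suc N ∸ suc k
      eq₁ = trans (ℕ.+-comm m 1) (sym (ℕ.+-∸-assoc 1 k<N))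
      eq₂ : m ℕ.+ 2 ≡ suc N ∸ k
      eq₂ = trans (ℕ.+-comm m 2) (trans (cong suc (sym (ℕ.+-∸-assoc 1 k<N))) (sym (ℕ.+-∸-assoc 1 (ℕ.<⇒≤ k<N))))
      shift : ∀ i (ψ : Fock N) {l} → m ℕ.+ i ≡ l → T^ m (T^ i ψ) s ≡ T^ l ψ s
      shift i ψ refl = cong (λ f → f s) (sym (T^-+ m i ψ))

  ε : ℤ
  ε = F (suc N) N

  T^-vac : (s : Vec Bool N) → T^ (suc N) vac s ≡ ε * vac s
  T^-vac = annihilated _ ann-T^-vac

  F-period : ∀ a → F (a ℕ.+ suc N) N ≡ ε * F a N
  F-period a = trans (cong (λ f → f (empty N)) (T^-+ a (suc N) vac))
    (trans (T^-cong a T^-vac (empty N)) (T^-scale a ε vac (empty N)))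

  -- Since `b` and `suc k` add up to the period, `T^ b vac` is ε times the power -(k + 1) of T at
  -- the vacuum, which `T^-compl-vac` computes. Both sides are compared after applying `T^ (suc k)`,
  -- which is injective.
  F-reflect : ∀ b k → b ℕ.+ k ≡ N → F b N ≡ ε * (η N * T^ k vac (replicate N true))
  F-reflect b k refl = begin
    T^ b vac (empty N)
      ≡⟨ T^-injective (suc k) agree (empty N) ⟩
    ε * (η N * compl (T^ k vac) (empty N))
      ≡⟨ cong (λ s → ε * (η N * T^ k vac s)) (map-replicate not false N) ⟩
    ε * (η N * T^ k vac (replicate N true)) ∎
    where
    open ≡-Reasoning
    agree : ∀ s → T^ (suc k) (T^ b vac) s ≡ T^ (suc k) (λ t → ε * (η N * compl (T^ k vac) t)) s
    agree s = begin
      T^ (suc k) (T^ b vac) s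
        ≡⟨ cong (λ f → f s) (T^-+ (suc k) b vac) ⟨
      T^ (suc k ℕ.+ b) vac s
        ≡⟨ cong (λ l → T^ (suc l) vac s) (ℕ.+-comm k b) ⟩
      T^ (suc N) vac s
        ≡⟨ T^-vac s ⟩
      ε * vac s
        ≡⟨ cong (ε *_) (T^-compl (suc k) vac s) ⟨
      ε * T^ (suc k) (compl (T^ (suc k) (compl vac))) s
        ≡⟨ cong (ε *_) (T^-cong (suc k) (T^-compl-vac k) s) ⟩
      ε * T^ (suc k) (λ t → η N * compl (T^ k vac) t) s
        ≡⟨ T^-scale (suc k) ε _ s ⟨
      T^ (suc k) (λ t → ε * (η N * compl (T^ k vac) t)) s ∎

  -- At the full set the last column is covered entirely from the right, so one application of T
  -- only passes from the full set to the empty one. This column accounts for the extra 1 in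
  -- `suc (a + b)`.
  F-mirror : ∀ a b → suc (a ℕ.+ b) ≡ N → F b N ≡ ε * η N * F a N
  F-mirror a b eq = trans
    (F-reflect b (suc a) (trans (ℕ.+-comm b (suc a)) eq))
    (trans (cong (λ x → ε * (η N * x)) (T-all N (T^ a vac))) (sym (*-assoc ε (η N) _)))

  F-zero : 0 < N → F N N ≡ 0ℤ
  F-zero 0<N = trans (F-reflect N 0 (ℕ.+-identityʳ N))
    (trans (cong (λ x → ε * (η N * x)) (vac-all 0<N))
      (trans (cong (ε *_) (*-zeroʳ (η N))) (*-zeroʳ ε)))

F-0 : ∀ N → F 0 N ≡ 1ℤ
F-0 zero    = refl
F-0 (suc N) = F-0 N

F-1 : ∀ k → F 1 (k ℕ.+ k) ≡ 1ℤ
F-1 zero = refl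
F-1 (suc k) rewrite ℕ.+-suc k k = trans
  (cong (λ x → σ (2 ℕ.+ (k ℕ.+ k)) * x + F 1 (k ℕ.+ k)) (T-zero (false ∷ empty (k ℕ.+ k))))
  (trans (cong (λ x → x + F 1 (k ℕ.+ k)) (*-zeroʳ (σ (2 ℕ.+ (k ℕ.+ k))))) (trans (+-identityˡ _) (F-1 k)))

-- Domino tilings and the transfer operator

⟦_⟧ : Bool → ℤ
⟦ true ⟧  = 1ℤ
⟦ false ⟧ = 0ℤ

Cover : Set
Cover = Square → ℕ

bit : Bool → ℕ
bit false = 0
bit true  = 1

hits : Domino → Cover
hits d s = bit (does (s ∈ᵈ? d))

add : Domino → Cover → Cover
add d c s = hits d s ℕ.+ c s

add-in : ∀ d {s} c → s ∈ᵈ d → add d c s ≡ suc (c s)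
add-in d {s} c s∈d = cong (λ x → bit x ℕ.+ c s) (dec-true (s ∈ᵈ? d) s∈d)

add-out : ∀ {d s} c → ¬ s ∈ᵈ d → add d c s ≡ c s
add-out {d} {s} c s∉d = cong (λ x → bit x ℕ.+ c s) (dec-false (s ∈ᵈ? d) s∉d)

add-cong : ∀ d {c c′} → c ≗ c′ → add d c ≗ add d c′
add-cong d e s = cong (hits d s ℕ.+_) (e s)

add-add : ∀ d d′ c → add d (add d′ c) ≗ add d′ (add d c)
add-add d d′ c s = trans (sym (ℕ.+-assoc (hits d s) _ _))
  (trans (cong (ℕ._+ c s) (ℕ.+-comm (hits d s) _)) (ℕ.+-assoc (hits d′ s) _ _))

-- The weighted sum over all sublists, with the cover reached so far as a running state: dominoes
-- can then be decided one at a time, hopeless branches cut off and the list permuted.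
S : (Domino → ℤ) → (Cover → ℤ) → List Domino → Cover → ℤ
S w K []       c = K c
S w K (d ∷ ds) c = w d * S w K ds (add d c) + S w K ds c

Extensional : (Cover → ℤ) → Set
Extensional K = ∀ {c c′} → c ≗ c′ → K c ≡ K c′

S-ext : ∀ w {K} → Extensional K → ∀ ds → Extensional (S w K ds)
S-ext w ext []       e = ext e
S-ext w ext (d ∷ ds) e = cong₂ (λ x y → w d * x + y) (S-ext w ext ds (add-cong d e)) (S-ext w ext ds e)

S-++ : ∀ w K xs ys c → S w K (xs ++ ys) c ≡ S w (S w K ys) xs c
S-++ w K []       ys c = refl
S-++ w K (d ∷ xs) ys c = cong₂ (λ x y → w d * x + y) (S-++ w K xs ys (add d c)) (S-++ w K xs ys c)

S-↭ : ∀ w {K} → Extensional K → ∀ {xs ys} → xs ↭ ys → ∀ c → S w K xs c ≡ S w K ys c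
S-↭ w ext Perm.refl          c = refl
S-↭ w ext (Perm.prep d p)    c = cong₂ (λ x y → w d * x + y) (S-↭ w ext p (add d c)) (S-↭ w ext p c)
S-↭ w ext (Perm.trans p q)   c = trans (S-↭ w ext p c) (S-↭ w ext q c)
S-↭ w {K} ext (Perm.swap {xs} {ys} d d′ p) c = begin
  w d * (w d′ * S w K xs (add d′ (add d c)) + S w K xs (add d c)) + (w d′ * S w K xs (add d′ c) + S w K xs c)
    ≡⟨ cong₂ _+_
         (cong₂ (λ x y → w d * (w d′ * x + y)) (trans (S-ext w ext xs (add-add d′ d c)) (S-↭ w ext p _)) (S-↭ w ext p _))
         (cong₂ (λ x y → w d′ * x + y) (S-↭ w ext p _) (S-↭ w ext p _)) ⟩
  w d * (w d′ * S w K ys (add d (add d′ c)) + S w K ys (add d c)) + (w d′ * S w K ys (add d′ c) + S w K ys c)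
    ≡⟨ lem (w d) (w d′) _ _ _ _ ⟩
  w d′ * (w d * S w K ys (add d (add d′ c)) + S w K ys (add d′ c)) + (w d * S w K ys (add d c) + S w K ys c) ∎
  where
  open ≡-Reasoning
  lem : ∀ a b p q r s → a * (b * p + q) + (b * r + s) ≡ b * (a * p + r) + (a * q + s)
  lem = solve-∀

module Target (cells : List Square) (want : Cover) where

  Met : Cover → Set
  Met c = All (λ s → c s ≡ want s) cells

  met? : ∀ c → Dec (Met c)
  met? c = All.all? (λ s → c s ℕ.≟ want s) cells

  K : Cover → ℤ
  K c = ⟦ does (met? c) ⟧

  K-met : ∀ {c} → Met c → K c ≡ 1ℤ
  K-met {c} m = cong ⟦_⟧ (dec-true (met? c) m)

  K-missed : ∀ {c} → ¬ Met c → K c ≡ 0ℤ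
  K-missed {c} m = cong ⟦_⟧ (dec-false (met? c) m)

  K-ext : Extensional K
  K-ext {c} {c′} e with met? c
  ... | yes m = sym (K-met (All.map (λ {s} p → trans (sym (e s)) p) m))
  ... | no ¬m = sym (K-missed (λ m → ¬m (All.map (λ {s} p → trans (e s) p) m)))

  -- The pruning principle. It serves two invariants: a square covered too often stays so, and a
  -- square out of reach of the remaining dominoes keeps its wrong count.
  S-dead : ∀ w ds → (Alive : Cover → Set) →
    (∀ {c} → Alive c → ¬ Met c) → All (λ d → ∀ {c} → Alive c → Alive (add d c)) ds →
    ∀ {c} → Alive c → S w K ds c ≡ 0ℤ
  S-dead w []       Alive bad step a = K-missed (bad a)
  S-dead w (d ∷ ds) Alive bad (p ∷ ps) a =
    trans (cong₂ (λ x y → w d * x + y) (S-dead w ds Alive bad ps (p a)) (S-dead w ds Alive bad ps a))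
          (trans (+-identityʳ _) (*-zeroʳ (w d)))

  S-over : ∀ w ds {c s} → s ∈ cells → want s < c s → S w K ds c ≡ 0ℤ
  S-over w ds {c} {s} s∈ = S-dead w ds (λ c → want s < c s)
    (λ lt m → ℕ.<-irrefl (sym (All.lookup m s∈)) lt)
    (All.universal (λ d {c} lt → ℕ.≤-trans lt (ℕ.m≤n+m (c s) (hits d s))) ds)

  S-untouched : ∀ w ds {c s} → s ∈ cells → All (λ d → ¬ s ∈ᵈ d) ds → c s ≢ want s → S w K ds c ≡ 0ℤ
  S-untouched w ds {c} {s} s∈ out = S-dead w ds (λ c → c s ≢ want s)
    (λ ne m → ne (All.lookup m s∈))
    (All.map (λ s∉d {c} ne → ne ∘ trans (sym (add-out c s∉d))) out)

H V : ℕ → ℕ → Domino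
H i j = (i , j) , (suc i , j)
V i j = (i , j) , (i , suc j)

-- The order follows the recursion of `T`: downwards through column `suc i`, offering at each square
-- first the domino to the left and then the domino downwards. Dominoes leaving through column 0 or
-- row 0 are included to keep the pattern uniform.
hopping : ℕ → ℕ → List Domino
hopping i zero    = []
hopping i (suc r) = H i (suc r) ∷ V (suc i) r ∷ hopping i r

scan : ℕ → ℕ → List Domino
scan zero    b = []
scan (suc a) b = hopping a b ++ scan a b

-- A formula for both kinds of dominoes: i + i′ is odd exactly for the horizontal ones.
wt : Domino → ℤ
wt ((i , j) , (i′ , j′)) = σ (j ℕ.* (i ℕ.+ i′))

σ-+ : ∀ m n → σ (m ℕ.+ n) ≡ σ m * σ n
σ-+ zero    n = sym (*-identityˡ _)
σ-+ (suc m) n = trans (cong -_ (σ-+ m n)) (neg-distribˡ-* (σ m) (σ n))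

σ-double : ∀ n → σ (n ℕ.+ n) ≡ 1ℤ
σ-double n = trans (σ-+ n n) (σ² n)

wt-H : ∀ i j → wt (H i j) ≡ σ j
wt-H i j = begin
  σ (j ℕ.* (i ℕ.+ suc i))              ≡⟨ cong (λ x → σ (j ℕ.* x)) (ℕ.+-suc i i) ⟩
  σ (j ℕ.* suc (i ℕ.+ i))              ≡⟨ cong σ (ℕ.*-suc j (i ℕ.+ i)) ⟩
  σ (j ℕ.+ j ℕ.* (i ℕ.+ i))            ≡⟨ cong (λ x → σ (j ℕ.+ x)) (ℕ.*-distribˡ-+ j i i) ⟩
  σ (j ℕ.+ (j ℕ.* i ℕ.+ j ℕ.* i))      ≡⟨ σ-+ j _ ⟩
  σ j * σ (j ℕ.* i ℕ.+ j ℕ.* i)        ≡⟨ cong (σ j *_) (σ-double (j ℕ.* i)) ⟩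
  σ j * 1ℤ                             ≡⟨ *-identityʳ (σ j) ⟩
  σ j ∎
  where open ≡-Reasoning

wt-V : ∀ i j → wt (V i j) ≡ 1ℤ
wt-V i j = trans (cong σ (ℕ.*-distribˡ-+ j i i)) (σ-double (j ℕ.* i))

hopping-left : ∀ i r {x k} → suc i < x → All (λ d → ¬ (x , k) ∈ᵈ d) (hopping i r)
hopping-left i zero    lt = []
hopping-left i (suc r) lt =
    (λ { (inj₁ refl) → ℕ.<-irrefl refl (ℕ.<⇒≤ lt) ; (inj₂ refl) → ℕ.<-irrefl refl lt })
  ∷ (λ { (inj₁ refl) → ℕ.<-irrefl refl lt ; (inj₂ refl) → ℕ.<-irrefl refl lt })
  ∷ hopping-left i r lt

scan-left : ∀ a {b x k} → a < x → All (λ d → ¬ (x , k) ∈ᵈ d) (scan a b)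
scan-left zero        lt = []
scan-left (suc a) {b} lt = All.++⁺ (hopping-left a b lt) (scan-left a (ℕ.<⇒≤ lt))

-- The board is enlarged by column 0 and row 0, whose squares have to stay uncovered, so that every column and
-- every row can be scanned alike.
want : Cover
want (zero  , j)     = 0
want (suc i , zero)  = 0
want (suc i , suc j) = 1

Reads : ∀ {r} → Cover → ℕ → Vec Bool r → Set
Reads         c i []      = ⊤
Reads {suc r} c i (b ∷ s) = c (i , suc r) ≡ bit b × Reads c i s

Reads-cong : ∀ {r c c′ i} (s : Vec Bool r) → (∀ j → j ≤ r → c (i , j) ≡ c′ (i , j)) → Reads c i s → Reads c′ i s
Reads-cong []      e _        = tt
Reads-cong (b ∷ s) e (p , ps) = trans (sym (e _ ℕ.≤-refl)) p , Reads-cong s (λ j j≤r → e j (ℕ.m≤n⇒m≤1+n j≤r)) ps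

Reads-empty : ∀ {c i} r → (∀ j → j ≤ r → c (i , j) ≡ 0) → Reads c i (empty r)
Reads-empty zero    z = tt
Reads-empty (suc r) z = z (suc r) ℕ.≤-refl , Reads-empty r (λ j j≤r → z j (ℕ.m≤n⇒m≤1+n j≤r))

module Scan (A b : ℕ) where

  cells : List Square
  cells = cartesianProduct (upTo (suc A)) (upTo (suc b))

  cell : ∀ {i j} → i ≤ A → j ≤ b → (i , j) ∈ cells
  cell i≤A j≤b = ∈-cartesianProduct⁺ (∈-upTo⁺ (s≤s i≤A)) (∈-upTo⁺ (s≤s j≤b))

  open Target cells want

  module Column (a : ℕ) (a<A : a < A) where

    hopping-below : ∀ r {k} → r < k → All (λ d → ¬ (suc a , k) ∈ᵈ d) (hopping a r)
    hopping-below zero    lt = []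
    hopping-below (suc r) lt =
        (λ { (inj₁ ()) ; (inj₂ refl) → ℕ.<-irrefl refl lt })
      ∷ (λ { (inj₁ refl) → ℕ.<-irrefl refl (ℕ.<⇒≤ lt) ; (inj₂ refl) → ℕ.<-irrefl refl lt })
      ∷ hopping-below r (ℕ.<⇒≤ lt)

    Rest : Cover → ℤ
    Rest = S wt K (scan a b)

    Fixed : ℕ → Cover → Cover → Set
    Fixed r c c′ = ∀ i j → ((i ≢ a × i ≢ suc a) ⊎ (j ≡ 0 ⊎ r < j)) → c′ (i , j) ≡ c (i , j)

    -- The continuation of the scan: however the lowest `r` rows of column `suc a` get filled, the
    -- columns further left depend only on the set this leaves covered in column `a`, and contribute
    -- `φ` of it.
    Completes : ∀ r → Cover → Fock r → Set
    Completes r c φ = ∀ c′ (s′ : Vec Bool r) → Reads c′ a s′ →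
      (∀ j → suc j ≤ r → c′ (suc a , suc j) ≡ 1) → Fixed r c c′ → Rest c′ ≡ φ s′

    dead : ∀ r c j → j ≤ b → want (suc a , j) < c (suc a , j) → S wt Rest (hopping a r) c ≡ 0ℤ
    dead r c j j≤b lt = trans (sym (S-++ wt K (hopping a r) (scan a b) c))
      (S-over wt (hopping a r ++ scan a b) (cell a<A j≤b) lt)

    stuck : ∀ r c → r < b → c (suc a , suc r) ≡ 0 → S wt Rest (hopping a r) c ≡ 0ℤ
    stuck r c r<b eq = trans (sym (S-++ wt K (hopping a r) (scan a b) c))
      (S-untouched wt (hopping a r ++ scan a b) (cell a<A r<b)
        (All.++⁺ (hopping-below r ℕ.≤-refl) (scan-left a ℕ.≤-refl)) λ eq′ → ℕ.0≢1+n (trans (sym eq) eq′))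

    descend : ∀ {r c φ} v c₁ → c₁ (a , suc r) ≡ bit v → c₁ (suc a , suc r) ≡ 1 → Fixed (suc r) c c₁ →
      Completes (suc r) c φ → Completes r c₁ (φ ↾ v)
    descend {r} v c₁ left filled same done c′ s′ reads ones fix =
      done c′ (v ∷ s′) (trans (fix a (suc r) (inj₂ (inj₂ ℕ.≤-refl))) left , reads) ones′
        (λ i j out → trans (fix i j (weaken out)) (same i j out))
      where
      ones′ : ∀ j → suc j ≤ suc r → c′ (suc a , suc j) ≡ 1
      ones′ j j≤r with ℕ.m≤n⇒m<n∨m≡n j≤r
      ... | inj₁ (s≤s j<r) = ones j j<r
      ... | inj₂ refl      = trans (fix (suc a) (suc r) (inj₂ (inj₂ ℕ.≤-refl))) filled
      weaken : ∀ {i j} → (i ≢ a × i ≢ suc a) ⊎ (j ≡ 0 ⊎ suc r < j) → (i ≢ a × i ≢ suc a) ⊎ (j ≡ 0 ⊎ r < j)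
      weaken (inj₁ x)        = inj₁ x
      weaken (inj₂ (inj₁ x)) = inj₂ (inj₁ x)
      weaken (inj₂ (inj₂ x)) = inj₂ (inj₂ (ℕ.<⇒≤ x))

    vertical : ∀ r → r < b → ∀ c (s : Vec Bool r) φ → c (suc a , suc r) ≡ 0 → Reads c (suc a) s →
      (∀ j → j ≤ suc r → c (a , j) ≡ 0) → c (suc a , 0) ≡ 0 → Completes (suc r) c φ →
      S wt Rest (hopping a r) (add (V (suc a) r) c) ≡ ann 1 (T (φ ↾ false)) s
    column : ∀ r → r ≤ b → ∀ c (s : Vec Bool r) φ → Reads c (suc a) s → (∀ j → j ≤ r → c (a , j) ≡ 0) →
      c (suc a , 0) ≡ 0 → Completes r c φ → S wt Rest (hopping a r) c ≡ T φ s
    column zero    r≤b c []          φ reads clear bottom done = done c [] tt (λ _ ()) (λ _ _ _ → refl)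
    -- Of the four choices for the two dominoes at the top square, three cover it twice.
    column (suc r) r<b c (true ∷ s)  φ (top , reads) clear bottom done = begin
      wt (H a (suc r)) * (wt (V (suc a) r) * S wt Rest (hopping a r) (add (V (suc a) r) (add (H a (suc r)) c))
          + S wt Rest (hopping a r) (add (H a (suc r)) c))
        + (wt (V (suc a) r) * S wt Rest (hopping a r) (add (V (suc a) r) c) + S wt Rest (hopping a r) c)
        ≡⟨ cong₂ _+_
             (cong₂ (λ x y → wt (H a (suc r)) * (wt (V (suc a) r) * x + y))
               (dead r _ (suc r) r<b (subst (1 ℕ.<_) (sym (trans (add-in (V (suc a) r) (add (H a (suc r)) c) (inj₂ refl)) (cong suc doubled))) (s≤s (s≤s z≤n))))
               (dead r _ (suc r) r<b (subst (1 ℕ.<_) (sym doubled) ℕ.≤-refl)))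
             (cong₂ (λ x y → wt (V (suc a) r) * x + y)
               (dead r _ (suc r) r<b (subst (1 ℕ.<_) (sym (trans (add-in (V (suc a) r) c (inj₂ refl)) (cong suc top))) ℕ.≤-refl))
               (column r (ℕ.<⇒≤ r<b) c s (φ ↾ false) reads (λ j j≤r → clear j (ℕ.m≤n⇒m≤1+n j≤r)) bottom
                 (descend false c (clear (suc r) ℕ.≤-refl) top (λ _ _ _ → refl) done))) ⟩
      wt (H a (suc r)) * (wt (V (suc a) r) * 0ℤ + 0ℤ) + (wt (V (suc a) r) * 0ℤ + T (φ ↾ false) s)
        ≡⟨ lem (wt (H a (suc r))) (wt (V (suc a) r)) _ ⟩
      T (φ ↾ false) s ∎
      where
      open ≡-Reasoning
      doubled : add (H a (suc r)) c (suc a , suc r) ≡ 2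
      doubled = trans (add-in (H a (suc r)) c (inj₂ refl)) (cong suc top)
      lem : ∀ x y z → x * (y * 0ℤ + 0ℤ) + (y * 0ℤ + z) ≡ z
      lem = solve-∀
    -- Both dominoes together cover the top square twice and neither leaves it bare for good, as no
    -- later domino reaches it. The two remaining choices are the two terms of `T`.
    column (suc r) r<b c (false ∷ s) φ (top , reads) clear bottom done = begin
      wt (H a (suc r)) * (wt (V (suc a) r) * S wt Rest (hopping a r) (add (V (suc a) r) cH)
          + S wt Rest (hopping a r) cH)
        + (wt (V (suc a) r) * S wt Rest (hopping a r) cV + S wt Rest (hopping a r) c)
        ≡⟨ cong₂ _+_
             (cong₂ (λ x y → wt (H a (suc r)) * (wt (V (suc a) r) * x + y))
               (dead r _ (suc r) r<b (subst (1 ℕ.<_) (sym (trans (add-in (V (suc a) r) cH (inj₂ refl)) (cong suc filledH))) ℕ.≤-refl))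
               (column r (ℕ.<⇒≤ r<b) cH s (φ ↾ true)
                 (Reads-cong s (λ j j≤r → sym (sameH (inj₂ (s≤s j≤r)))) reads)
                 (λ j j≤r → trans (sameH (inj₂ (s≤s j≤r))) (clear j (ℕ.m≤n⇒m≤1+n j≤r)))
                 (trans (sameH (inj₂ (s≤s z≤n))) bottom)
                 (descend true cH (trans (add-in (H a (suc r)) c (inj₁ refl)) (cong suc (clear (suc r) ℕ.≤-refl))) filledH
                   (λ i j out → fixedH i j out) done)))
             (cong₂ (λ x y → wt (V (suc a) r) * x + y) (vertical r r<b c s φ top reads clear bottom done) (stuck r c r<b top)) ⟩
      wt (H a (suc r)) * (wt (V (suc a) r) * 0ℤ + T (φ ↾ true) s) + (wt (V (suc a) r) * ann 1 (T (φ ↾ false)) s + 0ℤ)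
        ≡⟨ cong₂ (λ x y → x * (y * 0ℤ + T (φ ↾ true) s) + (y * ann 1 (T (φ ↾ false)) s + 0ℤ))
             (wt-H a (suc r)) (wt-V (suc a) r) ⟩
      σ (suc r) * (1ℤ * 0ℤ + T (φ ↾ true) s) + (1ℤ * ann 1 (T (φ ↾ false)) s + 0ℤ)
        ≡⟨ lem (σ (suc r)) _ _ ⟩
      σ (suc r) * T (φ ↾ true) s + ann 1 (T (φ ↾ false)) s ∎
      where
      open ≡-Reasoning
      cH cV : Cover
      cH = add (H a (suc r)) c
      cV = add (V (suc a) r) c
      lem : ∀ x y z → x * (1ℤ * 0ℤ + y) + (1ℤ * z + 0ℤ) ≡ x * y + z
      lem = solve-∀
      filledH : cH (suc a , suc r) ≡ 1
      filledH = trans (add-in (H a (suc r)) c (inj₂ refl)) (cong suc top)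
      sameH : ∀ {i j} → ((i ≢ a × i ≢ suc a) ⊎ j < suc r) → cH (i , j) ≡ c (i , j)
      sameH (inj₁ (p , q)) = add-out c λ { (inj₁ refl) → p refl ; (inj₂ refl) → q refl }
      sameH (inj₂ lt)      = add-out c λ { (inj₁ refl) → ℕ.<-irrefl refl lt ; (inj₂ refl) → ℕ.<-irrefl refl lt }
      fixedH : Fixed (suc r) c cH
      fixedH i j (inj₁ x)           = sameH (inj₁ x)
      fixedH i j (inj₂ (inj₁ refl)) = sameH (inj₂ (s≤s z≤n))
      fixedH i j (inj₂ (inj₂ lt))   = add-out c λ { (inj₁ refl) → ℕ.<-irrefl refl lt ; (inj₂ refl) → ℕ.<-irrefl refl lt }

    -- The domino would stick out into row 0, matching `ann 1` being 0 on a column of height 0. In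
    -- the other clauses the square below is either taken already or now counts as covered.
    vertical zero    r<b c []         φ top reads clear bottom done =
      dead zero _ zero z≤n (subst (0 ℕ.<_) (sym (add-in (V (suc a) 0) c (inj₁ refl))) (s≤s z≤n))
    vertical (suc r) r<b c (true ∷ s) φ top (p , reads) clear bottom done =
      dead (suc r) _ (suc r) (ℕ.<⇒≤ r<b)
        (subst (1 ℕ.<_) (sym (trans (add-in (V (suc a) (suc r)) c (inj₁ refl)) (cong suc p))) ℕ.≤-refl)
    vertical (suc r) r<b c (false ∷ s) φ top (p , reads) clear bottom done =
      column (suc r) (ℕ.<⇒≤ r<b) cV (true ∷ s) (φ ↾ false)
        ( trans (add-in (V (suc a) (suc r)) c (inj₁ refl)) (cong suc p)
        , Reads-cong s (λ j j≤r → sym (sameV (inj₂ (s≤s j≤r)))) reads)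
        (λ j j≤r → trans (sameV (inj₁ (ℕ.<⇒≢ (ℕ.n<1+n a)))) (clear j (ℕ.m≤n⇒m≤1+n j≤r)))
        (trans (sameV (inj₂ (s≤s z≤n))) bottom)
        (descend false cV (trans (sameV (inj₁ (ℕ.<⇒≢ (ℕ.n<1+n a)))) (clear _ ℕ.≤-refl))
          (trans (add-in (V (suc a) (suc r)) c (inj₂ refl)) (cong suc top)) fixedV done)
      where
      cV : Cover
      cV = add (V (suc a) (suc r)) c
      sameV : ∀ {i j} → (i ≢ suc a ⊎ j < suc r) → cV (i , j) ≡ c (i , j)
      sameV (inj₁ p)  = add-out c λ { (inj₁ refl) → p refl ; (inj₂ refl) → p refl }
      sameV (inj₂ lt) = add-out c λ { (inj₁ refl) → ℕ.<-irrefl refl lt ; (inj₂ refl) → ℕ.<-irrefl refl (ℕ.<⇒≤ lt) }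
      fixedV : Fixed (suc (suc r)) c cV
      fixedV i j (inj₁ (_ , q))     = sameV (inj₁ q)
      fixedV i j (inj₂ (inj₁ refl)) = sameV (inj₂ (s≤s z≤n))
      fixedV i j (inj₂ (inj₂ lt))   =
        add-out c λ { (inj₁ refl) → ℕ.<-irrefl refl (ℕ.<⇒≤ lt) ; (inj₂ refl) → ℕ.<-irrefl refl lt }

  Boundary : ∀ a → Vec Bool b → Cover → Set
  Boundary a s c = Reads c a s
    × (∀ i j → a < i → i ≤ A → j ≤ b → c (i , j) ≡ want (i , j))
    × (∀ i j → i < a → j ≤ b → c (i , j) ≡ 0)
    × c (a , 0) ≡ 0

  K-vac : ∀ c s → Boundary 0 s c → K c ≡ vac s
  K-vac c s (reads , above , _ , bottom) with all-false? s
    where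
    all-false? : ∀ {r} (s : Vec Bool r) → (s ≡ empty r × vac s ≡ 1ℤ) ⊎ (¬ s ≡ empty r × vac s ≡ 0ℤ)
    all-false? []          = inj₁ (refl , refl)
    all-false? (true ∷ s)  = inj₂ ((λ ()) , refl)
    all-false? (false ∷ s) with all-false? s
    ... | inj₁ (refl , v) = inj₁ (refl , v)
    ... | inj₂ (ne , v)   = inj₂ ((λ { refl → ne refl }) , v)
  ... | inj₁ (refl , v) = trans (K-met (All.tabulate met)) (sym v)
    where
    read-empty : ∀ r → Reads c 0 (empty r) → ∀ j → suc j ≤ r → c (0 , suc j) ≡ 0
    read-empty (suc r) (p , ps) j j≤r with ℕ.m≤n⇒m<n∨m≡n j≤r
    ... | inj₁ (s≤s j<r) = read-empty r ps j j<r
    ... | inj₂ refl      = p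
    met′ : ∀ i j → i ≤ A → j ≤ b → c (i , j) ≡ want (i , j)
    met′ zero    zero    _   _   = bottom
    met′ zero    (suc j) _   j≤b = read-empty b reads j j≤b
    met′ (suc i) j       i≤A j≤b = above (suc i) j (s≤s z≤n) i≤A j≤b
    met : ∀ {x} → x ∈ cells → c x ≡ want x
    met {i , j} x∈ with i∈ , j∈ ← ∈-cartesianProduct⁻ (upTo (suc A)) (upTo (suc b)) x∈ =
      met′ i j (ℕ.≤-pred (∈-upTo⁻ i∈)) (ℕ.≤-pred (∈-upTo⁻ j∈))
  ... | inj₂ (ne , v)   = trans (K-missed (λ m → ne (unread s ℕ.≤-refl reads m))) (sym v)
    where
    unread : ∀ {r} (s : Vec Bool r) → r ≤ b → Reads c 0 s → Met c → s ≡ empty r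
    unread []                  _   _        m = refl
    unread {suc r} (v ∷ s) r<b (p , ps) m = cong₂ _∷_
      (low v (trans (sym p) (All.lookup m (cell z≤n r<b)))) (unread s (ℕ.<⇒≤ r<b) ps m)
      where
      low : ∀ v → bit v ≡ 0 → v ≡ false
      low false _ = refl

  scan-sum : ∀ a → a ≤ A → ∀ c s → Boundary a s c → S wt K (scan a b) c ≡ T^ a vac s
  scan-sum zero    _   c s bd = K-vac c s bd
  scan-sum (suc a) a<A c s (reads , above , below , bottom) =
    trans (S-++ wt K (hopping a b) (scan a b) c)
      (column b ℕ.≤-refl c s (T^ a vac) reads (λ j → below a j ℕ.≤-refl) bottom next)
    where
    open Column a a<A
    next : Completes b c (T^ a vac)
    next c′ s′ reads′ ones fix = scan-sum a (ℕ.<⇒≤ a<A) c′ s′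
      (reads′ , above′ , (λ i j i<a j≤b → trans (fix i j (inj₁ (ℕ.<⇒≢ i<a , ℕ.<⇒≢ (ℕ.m≤n⇒m≤1+n i<a)))) (below i j (ℕ.m≤n⇒m≤1+n i<a) j≤b))
      , trans (fix a 0 (inj₂ (inj₁ refl))) (below a 0 ℕ.≤-refl z≤n))
      where
      above′ : ∀ i j → a < i → i ≤ A → j ≤ b → c′ (i , j) ≡ want (i , j)
      above′ i j a<i i≤A j≤b with ℕ.m≤n⇒m<n∨m≡n a<i
      ... | inj₁ sa<i = trans (fix i j (inj₁ ((λ { refl → ℕ.<-irrefl refl a<i }) , λ { refl → ℕ.<-irrefl refl sa<i })))
                              (above i j sa<i i≤A j≤b)
      above′ i zero    a<i i≤A j≤b | inj₂ refl = trans (fix i 0 (inj₂ (inj₁ refl))) bottom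
      above′ i (suc j) a<i i≤A j≤b | inj₂ refl = ones j j≤b

  scan-total : S wt K (scan A b) (λ _ → 0) ≡ F A b
  scan-total = scan-sum A ℕ.≤-refl (λ _ → 0) (empty b)
    ( Reads-empty b (λ _ _ → refl)
    , (λ i j A<i i≤A _ → contradiction (ℕ.<-≤-trans A<i i≤A) (ℕ.<-irrefl refl))
    , (λ _ _ _ _ → refl) , refl)

-- The scanning order as a rearrangement of the dominoes of the board

concatMap-↭ : ∀ {A B : Set} (f : A → List B) {xs ys} → xs ↭ ys → concatMap f xs ↭ concatMap f ys
concatMap-↭ f Perm.refl         = ↭-refl
concatMap-↭ f (Perm.prep x p)   = Perm.++⁺ˡ (f x) (concatMap-↭ f p)
concatMap-↭ f (Perm.swap x y p) =
  ↭-trans (Perm.shifts (f x) (f y)) (Perm.++⁺ˡ (f y) (Perm.++⁺ˡ (f x) (concatMap-↭ f p)))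
concatMap-↭ f (Perm.trans p q)  = ↭-trans (concatMap-↭ f p) (concatMap-↭ f q)

interchange : ∀ {A : Set} (ws xs ys zs : List A) → (ws ++ xs) ++ (ys ++ zs) ↭ (ws ++ ys) ++ (xs ++ zs)
interchange ws xs ys zs = ↭-trans (Perm.++-assoc ws xs (ys ++ zs))
  (↭-trans (Perm.++⁺ˡ ws (Perm.shifts xs ys)) (↭-sym (Perm.++-assoc ws ys (xs ++ zs))))

concatMap-∷ : ∀ {A B : Set} (f : A → B) (g : A → List B) xs →
  concatMap (λ x → f x ∷ g x) xs ↭ List.map f xs ++ concatMap g xs
concatMap-∷ f g []       = ↭-refl
concatMap-∷ f g (x ∷ xs) = Perm.prep (f x)
  (↭-trans (Perm.++⁺ˡ (g x) (concatMap-∷ f g xs)) (Perm.shifts (g x) (List.map f xs)))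

concatMap-map-swap : ∀ {A B C : Set} (f : A → B → C) xs ys →
  concatMap (λ x → List.map (f x) ys) xs ↭ concatMap (λ y → List.map (λ x → f x y) xs) ys
concatMap-map-swap f []       ys = ↭-reflexive (sym (nil ys))
  where
  nil : ∀ {B C : Set} (ys : List B) → concatMap {B = C} (λ _ → []) ys ≡ []
  nil []       = refl
  nil (_ ∷ ys) = nil ys
concatMap-map-swap f (x ∷ xs) ys =
  ↭-trans (Perm.++⁺ˡ (List.map (f x) ys) (concatMap-map-swap f xs ys))
    (↭-sym (concatMap-∷ (f x) (λ y → List.map (λ x → f x y) xs) ys))

upTo-last : ∀ n → upTo (suc n) ↭ n ∷ upTo n
upTo-last n = ↭-trans (↭-reflexive (sym (List.upTo-∷ʳ n))) (↭-sym (Perm.∷↭∷ʳ n (upTo n)))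

[]-last : ∀ n → [ suc n ] ↭ suc n ∷ [ n ]
[]-last n = Perm.map⁺ suc (upTo-last n)

upTo-first : ∀ n → upTo (suc n) ≡ 0 ∷ [ n ]
upTo-first n = cong (0 ∷_) (sym (List.map-upTo suc n))

hopping-↭ : ∀ i r → hopping i r ↭ List.map (H i) [ r ] ++ List.map (V (suc i)) (upTo r)
hopping-↭ i zero    = ↭-refl
hopping-↭ i (suc r) = ↭-trans (Perm.prep _ (Perm.prep _ (hopping-↭ i r)))
  (↭-trans (Perm.prep _ (↭-sym (Perm.shift (V (suc i) r) (List.map (H i) [ r ]) (List.map (V (suc i)) (upTo r)))))
    (Perm.++⁺ (↭-sym (Perm.map⁺ (H i) ([]-last r))) (↭-sym (Perm.map⁺ (V (suc i)) (upTo-last r)))))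

scan-↭ : ∀ a b → scan a b ↭ concatMap (λ i → List.map (H i) [ b ]) (upTo a) ++ concatMap (λ i → List.map (V i) (upTo b)) [ a ]
scan-↭ zero    b = ↭-refl
scan-↭ (suc a) b = ↭-trans (Perm.++⁺ (hopping-↭ a b) (scan-↭ a b))
  (↭-trans (interchange (List.map (H a) [ b ]) _ (concatMap (λ i → List.map (H i) [ b ]) (upTo a)) _)
    (Perm.++⁺ (↭-sym (concatMap-↭ (λ i → List.map (H i) [ b ]) (upTo-last a)))
              (↭-sym (concatMap-↭ (λ i → List.map (V i) (upTo b)) ([]-last a)))))

leftOf belowOf : ℕ → ℕ → List Domino
leftOf zero    b = []
leftOf (suc a) b = List.map (H 0) [ b ]
belowOf a zero    = []
belowOf a (suc b) = List.map (λ i → V i 0) [ a ]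

scan-dominoes : ∀ a b → scan a b ↭ (leftOf a b ++ belowOf a b) ++ dominoes a b
scan-dominoes a b = ↭-trans (scan-↭ a b) (↭-trans (Perm.++⁺ (hs a) (vs b)) (interchange (leftOf a b) (horizontalDominoes a b) (belowOf a b) (verticalDominoes a b)))
  where
  hs : ∀ a → concatMap (λ i → List.map (H i) [ b ]) (upTo a) ↭ leftOf a b ++ horizontalDominoes a b
  hs zero    = ↭-refl
  hs (suc a) = ↭-reflexive (cong (concatMap (λ i → List.map (H i) [ b ])) (upTo-first a))
  vs : ∀ b → concatMap (λ i → List.map (V i) (upTo b)) [ a ] ↭ belowOf a b ++ verticalDominoes a b
  vs zero    = ↭-refl
  vs (suc b) = ↭-trans (↭-reflexive (cong (λ js → concatMap (λ i → List.map (V i) js) [ a ]) (upTo-first b)))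
                       (concatMap-∷ (λ i → V i 0) (λ i → List.map (V i) [ b ]) [ a ])

data Placed (a b : ℕ) : Domino → Set where
  hor : ∀ {i j} → suc (suc i) ≤ a → suc j ≤ b → Placed a b (H (suc i) (suc j))
  ver : ∀ {i j} → suc i ≤ a → suc (suc j) ≤ b → Placed a b (V (suc i) (suc j))

All-[] : ∀ {P : ℕ → Set} k → (∀ i → i < k → P (suc i)) → All P [ k ]
All-[] k p = All.map⁺ (All.tabulate (λ i∈ → p _ (∈-upTo⁻ i∈)))

All-grid : ∀ {P : Domino → Set} (f : ℕ → ℕ → Domino) a b →
  (∀ i j → i < a → j < b → P (f (suc i) (suc j))) → All P (concatMap (λ i → List.map (f i) [ b ]) [ a ])
All-grid f a b p = All.concat⁺ (All.map⁺ (All-[] a (λ i i<a → All.map⁺ (All-[] b (λ j j<b → p i j i<a j<b)))))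

pred-< : ∀ {i} a → i < a ∸ 1 → suc i < a
pred-< (suc a) lt = s≤s lt

dominoes-placed : ∀ a b → All (Placed a b) (dominoes a b)
dominoes-placed a b = All.++⁺
  (All-grid H (a ∸ 1) b (λ i j i<a j<b → hor (pred-< a i<a) j<b))
  (All-grid V a (b ∸ 1) (λ i j i<a j<b → ver i<a (pred-< b j<b)))

squares-cartesian : ∀ a b → squares a b ≡ cartesianProduct [ a ] [ b ]
squares-cartesian a b = go [ a ]
  where
  go : ∀ is → concatMap (λ i → List.map (λ j → (i , j)) [ b ]) is ≡ cartesianProduct is [ b ]
  go []       = refl
  go (i ∷ is) = cong (List.map (i ,_) [ b ] ++_) (go is)

∈-squares⁺ : ∀ {a b i j} → i < a → j < b → (suc i , suc j) ∈ squares a b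
∈-squares⁺ {a} {b} i<a j<b = subst (_ ∈_) (sym (squares-cartesian a b))
  (∈-cartesianProduct⁺ (∈-map⁺ suc (∈-upTo⁺ i<a)) (∈-map⁺ suc (∈-upTo⁺ j<b)))

∈-squares⁻ : ∀ {a b s} → s ∈ squares a b → ∃[ i ] ∃[ j ] (i < a × j < b × s ≡ (suc i , suc j))
∈-squares⁻ {a} {b} s∈ with ∈-cartesianProduct⁻ [ a ] [ b ] (subst (_ ∈_) (squares-cartesian a b) s∈)
... | p , q with ∈-map⁻ suc p | ∈-map⁻ suc q
... | i , i∈ , refl | j , j∈ , refl = i , j , ∈-upTo⁻ i∈ , ∈-upTo⁻ j∈ , refl

board : ℕ → ℕ → Cover → ℤ
board a b = Target.K (squares a b) (λ _ → 1)

S-agree : ∀ w {K K′} ds (P : Cover → Set) → (∀ {c} → P c → K c ≡ K′ c) →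
  All (λ d → ∀ {c} → P c → P (add d c)) ds → ∀ {c} → P c → S w K ds c ≡ S w K′ ds c
S-agree w []       P eq step       p = eq p
S-agree w (d ∷ ds) P eq (s ∷ step) p =
  cong₂ (λ x y → w d * x + y) (S-agree w ds P eq step (s p)) (S-agree w ds P eq step p)

module _ (a b : ℕ) where
  open Scan a b using (cells; cell; scan-total)
  open Target cells want

  Kills : Domino → Set
  Kills d = ∃[ s ] (s ∈ᵈ d × s ∈ cells × want s ≡ 0)

  -- A domino leaving the board covers a square whose wanted count is 0, so only the terms that omit
  -- it survive.
  S-kill : ∀ ks ds → All Kills ks → ∀ c → S wt K (ks ++ ds) c ≡ S wt K ds c
  S-kill []       ds []                             c = refl
  S-kill (k ∷ ks) ds ((s , s∈k , s∈ , eq) ∷ kills) c = trans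
    (cong₂ (λ x y → wt k * x + y)
      (S-over wt (ks ++ ds) s∈ (subst₂ ℕ._<_ (sym eq) (sym (add-in k c s∈k)) (s≤s z≤n)))
      (S-kill ks ds kills c))
    (trans (cong (λ x → x + S wt K ds c) (*-zeroʳ (wt k))) (+-identityˡ _))

  offBoard-kills : All Kills (leftOf a b ++ belowOf a b)
  offBoard-kills = All.++⁺ (left a) (below b)
    where
    left : ∀ a′ → All Kills (leftOf a′ b)
    left zero     = []
    left (suc a′) = All.map⁺ (All-[] b (λ j j<b → (0 , suc j) , inj₁ refl , cell z≤n j<b , refl))
    below : ∀ b′ → All Kills (belowOf a b′)
    below zero     = []
    below (suc b′) = All.map⁺ (All-[] a (λ i i<a → (suc i , 0) , inj₁ refl , cell i<a z≤n , refl))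

  Margin : Cover → Set
  Margin c = ∀ s → want s ≡ 0 → c s ≡ 0

  placed-margin : ∀ {d} → Placed a b d → ∀ {c} → Margin c → Margin (add d c)
  placed-margin {d} p {c} m s z = trans (add-out c (avoid p s z)) (m s z)
    where
    avoid : ∀ {d} → Placed a b d → ∀ s → want s ≡ 0 → ¬ s ∈ᵈ d
    avoid (hor _ _) s () (inj₁ refl)
    avoid (hor _ _) s () (inj₂ refl)
    avoid (ver _ _) s () (inj₁ refl)
    avoid (ver _ _) s () (inj₂ refl)

  margin-board : ∀ {c} → Margin c → K c ≡ board a b c
  margin-board {c} m = by (met? c)
    where
    inside : Met c → ∀ {s} → ∃[ i ] ∃[ j ] (i < a × j < b × s ≡ (suc i , suc j)) → c s ≡ 1
    inside all (i , j , i<a , j<b , refl) = All.lookup all (cell i<a j<b)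
    outside : All (λ s → c s ≡ 1) (squares a b) → ∀ {s} → s ∈ cells → c s ≡ want s
    outside all {zero  , j}     s∈ = m _ refl
    outside all {suc i , zero}  s∈ = m _ refl
    outside all {suc i , suc j} s∈ with p , q ← ∈-cartesianProduct⁻ (upTo (suc a)) (upTo (suc b)) s∈ =
      All.lookup all (∈-squares⁺ (ℕ.≤-pred (∈-upTo⁻ p)) (ℕ.≤-pred (∈-upTo⁻ q)))
    by : Dec (Met c) → K c ≡ board a b c
    by (yes all) = trans (K-met all)
      (sym (Target.K-met (squares a b) (λ _ → 1) (All.tabulate λ s∈ → inside all (∈-squares⁻ s∈))))
    by (no ¬all) = trans (K-missed ¬all)
      (sym (Target.K-missed (squares a b) (λ _ → 1) λ all → ¬all (All.tabulate (outside all))))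

  board-sum : S wt (board a b) (dominoes a b) (λ _ → 0) ≡ F a b
  board-sum = begin
    S wt (board a b) (dominoes a b) (λ _ → 0)
      ≡⟨ S-agree wt (dominoes a b) Margin margin-board (All.map placed-margin (dominoes-placed a b)) (λ _ _ → refl) ⟨
    S wt K (dominoes a b) (λ _ → 0)
      ≡⟨ S-kill (leftOf a b ++ belowOf a b) (dominoes a b) offBoard-kills (λ _ → 0) ⟨
    S wt K ((leftOf a b ++ belowOf a b) ++ dominoes a b) (λ _ → 0)
      ≡⟨ S-↭ wt K-ext (scan-dominoes a b) (λ _ → 0) ⟨
    S wt K (scan a b) (λ _ → 0)
      ≡⟨ scan-total ⟩
    F a b ∎
    where open ≡-Reasoning

-- Sums over tilings and double counting of squares

sgn : (Domino → ℤ) → List Domino → ℤ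
sgn w []      = 1ℤ
sgn w (d ∷ D) = w d * sgn w D

sumOf : {A : Set} → (A → ℤ) → List A → ℤ
sumOf f = foldr (λ D acc → f D + acc) 0ℤ

sumOf-++ : ∀ {A : Set} (f : A → ℤ) xs ys → sumOf f (xs ++ ys) ≡ sumOf f xs + sumOf f ys
sumOf-++ f []       ys = sym (+-identityˡ _)
sumOf-++ f (x ∷ xs) ys = trans (cong (λ y → f x + y) (sumOf-++ f xs ys)) (sym (+-assoc (f x) _ _))

sumOf-cong : ∀ {A : Set} {f g : A → ℤ} {xs} → All (λ x → f x ≡ g x) xs → sumOf f xs ≡ sumOf g xs
sumOf-cong []       = refl
sumOf-cong (e ∷ es) = cong₂ _+_ e (sumOf-cong es)

sumOf-map : ∀ {A B : Set} (f : B → ℤ) (g : A → B) xs → sumOf f (List.map g xs) ≡ sumOf (f ∘ g) xs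
sumOf-map f g []       = refl
sumOf-map f g (x ∷ xs) = cong (λ y → f (g x) + y) (sumOf-map f g xs)

sumOf-scale : ∀ {A : Set} k (f : A → ℤ) xs → sumOf (λ x → k * f x) xs ≡ k * sumOf f xs
sumOf-scale k f []       = sym (*-zeroʳ k)
sumOf-scale k f (x ∷ xs) = trans (cong (λ y → k * f x + y) (sumOf-scale k f xs)) (sym (*-distribˡ-+ k (f x) _))

sumOf-filter : ∀ {A : Set} {P : Pred A 0ℓ} (P? : Decidable P) (f : A → ℤ) xs →
  sumOf f (filter P? xs) ≡ sumOf (λ x → f x * ⟦ does (P? x) ⟧) xs
sumOf-filter P? f []       = refl
sumOf-filter P? f (x ∷ xs) with does (P? x)
... | true  = cong₂ _+_ (sym (*-identityʳ (f x))) (sumOf-filter P? f xs)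
... | false = trans (sumOf-filter P? f xs) (trans (sym (+-identityˡ _)) (cong (_+ sumOf (λ x → f x * ⟦ does (P? x) ⟧) xs) (sym (*-zeroʳ (f x)))))

length-filter-∷ : ∀ {A : Set} {P : Pred A 0ℓ} (P? : Decidable P) x xs →
  List.length (filter P? (x ∷ xs)) ≡ bit (does (P? x)) ℕ.+ List.length (filter P? xs)
length-filter-∷ P? x xs with does (P? x)
... | true  = refl
... | false = refl

coverCount-∷ : ∀ s d D → coverCount s (d ∷ D) ≡ hits d s ℕ.+ coverCount s D
coverCount-∷ s = length-filter-∷ (s ∈ᵈ?_)

sum-sublists : ∀ w {K} → Extensional K → ∀ ds c →
  sumOf (λ D → sgn w D * K (λ s → coverCount s D ℕ.+ c s)) (sublists ds) ≡ S w K ds c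
sum-sublists w ext []       c = trans (+-identityʳ _) (*-identityˡ _)
sum-sublists w {K} ext (d ∷ ds) c = begin
  sumOf f (List.map (d ∷_) (sublists ds) ++ sublists ds)
    ≡⟨ sumOf-++ f (List.map (d ∷_) (sublists ds)) (sublists ds) ⟩
  sumOf f (List.map (d ∷_) (sublists ds)) + sumOf f (sublists ds)
    ≡⟨ cong₂ _+_ (sumOf-map f (d ∷_) (sublists ds)) (sum-sublists w ext ds c) ⟩
  sumOf (f ∘ (d ∷_)) (sublists ds) + S w K ds c
    ≡⟨ cong (_+ S w K ds c) (sumOf-cong (All.universal step (sublists ds))) ⟩
  sumOf (λ D → w d * (sgn w D * K (λ s → coverCount s D ℕ.+ add d c s))) (sublists ds) + S w K ds c
    ≡⟨ cong (_+ S w K ds c) (sumOf-scale (w d) _ (sublists ds)) ⟩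
  w d * sumOf (λ D → sgn w D * K (λ s → coverCount s D ℕ.+ add d c s)) (sublists ds) + S w K ds c
    ≡⟨ cong (λ x → w d * x + S w K ds c) (sum-sublists w ext ds (add d c)) ⟩
  w d * S w K ds (add d c) + S w K ds c ∎
  where
  open ≡-Reasoning
  f : List Domino → ℤ
  f D = sgn w D * K (λ s → coverCount s D ℕ.+ c s)
  step : ∀ D → f (d ∷ D) ≡ w d * (sgn w D * K (λ s → coverCount s D ℕ.+ add d c s))
  step D = trans (cong (w d * sgn w D *_) (ext λ s → trans (cong (ℕ._+ c s) (coverCount-∷ s d D))
             (trans (cong (ℕ._+ c s) (ℕ.+-comm (hits d s) _)) (ℕ.+-assoc (coverCount s D) _ _))))
    (*-assoc (w d) (sgn w D) _)

sum-tilings : ∀ w a b → sumOf (sgn w) (tilings a b) ≡ S w (board a b) (dominoes a b) (λ _ → 0)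
sum-tilings w a b = begin
  sumOf (sgn w) (tilings a b)
    ≡⟨ sumOf-filter (isTiling? a b) (sgn w) (sublists (dominoes a b)) ⟩
  sumOf (λ D → sgn w D * board a b (λ s → coverCount s D)) (sublists (dominoes a b))
    ≡⟨ sumOf-cong (All.universal (λ D → cong (sgn w D *_) (ext λ s → sym (ℕ.+-identityʳ (coverCount s D)))) (sublists (dominoes a b))) ⟩
  sumOf (λ D → sgn w D * board a b (λ s → coverCount s D ℕ.+ 0)) (sublists (dominoes a b))
    ≡⟨ sum-sublists w ext (dominoes a b) (λ _ → 0) ⟩
  S w (board a b) (dominoes a b) (λ _ → 0) ∎
  where
  open ≡-Reasoning
  ext : Extensional (board a b)
  ext = Target.K-ext (squares a b) (λ _ → 1)

-- Double counting of the incidences between squares and dominoes. The monoid is arbitrary because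
-- two are needed: integers under addition for the number of horizontal dominoes, and under
-- multiplication for the signs of a tiling and its transpose.
module Tally (M : CommutativeMonoid 0ℓ 0ℓ) where
  open CommutativeMonoid M renaming (refl to ≈-refl; sym to ≈-sym; trans to ≈-trans; reflexive to ≈-reflexive)
  open import Algebra.Properties.CommutativeSemigroup commutativeSemigroup using () renaming (interchange to ∙-interchange)
  open import Algebra.Definitions.RawMonoid rawMonoid using () renaming (_×_ to _⊗_)
  open import Algebra.Properties.Monoid.Mult monoid using (×-homo-+; ×-homo-1; ×-congˡ)

  Π : {A : Set} → (A → Carrier) → List A → Carrier
  Π f = foldr (λ x acc → f x ∙ acc) ε

  Π-cong : ∀ {A : Set} {f g : A → Carrier} xs → (∀ x → x ∈ xs → f x ≈ g x) → Π f xs ≈ Π g xs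
  Π-cong []       e = ≈-refl
  Π-cong (x ∷ xs) e = ∙-cong (e x (here refl)) (Π-cong xs (λ y y∈ → e y (there y∈)))

  Π-∙ : ∀ {A : Set} (f g : A → Carrier) xs → Π (λ x → f x ∙ g x) xs ≈ Π f xs ∙ Π g xs
  Π-∙ f g []       = ≈-sym (identityˡ ε)
  Π-∙ f g (x ∷ xs) = ≈-trans (∙-congˡ (Π-∙ f g xs)) (∙-interchange (f x) (g x) _ _)

  Π-ε : ∀ {A : Set} (xs : List A) → Π (λ _ → ε) xs ≈ ε
  Π-ε []       = ≈-refl
  Π-ε (x ∷ xs) = ≈-trans (identityˡ _) (Π-ε xs)

  Π-++ : ∀ {A : Set} (f : A → Carrier) xs ys → Π f (xs ++ ys) ≈ Π f xs ∙ Π f ys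
  Π-++ f []       ys = ≈-sym (identityˡ _)
  Π-++ f (x ∷ xs) ys = ≈-trans (∙-congˡ (Π-++ f xs ys)) (≈-sym (assoc _ _ _))

  Π-map : ∀ {A B : Set} (f : B → Carrier) (g : A → B) xs → Π f (List.map g xs) ≈ Π (f ∘ g) xs
  Π-map f g []       = ≈-refl
  Π-map f g (x ∷ xs) = ∙-congˡ (Π-map f g xs)

  Π-concatMap : ∀ {A B : Set} (f : B → Carrier) (g : A → List B) xs → Π f (concatMap g xs) ≈ Π (λ x → Π f (g x)) xs
  Π-concatMap f g []       = ≈-refl
  Π-concatMap f g (x ∷ xs) = ≈-trans (Π-++ f (g x) (concatMap g xs)) (∙-congˡ (Π-concatMap f g xs))

  only : Bool → Carrier → Carrier
  only true  x = x
  only false x = ε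

  only-no : ∀ {A : Set} (p : Dec A) → ¬ A → ∀ x → only (does p) x ≈ ε
  only-no p ¬a x = ≈-reflexive (cong (λ b → only b x) (dec-false p ¬a))

  only-yes : ∀ {A : Set} (p : Dec A) → A → ∀ x → only (does p) x ≈ x
  only-yes p a x = ≈-reflexive (cong (λ b → only b x) (dec-true p a))

  Π-only-none : ∀ (g : Square → Carrier) u xs → ¬ u ∈ xs → Π (λ s → only (does (s ≟ˢ u)) (g s)) xs ≈ ε
  Π-only-none g u []       _  = ≈-refl
  Π-only-none g u (x ∷ xs) u∉ = ≈-trans
    (∙-cong (only-no (x ≟ˢ u) (λ { refl → u∉ (here refl) }) (g x)) (Π-only-none g u xs (u∉ ∘ there)))
    (identityˡ ε)

  Π-only : ∀ (g : Square → Carrier) {u xs} → Unique xs → u ∈ xs → Π (λ s → only (does (s ≟ˢ u)) (g s)) xs ≈ g u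
  Π-only g {u} {x ∷ xs} (x∉ ∷ uniq) (here refl)  = ≈-trans
    (∙-cong (only-yes (x ≟ˢ u) refl (g x)) (Π-only-none g u xs (λ u∈xs → All.lookup x∉ u∈xs refl)))
    (identityʳ (g x))
  Π-only g {u} {x ∷ xs} (x∉ ∷ uniq) (there u∈xs) = ≈-trans
    (∙-cong (only-no (x ≟ˢ u) (All.lookup x∉ u∈xs) (g x)) (Π-only g uniq u∈xs))
    (identityˡ (g u))

  Proper : List Square → Domino → Set
  Proper xs (s , t) = s ∈ xs × t ∈ xs × s ≢ t

  disjoint-only : ∀ {A B : Set} (p : Dec A) (q : Dec B) → ¬ (A × B) → ∀ x →
    bit (does p ∨ does q) ⊗ x ≈ only (does p) x ∙ only (does q) x
  disjoint-only (yes a) (yes b) ¬ab x = contradiction (a , b) ¬ab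
  disjoint-only (yes a) (no ¬b) ¬ab x = ≈-refl
  disjoint-only (no ¬a) (yes b) ¬ab x = ≈-trans (identityʳ x) (≈-sym (identityˡ x))
  disjoint-only (no ¬a) (no ¬b) ¬ab x = ≈-sym (identityˡ ε)

  hits-only : ∀ (g : Square → Carrier) d → proj₁ d ≢ proj₂ d → ∀ s →
    hits d s ⊗ g s ≈ only (does (s ≟ˢ proj₁ d)) (g s) ∙ only (does (s ≟ˢ proj₂ d)) (g s)
  hits-only g (u , v) u≢v s = disjoint-only (s ≟ˢ u) (s ≟ˢ v) (λ { (refl , e) → u≢v e }) (g s)

  tally : ∀ (g : Square → Carrier) {xs} → Unique xs → ∀ {D} → All (Proper xs) D →
    Π (λ s → coverCount s D ⊗ g s) xs ≈ Π (λ d → g (proj₁ d) ∙ g (proj₂ d)) D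
  tally g {xs} uniq [] = Π-ε xs
  tally g {xs} uniq {d ∷ D} ((u∈ , v∈ , u≢v) ∷ proper) =
    ≈-trans (Π-cong xs (λ s _ → ≈-trans (≈-reflexive (cong (_⊗ g s) (coverCount-∷ s d D)))
                                        (×-homo-+ (g s) (hits d s) (coverCount s D))))
    (≈-trans (Π-∙ (λ s → hits d s ⊗ g s) _ xs)
      (∙-cong
        (≈-trans (Π-cong xs (λ s _ → hits-only g d u≢v s))
          (≈-trans (Π-∙ (λ s → only (does (s ≟ˢ proj₁ d)) (g s)) _ xs)
                   (∙-cong (Π-only g uniq u∈) (Π-only g uniq v∈))))
        (tally g uniq proper)))

  tally-once : ∀ (g : Square → Carrier) {xs D} → Unique xs → All (Proper xs) D → All (λ s → coverCount s D ≡ 1) xs →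
    Π (λ d → g (proj₁ d) ∙ g (proj₂ d)) D ≈ Π g xs
  tally-once g {xs} uniq proper once = ≈-trans (≈-sym (tally g uniq proper))
    (Π-cong xs (λ s s∈ → ≈-trans (≈-reflexive (cong (_⊗ g s) (All.lookup once s∈))) (×-homo-1 (g s))))

-- Signs of tilings and reciprocity

squares-unique : ∀ a b → Unique (squares a b)
squares-unique a b = subst Unique (sym (squares-cartesian a b))
  (Unique.cartesianProduct⁺ (Unique.map⁺ ℕ.suc-injective (Unique.upTo⁺ a)) (Unique.map⁺ ℕ.suc-injective (Unique.upTo⁺ b)))

sublists-All : ∀ {A : Set} {P : A → Set} {xs} → All P xs → All (All P) (sublists xs)
sublists-All []       = [] ∷ []
sublists-All (p ∷ ps) = All.++⁺ (All.map⁺ (All.map (p ∷_) (sublists-All ps))) (sublists-All ps)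

tilings-All : ∀ a b → All (λ D → All (Placed a b) D × IsTiling a b D) (tilings a b)
tilings-All a b = All.zip
  ( All.filter⁺ (isTiling? a b) (sublists-All (dominoes-placed a b))
  , All.all-filter (isTiling? a b) (sublists (dominoes a b)))

placed-proper : ∀ {a b d} → Placed a b d →
  proj₁ d ∈ squares a b × proj₂ d ∈ squares a b × proj₁ d ≢ proj₂ d
placed-proper (hor i<a j<b) = ∈-squares⁺ (ℕ.<⇒≤ i<a) j<b , ∈-squares⁺ i<a j<b , λ ()
placed-proper (ver i<a j<b) = ∈-squares⁺ i<a (ℕ.<⇒≤ j<b) , ∈-squares⁺ i<a j<b , λ ()

module _ (M : CommutativeMonoid 0ℓ 0ℓ) where
  open CommutativeMonoid M renaming (refl to ≈-refl; sym to ≈-sym; trans to ≈-trans; reflexive to ≈-reflexive)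
  open Tally M

  Π-tiling : ∀ (g : Square → Carrier) {a b D} → All (Placed a b) D → IsTiling a b D →
    Π (λ d → g (proj₁ d) ∙ g (proj₂ d)) D ≈ Π (λ i → Π (λ j → g (suc i , suc j)) (upTo b)) (upTo a)
  Π-tiling g {a} {b} {D} placed tiles = ≈-trans
    (tally-once g (squares-unique a b) (All.map placed-proper placed) tiles)
    (≈-trans (Π-concatMap g (λ i → List.map (λ j → (i , j)) [ b ]) [ a ])
      (≈-trans (Π-map _ suc (upTo a))
        (Π-cong (upTo a) (λ i _ → ≈-trans (Π-map g (λ j → (suc i , j)) [ b ]) (Π-map _ suc (upTo b))))))

  Π-upTo-suc : ∀ (f : ℕ → Carrier) n → Π f (upTo (suc n)) ≈ Π f (upTo n) ∙ f n
  Π-upTo-suc f n = ≈-trans (≈-reflexive (cong (Π f) (sym (List.upTo-∷ʳ n))))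
    (≈-trans (Π-++ f (upTo n) (n ∷ [])) (∙-congˡ (identityʳ (f n))))

module ℤ+ = Tally +-0-commutativeMonoid
module ℤ* = Tally *-1-commutativeMonoid

-- A horizontal domino meets exactly one odd column, so giving the squares of these columns alternating
-- row signs makes every vertical domino cancel and every horizontal one contribute the sign of its row.
odd : ℕ → Bool
odd zero    = false
odd (suc n) = not (odd n)

column-sign : Square → ℤ
column-sign (i , j) = ⟦ odd i ⟧ * σ j

column-sign-H : ∀ i j → column-sign (i , j) + column-sign (suc i , j) ≡ σ j
column-sign-H i j = lem (odd i) (σ j)
  where
  lem : ∀ b x → ⟦ b ⟧ * x + ⟦ not b ⟧ * x ≡ x
  lem false x = trans (+-identityˡ _) (*-identityˡ x)
  lem true  x = trans (+-identityʳ _) (*-identityˡ x)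

column-sign-V : ∀ i j → column-sign (i , j) + column-sign (i , suc j) ≡ 0ℤ
column-sign-V i j = lem ⟦ odd i ⟧ (σ j)
  where
  lem : ∀ b x → b * x + b * - x ≡ 0ℤ
  lem = solve-∀

column-total : ∀ (a k : ℕ) →
  ℤ+.Π (λ i → ℤ+.Π (λ j → column-sign (suc i , suc j)) (upTo (k ℕ.+ k))) (upTo a) ≡ 0ℤ
column-total a k = trans (ℤ+.Π-cong (upTo a) (λ i _ → cancel i k)) (ℤ+.Π-ε (upTo a))
  where
  cancel : ∀ i k → ℤ+.Π (λ j → column-sign (suc i , suc j)) (upTo (k ℕ.+ k)) ≡ 0ℤ
  cancel i zero    = refl
  cancel i (suc k) = begin
    sum (upTo (suc (k ℕ.+ suc k)))           ≡⟨ cong (λ l → sum (upTo (suc l))) (ℕ.+-suc k k) ⟩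
    sum (upTo (suc (suc n)))                 ≡⟨ Π-upTo-suc +-0-commutativeMonoid f (suc n) ⟩
    sum (upTo (suc n)) + f (suc n)           ≡⟨ cong (_+ f (suc n)) (Π-upTo-suc +-0-commutativeMonoid f n) ⟩
    sum (upTo n) + f n + f (suc n)           ≡⟨ +-assoc (sum (upTo n)) (f n) (f (suc n)) ⟩
    sum (upTo n) + (f n + f (suc n))         ≡⟨ cong₂ _+_ (cancel i k) (column-sign-V (suc i) (suc n)) ⟩
    0ℤ ∎
    where
    open ≡-Reasoning
    n = k ℕ.+ k
    f : ℕ → ℤ
    f j = column-sign (suc i , suc j)
    sum : List ℕ → ℤ
    sum = ℤ+.Π f

σ-cases : ∀ n → σ n ≡ 1ℤ ⊎ σ n ≡ -1ℤ
σ-cases zero    = inj₁ refl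
σ-cases (suc n) with σ-cases n
... | inj₁ e = inj₂ (cong -_ e)
... | inj₂ e = inj₁ (cong -_ e)

h-H : ∀ i j D → h (H i j ∷ D) ≡ suc (h D)
h-H i j D = trans (length-filter-∷ isHorizontal? (H i j) D)
  (cong (λ b → bit b ℕ.+ h D) (dec-true (isHorizontal? (H i j)) refl))

h-V : ∀ i j D → h (V i j ∷ D) ≡ h D
h-V i j D = trans (length-filter-∷ isHorizontal? (V i j) D)
  (cong (λ b → bit b ℕ.+ h D) (dec-false (isHorizontal? (V i j)) (λ e → ℕ.<⇒≢ (ℕ.n<1+n j) e)))

row-signs : List Domino → ℤ
row-signs = ℤ+.Π (λ d → column-sign (proj₁ d) + column-sign (proj₂ d))

-- The witness `k` is the number of horizontal dominoes in odd rows. Each of them adds 1 to `h D`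
-- but -1 to the row signs, a difference of 2, and contributes -1 to the weight.
horizontal-count : ∀ {a b D} → All (Placed a b) D → ∃[ k ] (+ h D ≡ row-signs D + + (k ℕ.+ k) × sgn wt D ≡ σ k)
horizontal-count [] = 0 , refl , refl
horizontal-count {D = _ ∷ D} (hor {i} {j} _ _ ∷ placed) with horizontal-count placed | σ-cases (suc j)
... | k , count , sign | inj₁ e = k
  , trans (cong +_ (h-H (suc i) (suc j) D)) (trans (pos-+ 1 (h D)) (trans (cong (λ x → 1ℤ + x) count)
      (lem (trans (column-sign-H (suc i) (suc j)) e) (row-signs D) (+ (k ℕ.+ k)))))
  , trans (cong₂ _*_ (trans (wt-H (suc i) (suc j)) e) sign) (*-identityˡ (σ k))
  where
  lem : ∀ {u} → u ≡ 1ℤ → ∀ x y → 1ℤ + (x + y) ≡ u + x + y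
  lem refl x y = sym (+-assoc 1ℤ x y)
... | k , count , sign | inj₂ e = suc k
  , trans (cong +_ (h-H (suc i) (suc j) D)) (trans (pos-+ 1 (h D)) (trans (cong (λ x → 1ℤ + x) count)
      (trans (lem (trans (column-sign-H (suc i) (suc j)) e) (row-signs D) (+ (k ℕ.+ k)))
        (cong (λ l → row-signs (H (suc i) (suc j) ∷ D) + + (suc l)) (sym (ℕ.+-suc k k))))))
  , trans (cong₂ _*_ (trans (wt-H (suc i) (suc j)) e) sign) (-1*i≡-i (σ k))
  where
  ring : ∀ x y → 1ℤ + (x + y) ≡ -1ℤ + x + (1ℤ + (1ℤ + y))
  ring = solve-∀
  lem : ∀ {u} → u ≡ -1ℤ → ∀ x y → 1ℤ + (x + y) ≡ u + x + (1ℤ + (1ℤ + y))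
  lem refl = ring
horizontal-count {D = _ ∷ D} (ver {i} {j} _ _ ∷ placed) with horizontal-count placed
... | k , count , sign = k
  , trans (cong +_ (h-V (suc i) (suc j) D)) (trans count
      (lem (column-sign-V (suc i) (suc j)) (row-signs D) (+ (k ℕ.+ k))))
  , trans (cong₂ _*_ (wt-V (suc i) (suc j)) sign) (*-identityˡ (σ k))
  where
  lem : ∀ {u} → u ≡ 0ℤ → ∀ x y → x + y ≡ u + x + y
  lem refl x y = cong (_+ y) (sym (+-identityˡ x))

iPow-double : ∀ k → iPow (k ℕ.+ k) ≡ toℤi (σ k)
iPow-double zero    = refl
iPow-double (suc k) rewrite ℕ.+-suc k k | iPow-double k = refl

-- In even height the row signs add up to 0. Hence `h D` is twice the number of horizontal dominoes
-- in odd rows, and the power of √-1 is -1 to that number.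
tiling-weight : ∀ a k {D} → All (Placed a (k ℕ.+ k)) D → IsTiling a (k ℕ.+ k) D → iPow (h D) ≡ toℤi (sgn wt D)
tiling-weight a k {D} placed tiles with horizontal-count placed
... | l , count , sign = trans (cong iPow (+-injective (trans count
    (trans (cong (_+ + (l ℕ.+ l)) (trans (Π-tiling +-0-commutativeMonoid column-sign placed tiles) (column-total a k)))
      (+-identityˡ _)))))
  (trans (iPow-double l) (cong toℤi (sym sign)))

sum-toℤi : ∀ {f : List Domino → ℤi} {g : List Domino → ℤ} {Ds} → All (λ D → f D ≡ toℤi (g D)) Ds →
  foldr (λ D acc → f D +ᵍ acc) 0ᵍ Ds ≡ toℤi (sumOf g Ds)
sum-toℤi []       = refl
sum-toℤi (e ∷ es) = cong₂ _+ᵍ_ e (sum-toℤi es)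

dominoSum-F : ∀ a k → dominoSum a (k ℕ.+ k) ≡ toℤi (F a (k ℕ.+ k))
dominoSum-F a k = trans
  (sum-toℤi (All.map (λ { (placed , tiles) → tiling-weight a k placed tiles }) (tilings-All a (k ℕ.+ k))))
  (cong toℤi (trans (sum-tilings wt a (k ℕ.+ k)) (board-sum a (k ℕ.+ k))))

flip : Domino → Domino
flip (s , t) = swap s , swap t

flip-hits : ∀ d s → hits (flip d) s ≡ hits d (swap s)
flip-hits ((i , j) , (i′ , j′)) (x , y) = cong bit (cong₂ _∨_ (flip≟ x y i j) (flip≟ x y i′ j′))
  where
  flip≟ : ∀ x y i j → does ((x , y) ≟ˢ (j , i)) ≡ does ((y , x) ≟ˢ (i , j))
  flip≟ x y i j with (y , x) ≟ˢ (i , j)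
  ... | yes e = dec-true ((x , y) ≟ˢ (j , i)) (cong swap e)
  ... | no ¬e = dec-false ((x , y) ≟ˢ (j , i)) (¬e ∘ cong swap)

S-flip : ∀ w {K} → Extensional K → ∀ ds {c c′} → (∀ s → c s ≡ c′ (swap s)) →
  S w K (List.map flip ds) c ≡ S (w ∘ flip) (λ c → K (c ∘ swap)) ds c′
S-flip w ext []       e = ext e
S-flip w ext (d ∷ ds) e = cong₂ (λ x y → w (flip d) * x + y)
  (S-flip w ext ds (λ s → cong₂ ℕ._+_ (flip-hits d s) (e s))) (S-flip w ext ds e)

dominoes-flip : ∀ a b → dominoes b a ↭ List.map flip (dominoes a b)
dominoes-flip a b = ↭-trans (Perm.++-comm (horizontalDominoes b a) (verticalDominoes b a))
  (↭-trans (Perm.++⁺ (grid V H (λ _ _ → refl) [ a ∸ 1 ] [ b ]) (grid H V (λ _ _ → refl) [ a ] [ b ∸ 1 ]))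
    (↭-reflexive (sym (List.map-++ flip (horizontalDominoes a b) (verticalDominoes a b)))))
  where
  grid : ∀ (f g : ℕ → ℕ → Domino) → (∀ x y → flip (g x y) ≡ f y x) → ∀ (xs ys : List ℕ) →
    concatMap (λ y → List.map (f y) xs) ys ↭ List.map flip (concatMap (λ x → List.map (g x) ys) xs)
  grid f g e xs ys = ↭-trans (concatMap-map-swap f ys xs) (↭-reflexive (sym
    (trans (List.map-concatMap flip (λ x → List.map (g x) ys) xs)
      (List.concatMap-cong (λ x → trans (sym (List.map-∘ ys)) (List.map-cong (e x) ys)) xs))))

swap-squares : ∀ a b {s} → s ∈ squares a b → swap s ∈ squares b a
swap-squares a b s∈ with i , j , i<a , j<b , refl ← ∈-squares⁻ {a} {b} s∈ = ∈-squares⁺ j<b i<a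

board-flip : ∀ a b c → board b a (c ∘ swap) ≡ board a b c
board-flip a b c = by (Target.met? (squares a b) (λ _ → 1) c)
  where
  by : Dec (All (λ s → c s ≡ 1) (squares a b)) → board b a (c ∘ swap) ≡ board a b c
  by (yes m) = trans (Target.K-met (squares b a) (λ _ → 1) (All.tabulate (λ s∈ → All.lookup m (swap-squares b a s∈))))
    (sym (Target.K-met (squares a b) (λ _ → 1) m))
  by (no ¬m) = trans (Target.K-missed (squares b a) (λ _ → 1)
      (λ m → ¬m (All.tabulate (λ s∈ → All.lookup m (swap-squares a b s∈)))))
    (sym (Target.K-missed (squares a b) (λ _ → 1) ¬m))

S-weight : ∀ {w w′ K K′} → (∀ d → w d ≡ w′ d) → (∀ c → K c ≡ K′ c) → ∀ ds c → S w K ds c ≡ S w′ K′ ds c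
S-weight ew eK []       c = eK c
S-weight ew eK (d ∷ ds) c = cong₂ _+_ (cong₂ _*_ (ew d) (S-weight ew eK ds (add d c))) (S-weight ew eK ds c)

sum-flipped : ∀ a b → sumOf (sgn (wt ∘ flip)) (tilings a b) ≡ F b a
sum-flipped a b = begin
  sumOf (sgn (wt ∘ flip)) (tilings a b)
    ≡⟨ sum-tilings (wt ∘ flip) a b ⟩
  S (wt ∘ flip) (board a b) (dominoes a b) (λ _ → 0)
    ≡⟨ S-weight (λ _ → refl) (λ c → sym (board-flip a b c)) (dominoes a b) _ ⟩
  S (wt ∘ flip) (λ c → board b a (c ∘ swap)) (dominoes a b) (λ _ → 0)
    ≡⟨ S-flip wt ext (dominoes a b) (λ _ → refl) ⟨
  S wt (board b a) (List.map flip (dominoes a b)) (λ _ → 0)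
    ≡⟨ S-↭ wt ext (dominoes-flip a b) (λ _ → 0) ⟨
  S wt (board b a) (dominoes b a) (λ _ → 0)
    ≡⟨ board-sum b a ⟩
  F b a ∎
  where
  open ≡-Reasoning
  ext : Extensional (board b a)
  ext = Target.K-ext (squares b a) (λ _ → 1)

-- Chosen so that the signs of the two squares of a domino multiply to wt d * wt (flip d).
area-sign : Square → ℤ
area-sign (i , j) = σ (i ℕ.* j)

wt-flip : ∀ {a b d} → Placed a b d → area-sign (proj₁ d) * area-sign (proj₂ d) ≡ wt d * wt (flip d)
wt-flip (hor {i} {j} _ _) = begin
  σ (suc i ℕ.* suc j) * σ (suc j ℕ.+ suc i ℕ.* suc j)
    ≡⟨ cong (σ (suc i ℕ.* suc j) *_) (σ-+ (suc j) (suc i ℕ.* suc j)) ⟩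
  σ (suc i ℕ.* suc j) * (σ (suc j) * σ (suc i ℕ.* suc j))
    ≡⟨ lem (σ (suc i ℕ.* suc j)) (σ (suc j)) ⟩
  σ (suc j) * (σ (suc i ℕ.* suc j) * σ (suc i ℕ.* suc j))
    ≡⟨ cong (σ (suc j) *_) (σ² (suc i ℕ.* suc j)) ⟩
  σ (suc j) * 1ℤ
    ≡⟨ cong₂ _*_ (wt-H (suc i) (suc j)) (wt-V (suc j) (suc i)) ⟨
  wt (H (suc i) (suc j)) * wt (V (suc j) (suc i)) ∎
  where
  open ≡-Reasoning
  lem : ∀ x y → x * (y * x) ≡ y * (x * x)
  lem = solve-∀
wt-flip (ver {i} {j} _ _) = begin
  σ (suc i ℕ.* suc j) * σ (suc i ℕ.* suc (suc j))
    ≡⟨ cong (λ x → σ (suc i ℕ.* suc j) * σ x) (ℕ.*-suc (suc i) (suc j)) ⟩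
  σ (suc i ℕ.* suc j) * σ (suc i ℕ.+ suc i ℕ.* suc j)
    ≡⟨ cong (σ (suc i ℕ.* suc j) *_) (σ-+ (suc i) (suc i ℕ.* suc j)) ⟩
  σ (suc i ℕ.* suc j) * (σ (suc i) * σ (suc i ℕ.* suc j))
    ≡⟨ lem (σ (suc i ℕ.* suc j)) (σ (suc i)) ⟩
  (σ (suc i ℕ.* suc j) * σ (suc i ℕ.* suc j)) * σ (suc i)
    ≡⟨ cong (_* σ (suc i)) (σ² (suc i ℕ.* suc j)) ⟩
  1ℤ * σ (suc i)
    ≡⟨ cong₂ _*_ (wt-V (suc i) (suc j)) (wt-H (suc j) (suc i)) ⟨
  wt (V (suc i) (suc j)) * wt (H (suc j) (suc i)) ∎
  where
  open ≡-Reasoning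
  lem : ∀ x y → x * (y * x) ≡ (x * x) * y
  lem = solve-∀

sgn-flip : ∀ {a b D} → All (Placed a b) D →
  ℤ*.Π (λ d → area-sign (proj₁ d) * area-sign (proj₂ d)) D ≡ sgn wt D * sgn (wt ∘ flip) D
sgn-flip [] = refl
sgn-flip {D = d ∷ D} (p ∷ ps) = trans (cong₂ _*_ (wt-flip p) (sgn-flip ps))
  (lem (wt d) (wt (flip d)) (sgn wt D) (sgn (wt ∘ flip) D))
  where
  lem : ∀ x y u v → (x * y) * (u * v) ≡ (x * u) * (y * v)
  lem = solve-∀

-- The sum 1 + ... + 2k = k (2k + 1) has the parity of k.
sign-product : ∀ m k → ℤ*.Π (λ j → σ (m ℕ.* suc j)) (upTo (k ℕ.+ k)) ≡ σ (m ℕ.* k)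
sign-product m zero    = cong σ (sym (ℕ.*-zeroʳ m))
sign-product m (suc k) = begin
  ℤ*.Π f (upTo (suc (k ℕ.+ suc k)))        ≡⟨ cong (λ l → ℤ*.Π f (upTo (suc l))) (ℕ.+-suc k k) ⟩
  ℤ*.Π f (upTo (suc (suc n)))              ≡⟨ Π-upTo-suc *-1-commutativeMonoid f (suc n) ⟩
  ℤ*.Π f (upTo (suc n)) * f (suc n)        ≡⟨ cong (_* f (suc n)) (Π-upTo-suc *-1-commutativeMonoid f n) ⟩
  ℤ*.Π f (upTo n) * f n * f (suc n)        ≡⟨ cong (λ x → x * f n * f (suc n)) (sign-product m k) ⟩
  σ (m ℕ.* k) * f n * f (suc n)            ≡⟨ cong (σ (m ℕ.* k) * f n *_) (trans (cong σ (ℕ.*-suc m (suc n))) (σ-+ m (m ℕ.* suc n))) ⟩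
  σ (m ℕ.* k) * f n * (σ m * f n)          ≡⟨ lem (σ (m ℕ.* k)) (f n) (σ m) ⟩
  σ m * σ (m ℕ.* k) * (f n * f n)          ≡⟨ cong (σ m * σ (m ℕ.* k) *_) (σ² (m ℕ.* suc n)) ⟩
  σ m * σ (m ℕ.* k) * 1ℤ                   ≡⟨ *-identityʳ _ ⟩
  σ m * σ (m ℕ.* k)                        ≡⟨ σ-+ m (m ℕ.* k) ⟨
  σ (m ℕ.+ m ℕ.* k)                        ≡⟨ cong σ (ℕ.*-suc m k) ⟨
  σ (m ℕ.* suc k) ∎
  where
  open ≡-Reasoning
  n = k ℕ.+ k
  f : ℕ → ℤ
  f j = σ (m ℕ.* suc j)
  lem : ∀ x y z → x * y * (z * y) ≡ z * x * (y * y)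
  lem = solve-∀

area-total : ∀ l k →
  ℤ*.Π (λ i → ℤ*.Π (λ j → area-sign (suc i , suc j)) (upTo (k ℕ.+ k))) (upTo (l ℕ.+ l)) ≡ σ (k ℕ.* l)
area-total l k = trans
  (ℤ*.Π-cong (upTo (l ℕ.+ l)) (λ i _ → trans (sign-product (suc i) k) (cong σ (ℕ.*-comm (suc i) k))))
  (sign-product k l)

sgn² : ∀ D → sgn (wt ∘ flip) D * sgn (wt ∘ flip) D ≡ 1ℤ
sgn² []      = refl
sgn² (((i , j) , (i′ , j′)) ∷ D) = trans (lem (σ (i ℕ.* (j ℕ.+ j′))) _)
  (cong₂ _*_ (σ² (i ℕ.* (j ℕ.+ j′))) (sgn² D))
  where
  lem : ∀ x y → (x * y) * (x * y) ≡ (x * x) * (y * y)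
  lem = solve-∀

-- Transposition keeps the tilings but moves the signs from the horizontal to the vertical dominoes.
-- The quotient of the two weights of a tiling is the product of `area-sign` over all squares of the
-- board, the same for every tiling.
F-reciprocity : ∀ l k → F (l ℕ.+ l) (k ℕ.+ k) ≡ σ (k ℕ.* l) * F (k ℕ.+ k) (l ℕ.+ l)
F-reciprocity l k = begin
  F a b
    ≡⟨ board-sum a b ⟨
  S wt (board a b) (dominoes a b) (λ _ → 0)
    ≡⟨ sum-tilings wt a b ⟨
  sumOf (sgn wt) (tilings a b)
    ≡⟨ sumOf-cong (All.map (λ { {D} (placed , tiles) → each D placed tiles }) (tilings-All a b)) ⟩
  sumOf (λ D → σ (k ℕ.* l) * sgn (wt ∘ flip) D) (tilings a b)
    ≡⟨ sumOf-scale (σ (k ℕ.* l)) (sgn (wt ∘ flip)) (tilings a b) ⟩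
  σ (k ℕ.* l) * sumOf (sgn (wt ∘ flip)) (tilings a b)
    ≡⟨ cong (σ (k ℕ.* l) *_) (sum-flipped a b) ⟩
  σ (k ℕ.* l) * F b a ∎
  where
  open ≡-Reasoning
  a = l ℕ.+ l
  b = k ℕ.+ k
  each : ∀ D → All (Placed a b) D → IsTiling a b D → sgn wt D ≡ σ (k ℕ.* l) * sgn (wt ∘ flip) D
  each D placed tiles = begin
    sgn wt D
      ≡⟨ *-identityʳ _ ⟨
    sgn wt D * 1ℤ
      ≡⟨ cong (sgn wt D *_) (sgn² D) ⟨
    sgn wt D * (sgn (wt ∘ flip) D * sgn (wt ∘ flip) D)
      ≡⟨ *-assoc (sgn wt D) _ _ ⟨
    sgn wt D * sgn (wt ∘ flip) D * sgn (wt ∘ flip) D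
      ≡⟨ cong (_* sgn (wt ∘ flip) D) (trans (sym (sgn-flip placed))
           (trans (Π-tiling *-1-commutativeMonoid area-sign placed tiles) (area-total l k))) ⟩
    σ (k ℕ.* l) * sgn (wt ∘ flip) D ∎

-- Lagrange's theorem and Gauss's lemma

subset-↭ : ∀ {A : Set} {xs ys : List A} → Unique xs → (∀ {x} → x ∈ xs → x ∈ ys) → length xs ≡ length ys → xs ↭ ys
subset-↭ {xs = []}     {[]}     _             _   _   = ↭-refl
subset-↭ {xs = x ∷ xs} (x∉ ∷ uniq) sub len with us , vs , refl ← ∈-∃++ (sub (here refl)) =
  ↭-trans (Perm.prep x (subset-↭ uniq sub′ len′)) (↭-sym (Perm.shift x us vs))
  where
  sub′ : ∀ {y} → y ∈ xs → y ∈ us ++ vs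
  sub′ y∈ with ∈-++⁻ us (sub (there y∈))
  ... | inj₁ y∈us         = ∈-++⁺ˡ y∈us
  ... | inj₂ (here refl)  = contradiction refl (All.lookup x∉ y∈)
  ... | inj₂ (there y∈vs) = ∈-++⁺ʳ us y∈vs
  len′ : length xs ≡ length (us ++ vs)
  len′ = ℕ.suc-injective (trans len (Perm.↭-length (Perm.shift x us vs)))

Π-↭ : ∀ {A : Set} (f : A → ℤ) {xs ys} → xs ↭ ys → ℤ*.Π f xs ≡ ℤ*.Π f ys
Π-↭ f Perm.refl         = refl
Π-↭ f (Perm.prep x p)   = cong (f x *_) (Π-↭ f p)
Π-↭ f (Perm.swap x y p) = trans (cong (λ z → f x * (f y * z)) (Π-↭ f p)) (lem (f x) (f y) _)
  where
  lem : ∀ a b c → a * (b * c) ≡ b * (a * c)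
  lem = solve-∀
Π-↭ f (Perm.trans p q)  = trans (Π-↭ f p) (Π-↭ f q)

Π-applyUpTo : ∀ {A : Set} (f : A → ℤ) (g : ℕ → A) n → ℤ*.Π f (applyUpTo g n) ≡ ℤ*.Π (f ∘ g) (upTo n)
Π-applyUpTo f g n = trans (cong (ℤ*.Π f) (sym (List.map-upTo g n))) (ℤ*.Π-map f g (upTo n))

Π-const : ∀ x n → ℤ*.Π (λ _ → x) (upTo n) ≡ x ^ n
Π-const x zero    = refl
Π-const x (suc n) = cong (x *_) (trans (Π-applyUpTo (λ _ → x) suc n) (Π-const x n))

σ-odd : ∀ x k → σ (suc (x ℕ.+ x) ℕ.* k) ≡ σ k
σ-odd x k = trans (σ-+ k ((x ℕ.+ x) ℕ.* k)) (trans
  (cong (σ k *_) (trans (cong σ (ℕ.*-distribʳ-+ k x x)) (σ-double (x ℕ.* k)))) (*-identityʳ (σ k)))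

*-^ : ∀ x y n → (x * y) ^ n ≡ x ^ n * y ^ n
*-^ x y zero    = refl
*-^ x y (suc n) = trans (cong (x * y *_) (*-^ x y n)) (lem x y (x ^ n) (y ^ n))
  where
  lem : ∀ x y a b → (x * y) * (a * b) ≡ (x * a) * (y * b)
  lem = solve-∀

Π-square : ∀ {f : ℕ → ℤ} xs → (∀ i → f i * f i ≡ 1ℤ) → ℤ*.Π f xs * ℤ*.Π f xs ≡ 1ℤ
Π-square {f} []       e = refl
Π-square {f} (x ∷ xs) e = trans (lem (f x) _) (cong₂ _*_ (e x) (Π-square {f} xs e))
  where
  lem : ∀ a b → (a * b) * (a * b) ≡ (a * a) * (b * b)
  lem = solve-∀

module OddPrime (h : ℕ) (p-prime : Prime (suc (h ℕ.+ h))) where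

  p : ℕ
  p = suc (h ℕ.+ h)

  h≥1 : 1 ≤ h
  h≥1 = positive h p-prime
    where
    positive : ∀ h → Prime (suc (h ℕ.+ h)) → 1 ≤ h
    positive zero    pr = contradiction pr ¬prime[1]
    positive (suc h) pr = s≤s z≤n

  h<p : h < p
  h<p = s≤s (ℕ.m≤m+n h h)

  2<p : 2 < p
  2<p = s≤s (ℕ.+-mono-≤ h≥1 h≥1)

  infix 4 p∣_ _≋_

  p∣_ : ℤ → Set
  p∣ x = + p ∣ x

  -- A record rather than an abbreviation, so that `x` and `y` can be inferred from the type of a
  -- proof; the difference alone does not determine them.
  record _≋_ (x y : ℤ) : Set where
    constructor congruent
    field difference : p∣ x - y
  open _≋_

  euclid : ∀ x y → p∣ x * y → p∣ x ⊎ p∣ y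
  euclid x y p∣xy with euclidsLemma ∣ x ∣ ∣ y ∣ p-prime (subst (p ℕ.∣_) (abs-* x y) (∣⇒∣ᵤ p∣xy))
  ... | inj₁ p∣x = inj₁ (∣ᵤ⇒∣ p∣x)
  ... | inj₂ p∣y = inj₂ (∣ᵤ⇒∣ p∣y)

  small : ∀ x → ∣ x ∣ < p → p∣ x → x ≡ 0ℤ
  small x x<p p∣x with ∣ x ∣ in eq
  ... | zero  = ∣i∣≡0⇒i≡0 eq
  ... | suc n = contradiction (subst (p ℕ.∣_) eq (∣⇒∣ᵤ p∣x)) (ℕ.>⇒∤ x<p)

  ≋-reflexive : ∀ {x y} → x ≡ y → x ≋ y
  ≋-reflexive {x} refl = congruent (divides 0ℤ (+-inverseʳ x))

  ≋-sym : ∀ {x y} → x ≋ y → y ≋ x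
  ≋-sym {x} {y} (congruent e) = congruent (subst p∣_ (lem x y) (∣m⇒∣-m e))
    where
    lem : ∀ x y → - (x - y) ≡ y - x
    lem = solve-∀

  ≋-trans : ∀ {x y z} → x ≋ y → y ≋ z → x ≋ z
  ≋-trans {x} {y} {z} (congruent e) (congruent f) = congruent (subst p∣_ (lem x y z) (∣m∣n⇒∣m+n e f))
    where
    lem : ∀ x y z → (x - y) + (y - z) ≡ x - z
    lem = solve-∀

  ≋-* : ∀ {x y u v} → x ≋ y → u ≋ v → x * u ≋ y * v
  ≋-* {x} {y} {u} {v} (congruent e) (congruent f) =
    congruent (subst p∣_ (lem x y u v) (∣m∣n⇒∣m+n (∣m⇒∣m*n u e) (∣n⇒∣m*n y f)))
    where
    lem : ∀ x y u v → (x - y) * u + y * (u - v) ≡ x * u - y * v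
    lem = solve-∀

  ≋-^ : ∀ {x y} n → x ≋ y → x ^ n ≋ y ^ n
  ≋-^ zero    e = ≋-reflexive refl
  ≋-^ (suc n) e = ≋-* e (≋-^ n e)

  ≋-cancel : ∀ z {x y} → ¬ p∣ z → z * x ≋ z * y → x ≋ y
  ≋-cancel z {x} {y} p∤z (congruent e) with euclid z (x - y) (subst p∣_ (lem z x y) e)
    where
    lem : ∀ z x y → z * x - z * y ≡ z * (x - y)
    lem = solve-∀
  ... | inj₁ p∣z = contradiction p∣z p∤z
  ... | inj₂ p∣d = congruent p∣d

  Π-≋ : ∀ {f g : ℕ → ℤ} xs → (∀ i → i ∈ xs → f i ≋ g i) → ℤ*.Π f xs ≋ ℤ*.Π g xs
  Π-≋ []       e = ≋-reflexive refl
  Π-≋ (x ∷ xs) e = ≋-* (e x (here refl)) (Π-≋ xs (λ i i∈ → e i (there i∈)))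

  p∤1 : ¬ p∣ 1ℤ
  p∤1 d = contradiction (small 1ℤ (ℕ.<-trans (ℕ.n<1+n 1) 2<p) d) λ ()

  Π-coprime : ∀ {f : ℕ → ℤ} xs → (∀ i → i ∈ xs → ¬ p∣ f i) → ¬ p∣ ℤ*.Π f xs
  Π-coprime []           c d = p∤1 d
  Π-coprime {f} (x ∷ xs) c d with euclid (f x) _ d
  ... | inj₁ p∣fx = c x (here refl) p∣fx
  ... | inj₂ p∣Π  = Π-coprime xs (λ i i∈ → c i (there i∈)) p∣Π

  %⇒≋ : ∀ {a b} → a % p ≡ b % p → + a ≋ + b
  %⇒≋ {a} {b} e = ≋-trans (rem a) (≋-trans (≋-reflexive (cong +_ e)) (≋-sym (rem b)))
    where
    rem : ∀ a → + a ≋ + (a % p)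
    rem a = congruent (divides (+ (a / p)) (trans (cong (λ x → x - + (a % p)) (trans (cong +_ (ℕ.m≡m%n+[m/n]*n a p))
        (trans (pos-+ (a % p) _) (cong (λ x → + (a % p) + x) (pos-* (a / p) p)))))
      (lem (+ (a % p)) _)))
      where
      lem : ∀ x y → x + y - x ≡ y
      lem = solve-∀

  rem-≋ : ∀ a → + a ≋ + (a % p)
  rem-≋ a = %⇒≋ (sym (ℕ.m%n%n≡m%n a p))

  close : ∀ {a b} → a < p → b < p → + a ≋ + b → a ≡ b
  close {a} {b} a<p b<p e = +-injective (i-j≡0⇒i≡j (+ a) (+ b) (small (+ a - + b) bound (difference e)))
    where
    bound : ∣ + a - + b ∣ < p
    bound = subst (ℕ._< p) (cong ∣_∣ (sym (m-n≡m⊖n a b)))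
      (ℕ.≤-<-trans (∣m⊝n∣≤m⊔n a b) (ℕ.⊔-lub a<p b<p))

  ≋⇒% : ∀ {a b} → + a ≋ + b → a % p ≡ b % p
  ≋⇒% {a} {b} e = close (ℕ.m%n<n a p) (ℕ.m%n<n b p) (≋-trans (≋-sym (rem-≋ a)) (≋-trans e (rem-≋ b)))

  -- A vector lists the lower coefficients of a monic polynomial.
  eval : ∀ {d} → Vec ℤ d → ℤ → ℤ
  eval []       x = 1ℤ
  eval (c ∷ cs) x = c + x * eval cs x

  raise : ∀ {d} → Vec ℤ (suc d) → ℤ → Vec ℤ d → Vec ℤ (suc d)
  raise (c ∷ [])      r []       = c + r ∷ []
  raise (c ∷ c′ ∷ cs) r (q ∷ qs) = c + r * q ∷ raise (c′ ∷ cs) r qs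

  eval-raise : ∀ {d} cs r (qs : Vec ℤ d) x → eval (raise cs r qs) x ≡ eval cs x + r * eval qs x
  eval-raise (c ∷ [])      r []       x = lem c r x
    where
    lem : ∀ c r x → c + r + x * 1ℤ ≡ c + x * 1ℤ + r * 1ℤ
    lem = solve-∀
  eval-raise (c ∷ c′ ∷ cs) r (q ∷ qs) x =
    trans (cong (λ z → c + r * q + x * z) (eval-raise (c′ ∷ cs) r qs x)) (lem c r q x _ _)
    where
    lem : ∀ c r q x a b → c + r * q + x * (a + r * b) ≡ c + x * a + r * (q + x * b)
    lem = solve-∀

  -- Synthetic division by `x − r`. If P = c + x Q, then (P(x) - P(r)) / (x - r) is Q(x) + r (Q(x) -
  -- Q(r)) / (x - r), and `raise` forms this sum while keeping the leading coefficient 1.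
  quotient : ∀ {d} → Vec ℤ (suc d) → ℤ → Vec ℤ d
  quotient {zero}  cs       r = []
  quotient {suc d} (c ∷ cs) r = raise cs r (quotient cs r)

  eval-quotient : ∀ {d} (cs : Vec ℤ (suc d)) r x → eval cs x - eval cs r ≡ (x - r) * eval (quotient cs r) x
  eval-quotient {zero} (c ∷ []) r x = lem c r x
    where
    lem : ∀ c r x → c + x * 1ℤ - (c + r * 1ℤ) ≡ (x - r) * 1ℤ
    lem = solve-∀
  eval-quotient {suc d} (c ∷ cs) r x = begin
    c + x * eval cs x - (c + r * eval cs r)
      ≡⟨ lem c x r (eval cs x) (eval cs r) ⟩
    (x - r) * eval cs x + r * (eval cs x - eval cs r)
      ≡⟨ cong (λ z → (x - r) * eval cs x + r * z) (eval-quotient cs r x) ⟩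
    (x - r) * eval cs x + r * ((x - r) * eval (quotient cs r) x)
      ≡⟨ lem′ x r (eval cs x) (eval (quotient cs r) x) ⟩
    (x - r) * (eval cs x + r * eval (quotient cs r) x)
      ≡⟨ cong ((x - r) *_) (eval-raise cs r (quotient cs r) x) ⟨
    (x - r) * eval (raise cs r (quotient cs r)) x ∎
    where
    open ≡-Reasoning
    lem : ∀ c x r a b → c + x * a - (c + r * b) ≡ (x - r) * a + r * (a - b)
    lem = solve-∀
    lem′ : ∀ x r a b → (x - r) * a + r * ((x - r) * b) ≡ (x - r) * (a + r * b)
    lem′ = solve-∀

  -- Division by `x − r` for one root `r` lowers the degree, and modulo a prime every root
  -- incongruent to `r` is a root of the quotient. At degree 0 a root would make `p` divide 1.
  lagrange : ∀ {d} (cs : Vec ℤ d) rs → length rs ≡ suc d → AllPairs (λ x y → ¬ x ≋ y) rs →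
    ¬ All (λ r → p∣ eval cs r) rs
  lagrange []       (r ∷ [])  len apart             (root ∷ _)     = p∤1 root
  lagrange (c ∷ cs) (r ∷ rs)  len (r-apart ∷ apart) (root ∷ roots) =
    lagrange (quotient (c ∷ cs) r) rs (ℕ.suc-injective len) apart
      (All.zipWith (λ { {x} (r≢x , rootₓ) → descend x r≢x rootₓ }) (r-apart , roots))
    where
    descend : ∀ x → ¬ r ≋ x → p∣ eval (c ∷ cs) x → p∣ eval (quotient (c ∷ cs) r) x
    descend x r≢x rootₓ with euclid (x - r) _ (subst p∣_ (eval-quotient (c ∷ cs) r x) (∣m∣n⇒∣m-n rootₓ root))
    ... | inj₁ x≋r = contradiction (≋-sym (congruent x≋r)) r≢x
    ... | inj₂ q   = q

  power-minus-one : ∀ n → Vec ℤ (suc n)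
  power-minus-one n = -1ℤ ∷ Vec.replicate n 0ℤ

  eval-power : ∀ n x → eval (power-minus-one n) x ≡ x ^ suc n - 1ℤ
  eval-power n x = trans (cong (λ z → -1ℤ + x * z) (pure n)) (+-comm -1ℤ (x ^ suc n))
    where
    pure : ∀ n → eval (Vec.replicate n 0ℤ) x ≡ x ^ n
    pure zero    = refl
    pure (suc n) = trans (+-identityˡ _) (cong (x *_) (pure n))

  -- The residue of least absolute value, as a sign and a number in 1, …, h.
  halve : ∀ r → Dec (r ≤ h) → ℤ × ℕ
  halve r (yes _) = 1ℤ , r
  halve r (no _)  = -1ℤ , p ∸ r

  halve-≋ : ∀ r d → r < p → + r ≋ proj₁ (halve r d) * + proj₂ (halve r d)
  halve-≋ r (yes _) r<p = ≋-reflexive (sym (*-identityˡ (+ r)))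
  halve-≋ r (no _)  r<p = congruent (divides 1ℤ (begin
    + r - -1ℤ * + (p ∸ r)  ≡⟨ lem (+ r) (+ (p ∸ r)) ⟩
    + r + + (p ∸ r)        ≡⟨ pos-+ r (p ∸ r) ⟨
    + (r ℕ.+ (p ∸ r))      ≡⟨ cong +_ (ℕ.m+[n∸m]≡n (ℕ.<⇒≤ r<p)) ⟩
    + p                    ≡⟨ *-identityˡ (+ p) ⟨
    1ℤ * + p ∎))
    where
    open ≡-Reasoning
    lem : ∀ x y → x - -1ℤ * y ≡ x + y
    lem = solve-∀

  halve-sign : ∀ r d → proj₁ (halve r d) ≡ 1ℤ ⊎ proj₁ (halve r d) ≡ -1ℤ
  halve-sign r (yes _) = inj₁ refl
  halve-sign r (no _)  = inj₂ refl

  halve-range : ∀ r d → 1 ≤ r → r < p → ∃[ k ] (k < h × proj₂ (halve r d) ≡ suc k)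
  halve-range (suc r) (yes r≤h) _ _   = r , r≤h , refl
  halve-range r       (no r≰h)  _ r<p with p ∸ r in eq
  ... | zero  = contradiction eq (ℕ.m>n⇒m∸n≢0 r<p)
  ... | suc k = k , ℕ.≤-trans (ℕ.≤-reflexive (sym eq))
                      (ℕ.≤-trans (ℕ.∸-monoʳ-≤ p (ℕ.≰⇒> r≰h)) (ℕ.≤-reflexive (ℕ.m+n∸m≡n h h))) , refl

  -- As `p` is odd, `r` and `p ∸ r` have opposite parities, so the sign chosen by `halve` also
  -- records the change of parity.
  halve-parity : ∀ r d → r < p → σ r ≡ proj₁ (halve r d) * σ (proj₂ (halve r d))
  halve-parity r (yes _) r<p = sym (*-identityˡ (σ r))
  halve-parity r (no _)  r<p = begin
    σ r                        ≡⟨ σ-cancel (p ∸ r) (sym total) ⟩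
    σ (p ∸ r) * -1ℤ            ≡⟨ *-comm (σ (p ∸ r)) -1ℤ ⟩
    -1ℤ * σ (p ∸ r) ∎
    where
    open ≡-Reasoning
    total : σ (p ∸ r) * σ r ≡ -1ℤ
    total = trans (sym (σ-+ (p ∸ r) r)) (trans (cong σ (ℕ.m∸n+n≡m (ℕ.<⇒≤ r<p))) (cong -_ (σ-double h)))

  Sign : ℤ → Set
  Sign u = u ≡ 1ℤ ⊎ u ≡ -1ℤ

  Sign-* : ∀ {u v} → Sign u → Sign v → Sign (u * v)
  Sign-* (inj₁ refl) (inj₁ refl) = inj₁ refl
  Sign-* (inj₁ refl) (inj₂ refl) = inj₂ refl
  Sign-* (inj₂ refl) (inj₁ refl) = inj₂ refl
  Sign-* (inj₂ refl) (inj₂ refl) = inj₁ refl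

  Sign-square : ∀ {u} → Sign u → u * u ≡ 1ℤ
  Sign-square (inj₁ refl) = refl
  Sign-square (inj₂ refl) = refl

  Sign-Π : ∀ {f : ℕ → ℤ} xs → (∀ i → Sign (f i)) → Sign (ℤ*.Π f xs)
  Sign-Π []       e = inj₁ refl
  Sign-Π (x ∷ xs) e = Sign-* (e x) (Sign-Π xs e)

  module Gauss (a : ℕ) (p∤a : ¬ p∣ + a) where

    residue : ℕ → ℕ
    residue i = (a ℕ.* suc i) % p

    sign : ℕ → ℤ
    sign i = proj₁ (halve (residue i) (residue i ℕ.≤? h))

    π : ℕ → ℕ
    π i = proj₂ (halve (residue i) (residue i ℕ.≤? h))

    residue<p : ∀ i → residue i < p
    residue<p i = ℕ.m%n<n (a ℕ.* suc i) p

    multiple : ∀ i → + a * + suc i ≋ sign i * + π i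
    multiple i = ≋-trans (≋-reflexive (sym (pos-* a (suc i)))) (≋-trans (rem-≋ (a ℕ.* suc i))
      (halve-≋ (residue i) (residue i ℕ.≤? h) (residue<p i)))

    sign-sign : ∀ i → Sign (sign i)
    sign-sign i = halve-sign (residue i) (residue i ℕ.≤? h)

    p∤suc : ∀ {i} → i < h → ¬ p∣ + suc i
    p∤suc i<h d = contradiction (small _ (ℕ.≤-<-trans i<h h<p) d) λ ()

    residue≥1 : ∀ {i} → i < h → 1 ≤ residue i
    residue≥1 {i} i<h with residue i in eq
    ... | suc _ = s≤s z≤n
    ... | zero  with euclid (+ a) (+ suc i) (subst p∣_ (pos-* a (suc i)) (∣ᵤ⇒∣ (ℕ.m%n≡0⇒n∣m (a ℕ.* suc i) p eq)))
    ...   | inj₁ p∣a = contradiction p∣a p∤a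
    ...   | inj₂ p∣i = contradiction p∣i (p∤suc i<h)

    π-range : ∀ {i} → i < h → ∃[ k ] (k < h × π i ≡ suc k)
    π-range {i} i<h = halve-range (residue i) (residue i ℕ.≤? h) (residue≥1 i<h) (residue<p i)

    -- Equal absolute residues mean that a (i + 1) and a (j + 1) agree up to sign. Equal signs give
    -- i = j; opposite signs make `p` divide (i + 1) + (j + 1), which is positive and at most 2h <
    -- p.
    π-injective : ∀ {i j} → i < j → j < h → π i ≢ π j
    π-injective {i} {j} i<j j<h eq = clash (sign-sign i) (sign-sign j)
      where
      i<h = ℕ.<-trans i<j j<h
      same : + a * + suc i ≋ + a * + suc j → i ≡ j
      same e = ℕ.suc-injective (close (ℕ.≤-<-trans i<h h<p) (ℕ.≤-<-trans j<h h<p) (≋-cancel (+ a) p∤a e))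
      opposite : + a * + suc i ≋ -1ℤ * (+ a * + suc j) → + suc i + + suc j ≡ 0ℤ
      opposite (congruent d) with euclid (+ a) (+ suc i + + suc j) (subst p∣_ (lem (+ a) (+ suc i) (+ suc j)) d)
        where
        lem : ∀ a x y → a * x - -1ℤ * (a * y) ≡ a * (x + y)
        lem = solve-∀
      ... | inj₁ p∣a = contradiction p∣a p∤a
      ... | inj₂ p∣s = small _ (s≤s (ℕ.+-mono-≤ i<h j<h)) p∣s
      u = + π i
      mi : ∀ {s} → sign i ≡ s → + a * + suc i ≋ s * u
      mi refl = multiple i
      mj : ∀ {s} → sign j ≡ s → + a * + suc j ≋ s * u
      mj refl = subst (λ k → + a * + suc j ≋ sign j * + k) (sym eq) (multiple j)
      negate : ∀ x → x ≡ -1ℤ * (-1ℤ * x)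
      negate = solve-∀
      clash : Sign (sign i) → Sign (sign j) → ⊥
      clash (inj₁ e) (inj₁ f) = ℕ.<-irrefl (same (≋-trans (mi e) (≋-sym (mj f)))) i<j
      clash (inj₂ e) (inj₂ f) = ℕ.<-irrefl (same (≋-trans (mi e) (≋-sym (mj f)))) i<j
      clash (inj₁ e) (inj₂ f) = contradiction (opposite (≋-trans (mi e)
        (≋-trans (≋-reflexive (trans (*-identityˡ u) (negate u))) (≋-* (≋-reflexive {x = -1ℤ} refl) (≋-sym (mj f)))))) λ ()
      clash (inj₂ e) (inj₁ f) = contradiction (opposite (≋-trans (mi e)
        (≋-* (≋-reflexive {x = -1ℤ} refl) (≋-trans (≋-reflexive (sym (*-identityˡ u))) (≋-sym (mj f)))))) λ ()

    π-permutes : applyUpTo π h ↭ applyUpTo suc h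
    π-permutes = subset-↭ (Unique.applyUpTo⁺₁ π h π-injective) inside
      (trans (List.length-applyUpTo π h) (sym (List.length-applyUpTo suc h)))
      where
      inside : ∀ {x} → x ∈ applyUpTo π h → x ∈ applyUpTo suc h
      inside x∈ with ∈-applyUpTo⁻ π x∈
      ... | i , i<h , refl with π-range i<h
      ...   | k , k<h , eq = subst (_∈ applyUpTo suc h) (sym eq) (∈-applyUpTo⁺ suc k<h)

    Π-π : ∀ (f : ℕ → ℤ) → ℤ*.Π (f ∘ π) (upTo h) ≡ ℤ*.Π (f ∘ suc) (upTo h)
    Π-π f = trans (sym (Π-applyUpTo f π h)) (trans (Π-↭ f π-permutes) (Π-applyUpTo f suc h))

    signs : ℤ
    signs = ℤ*.Π sign (upTo h)

    gauss : (+ a) ^ h ≋ signs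
    gauss = ≋-cancel Z (Π-coprime (upTo h) (λ i i∈ → p∤suc (∈-upTo⁻ i∈)))
      (≋-trans (≋-reflexive left) (≋-trans (Π-≋ (upTo h) (λ i _ → multiple i)) (≋-reflexive right)))
      where
      Z = ℤ*.Π (λ i → + suc i) (upTo h)
      left : Z * (+ a) ^ h ≡ ℤ*.Π (λ i → + a * + suc i) (upTo h)
      left = trans (*-comm Z _) (sym (trans (ℤ*.Π-∙ (λ _ → + a) (λ i → + suc i) (upTo h)) (cong (_* Z) (Π-const (+ a) h))))
      right : ℤ*.Π (λ i → sign i * + π i) (upTo h) ≡ Z * signs
      right = trans (ℤ*.Π-∙ sign (λ i → + π i) (upTo h)) (trans (cong (signs *_) (Π-π (λ k → + k))) (*-comm signs Z))

    -- Comparing a k = t p + r with k modulo 2: both a and p are odd, and r has the parity of π k exactly when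
    -- its sign is +1.
    eisenstein : ∀ x → a ≡ suc (x ℕ.+ x) → signs ≡ ℤ*.Π (λ i → σ ((a ℕ.* suc i) / p)) (upTo h)
    eisenstein x odd = begin
      signs                  ≡⟨ *-identityʳ signs ⟨
      signs * 1ℤ             ≡⟨ cong (signs *_) (Π-square {λ i → σ (floor i)} (upTo h) (λ i → σ² (floor i))) ⟨
      signs * (t * t)        ≡⟨ *-identityˡ _ ⟨
      1ℤ * (signs * (t * t)) ≡⟨ cong (_* (signs * (t * t))) (Π-square {λ i → σ (suc i)} (upTo h) (λ i → σ² (suc i))) ⟨
      z * z * (signs * (t * t)) ≡⟨ lem z signs t ⟩
      signs * z * t * z * t  ≡⟨ cong (λ y → y * z * t) totals ⟨
      z * z * t              ≡⟨ cong (_* t) (Π-square {λ i → σ (suc i)} (upTo h) (λ i → σ² (suc i))) ⟩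
      1ℤ * t                 ≡⟨ *-identityˡ t ⟩
      t ∎
      where
      open ≡-Reasoning
      floor : ℕ → ℕ
      floor i = (a ℕ.* suc i) / p
      t = ℤ*.Π (λ i → σ (floor i)) (upTo h)
      z = ℤ*.Π (λ i → σ (suc i)) (upTo h)
      lem : ∀ z s t → z * z * (s * (t * t)) ≡ s * z * t * z * t
      lem = solve-∀
      each : ∀ i → σ (suc i) ≡ sign i * σ (π i) * σ (floor i)
      each i = begin
        σ (suc i)                            ≡⟨ σ-odd x (suc i) ⟨
        σ (suc (x ℕ.+ x) ℕ.* suc i)          ≡⟨ cong (λ a → σ (a ℕ.* suc i)) odd ⟨
        σ (a ℕ.* suc i)                      ≡⟨ cong σ (ℕ.m≡m%n+[m/n]*n (a ℕ.* suc i) p) ⟩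
        σ (residue i ℕ.+ floor i ℕ.* p)      ≡⟨ σ-+ (residue i) (floor i ℕ.* p) ⟩
        σ (residue i) * σ (floor i ℕ.* p)    ≡⟨ cong₂ _*_ (halve-parity (residue i) (residue i ℕ.≤? h) (residue<p i))
                                                  (trans (cong σ (ℕ.*-comm (floor i) p)) (σ-odd h (floor i))) ⟩
        sign i * σ (π i) * σ (floor i) ∎
      totals : z ≡ signs * z * t
      totals = begin
        z ≡⟨ ℤ*.Π-cong (upTo h) (λ i _ → each i) ⟩
        ℤ*.Π (λ i → sign i * σ (π i) * σ (floor i)) (upTo h) ≡⟨ ℤ*.Π-∙ (λ i → sign i * σ (π i)) (λ i → σ (floor i)) (upTo h) ⟩
        ℤ*.Π (λ i → sign i * σ (π i)) (upTo h) * t           ≡⟨ cong (_* t) (ℤ*.Π-∙ sign (λ i → σ (π i)) (upTo h)) ⟩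
        signs * ℤ*.Π (λ i → σ (π i)) (upTo h) * t            ≡⟨ cong (λ y → signs * y * t) (Π-π σ) ⟩
        signs * z * t ∎

-- Quadratic reciprocity for the Legendre symbol

any-true : ∀ {A : Set} (f : A → Bool) xs → any f xs ≡ true → ∃[ x ] (x ∈ xs × f x ≡ true)
any-true f (x ∷ xs) eq with f x in fx
... | true  = x , here refl , fx
... | false with y , y∈ , fy ← any-true f xs eq = y , there y∈ , fy

any-false : ∀ {A : Set} (f : A → Bool) xs → any f xs ≡ false → ∀ {x} → x ∈ xs → f x ≡ false
any-false f (x ∷ xs) eq x∈ with f x in fx
any-false f (x ∷ xs) eq (here refl) | false = fx
any-false f (x ∷ xs) eq (there x∈)  | false = any-false f xs eq x∈

does-true : ∀ {A : Set} (d : Dec A) → ⌊ d ⌋ ≡ true → A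
does-true (yes a) _ = a

does-false : ∀ {A : Set} (d : Dec A) → ⌊ d ⌋ ≡ false → ¬ A
does-false (no ¬a) _ = ¬a

0^ : ∀ {n} → 1 ≤ n → 0ℤ ^ n ≡ 0ℤ
0^ (s≤s _) = refl

1^ : ∀ n → 1ℤ ^ n ≡ 1ℤ
1^ zero    = refl
1^ (suc n) = trans (*-identityˡ _) (1^ n)

legendre-zero : ∀ a q → a % suc q ≡ 0 → legendre a (suc q) ≡ 0ℤ
legendre-zero a q e with a % suc q ℕ.≟ 0
... | yes _ = refl
... | no ne = contradiction e ne

legendre-period : ∀ {a b} q → a % suc q ≡ b % suc q → legendre a (suc q) ≡ legendre b (suc q)
legendre-period {a} {b} q e with a % suc q ℕ.≟ 0 | b % suc q ℕ.≟ 0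
... | yes _ | yes _  = refl
... | yes z | no nz  = contradiction (trans (sym e) z) nz
... | no nz | yes z  = contradiction (trans e z) nz
... | no _  | no _   = cong (λ r → if any (λ x → ⌊ (x ℕ.* x) % suc q ℕ.≟ r ⌋) (upTo (suc q)) then + 1 else -[1+ 0 ]) e

module LegendreSymbol (h : ℕ) (p-prime : Prime (suc (h ℕ.+ h))) where
  open OddPrime h p-prime

  data Spec (a : ℕ) : ℤ → Set where
    divisible  : p∣ + a → Spec a 0ℤ
    residue    : ¬ p∣ + a → ∀ x → + x * + x ≋ + a → Spec a 1ℤ
    nonresidue : ¬ p∣ + a → (∀ x → ¬ + x * + x ≋ + a) → Spec a -1ℤ

  legendre-spec : ∀ a → Spec a (legendre a p)
  legendre-spec a with a % p ℕ.≟ 0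
  ... | yes e = divisible (∣ᵤ⇒∣ (ℕ.m%n≡0⇒n∣m a p e))
  ... | no ne with any (λ x → ⌊ (x ℕ.* x) % p ℕ.≟ a % p ⌋) (upTo p) in eq
  ...   | true with x , x∈ , ex ← any-true (λ x → ⌊ (x ℕ.* x) % p ℕ.≟ a % p ⌋) (upTo p) eq =
          residue coprime x (≋-trans (≋-reflexive (sym (pos-* x x))) (%⇒≋ (does-true ((x ℕ.* x) % p ℕ.≟ a % p) ex)))
    where
    coprime : ¬ p∣ + a
    coprime d = ne (ℕ.n∣m⇒m%n≡0 a p (∣⇒∣ᵤ d))
  ...   | false = nonresidue coprime none
    where
    coprime : ¬ p∣ + a
    coprime d = ne (ℕ.n∣m⇒m%n≡0 a p (∣⇒∣ᵤ d))
    none : ∀ x → ¬ + x * + x ≋ + a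
    none x e = does-false _ (any-false (λ x → ⌊ (x ℕ.* x) % p ℕ.≟ a % p ⌋) (upTo p) eq (∈-upTo⁺ (ℕ.m%n<n x p)))
      (≋⇒% (≋-trans (≋-reflexive (pos-* (x % p) (x % p)))
        (≋-trans (≋-* (≋-sym (rem-≋ x)) (≋-sym (rem-≋ x))) e)))

  Unit : ℤ → Set
  Unit u = ∣ u ∣ ≤ 1

  Unit-* : ∀ {u v} → Unit u → Unit v → Unit (u * v)
  Unit-* {u} {v} p q = ℕ.≤-trans (ℕ.≤-reflexive (abs-* u v)) (ℕ.*-mono-≤ p q)

  Sign-Unit : ∀ {u} → Sign u → Unit u
  Sign-Unit (inj₁ refl) = ℕ.≤-refl
  Sign-Unit (inj₂ refl) = ℕ.≤-refl

  Spec-Unit : ∀ {a u} → Spec a u → Unit u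
  Spec-Unit (divisible _)    = z≤n
  Spec-Unit (residue _ _ _)  = ℕ.≤-refl
  Spec-Unit (nonresidue _ _) = ℕ.≤-refl

  -- The difference is at most 2 in absolute value, hence below `p`. This turns congruences between
  -- symbols into equalities.
  Unit-unique : ∀ {u v} → Unit u → Unit v → u ≋ v → u ≡ v
  Unit-unique {u} {v} p q (congruent d) =
    i-j≡0⇒i≡j u v (small (u - v) (ℕ.≤-<-trans (ℕ.≤-trans (∣i-j∣≤∣i∣+∣j∣ u v) (ℕ.+-mono-≤ p q)) 2<p) d)

  coprime-root : ∀ {a} → ¬ p∣ + a → ∀ x → + x * + x ≋ + a → ¬ p∣ + x
  coprime-root {a} p∤a x e d = p∤a (subst p∣_ (lem (+ x * + x) (+ a)) (∣m∣n⇒∣m-n (∣m⇒∣m*n (+ x) d) (_≋_.difference e)))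
    where
    lem : ∀ x a → x - (x - a) ≡ a
    lem = solve-∀

  -- Fermat's little theorem comes out of Gauss's lemma: x ^ h is congruent to a product of signs,
  -- whose square is 1.
  square-power : ∀ x → ¬ p∣ + x → (+ x * + x) ^ h ≋ 1ℤ
  square-power x p∤x = ≋-trans (≋-reflexive (*-^ (+ x) (+ x) h)) (≋-trans (≋-* G.gauss G.gauss)
    (≋-reflexive (Sign-square (Sign-Π (upTo h) G.sign-sign))))
    where module G = Gauss x p∤x

  signs-Sign : ∀ a (p∤a : ¬ p∣ + a) → Sign (Gauss.signs a p∤a)
  signs-Sign a p∤a = Sign-Π (upTo h) (Gauss.sign-sign a p∤a)

  monic-power : ∀ n → 1 ≤ n → ∃[ cs ] (∀ x → eval {n} cs x ≡ x ^ n - 1ℤ)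
  monic-power (suc n) _ = power-minus-one n , eval-power n

  -- The squares of 1, ..., h are already h incongruent roots of x ^ h - 1. A nonresidue with the
  -- same property would be one root too many for Lagrange's bound.
  nonresidue-power : ∀ a → (∀ x → ¬ + x * + x ≋ + a) → ¬ (+ a) ^ h ≋ 1ℤ
  nonresidue-power a none e with cs , eval-cs ← monic-power h h≥1 =
    lagrange cs (+ a ∷ applyUpTo square h) (cong suc (List.length-applyUpTo square h))
      (All.applyUpTo⁺₁ square h (λ {i} _ e → none (suc i) (≋-sym e)) ∷ AllPairs.applyUpTo⁺₁ square h apart)
      (root (+ a) e ∷ All.applyUpTo⁺₁ square h (λ {i} i<h → root (square i) (square-power (suc i) (p∤suc i<h))))
    where
    square : ℕ → ℤ
    square i = + suc i * + suc i
    p∤suc : ∀ {i} → i < h → ¬ p∣ + suc i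
    p∤suc i<h d = contradiction (small _ (ℕ.≤-<-trans i<h h<p) d) λ ()
    root : ∀ x → x ^ h ≋ 1ℤ → p∣ eval cs x
    root x (congruent d) = subst p∣_ (sym (eval-cs x)) d
    apart : ∀ {i j} → i < j → j < h → ¬ square i ≋ square j
    apart {i} {j} i<j j<h (congruent d)
      with euclid (+ suc i - + suc j) (+ suc i + + suc j) (subst p∣_ (lem (+ suc i) (+ suc j)) d)
      where
      lem : ∀ x y → x * x - y * y ≡ (x - y) * (x + y)
      lem = solve-∀
    ... | inj₁ p∣- = ℕ.<-irrefl (ℕ.suc-injective (close (ℕ.≤-<-trans (ℕ.<-trans i<j j<h) h<p) (ℕ.≤-<-trans j<h h<p) (congruent p∣-))) i<j
    ... | inj₂ p∣+ = contradiction (small _ (s≤s (ℕ.+-mono-≤ (ℕ.<-trans i<j j<h) j<h)) p∣+) λ ()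

  legendre-signs : ∀ a (p∤a : ¬ p∣ + a) → legendre a p ≡ Gauss.signs a p∤a
  legendre-signs a p∤a = by (legendre-spec a)
    where
    module G = Gauss a p∤a
    by : ∀ {u} → Spec a u → u ≡ G.signs
    by (divisible p∣a)    = contradiction p∣a p∤a
    by (residue _ x e)    = Unit-unique ℕ.≤-refl (Sign-Unit (signs-Sign a p∤a))
      (≋-trans (≋-sym (square-power x (coprime-root p∤a x e))) (≋-trans (≋-^ h e) G.gauss))
    by (nonresidue _ none) with signs-Sign a p∤a
    ... | inj₁ e = contradiction (subst ((+ a) ^ h ≋_) e G.gauss) (nonresidue-power a none)
    ... | inj₂ e = sym e

  euler : ∀ a → (+ a) ^ h ≋ legendre a p
  euler a = by (legendre-spec a) refl
    where
    coprime : ∀ {u} (p∤a : ¬ p∣ + a) → u ≡ legendre a p → (+ a) ^ h ≋ u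
    coprime p∤a e = subst ((+ a) ^ h ≋_) (sym (trans e (legendre-signs a p∤a))) (Gauss.gauss a p∤a)
    by : ∀ {u} → Spec a u → u ≡ legendre a p → (+ a) ^ h ≋ u
    by (divisible p∣a)      e = ≋-trans (≋-^ h (congruent (subst p∣_ (sym (+-identityʳ (+ a))) p∣a))) (≋-reflexive (0^ h≥1))
    by (residue p∤a _ _)    e = coprime p∤a e
    by (nonresidue p∤a _)   e = coprime p∤a e

  legendre-Unit : ∀ a → Unit (legendre a p)
  legendre-Unit a = Spec-Unit (legendre-spec a)

  legendre-* : ∀ a b → legendre (a ℕ.* b) p ≡ legendre a p * legendre b p
  legendre-* a b = Unit-unique (legendre-Unit (a ℕ.* b)) (Unit-* {legendre a p} {legendre b p} (legendre-Unit a) (legendre-Unit b))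
    (≋-trans (≋-sym (euler (a ℕ.* b))) (≋-trans (≋-reflexive (trans (cong (_^ h) (pos-* a b)) (*-^ (+ a) (+ b) h)))
      (≋-* (euler a) (euler b))))

  legendre-1 : legendre 1 p ≡ 1ℤ
  legendre-1 = Unit-unique (legendre-Unit 1) ℕ.≤-refl (≋-trans (≋-sym (euler 1)) (≋-reflexive (1^ h)))

  legendre-floor : ∀ x → ¬ p∣ + suc (x ℕ.+ x) →
    legendre (suc (x ℕ.+ x)) p ≡ ℤ*.Π (λ i → σ ((suc (x ℕ.+ x) ℕ.* suc i) / p)) (upTo h)
  legendre-floor x p∤a = trans (legendre-signs _ p∤a) (Gauss.eisenstein _ p∤a x refl)

-- Eisenstein's lattice points

below : Bool → ℤ
below true  = -1ℤ
below false = 1ℤ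

count-below : ∀ {t n} → t ≤ n → ℤ*.Π (λ j → below (j ℕ.<ᵇ t)) (upTo n) ≡ σ t
count-below {zero}  {n} _   = trans (Π-const 1ℤ n) (1^ n)
count-below {suc t} {suc n} (s≤s t≤n) =
  trans (cong (-1ℤ *_) (trans (Π-applyUpTo (λ j → below (j ℕ.<ᵇ suc t)) suc n) (count-below t≤n))) (-1*i≡-i (σ t))

<ᵇ-true : ∀ {m n} → m < n → (m ℕ.<ᵇ n) ≡ true
<ᵇ-true {m} {n} lt = dec-true (m ℕ.<? n) lt

<ᵇ-false : ∀ {m n} → ¬ m < n → (m ℕ.<ᵇ n) ≡ false
<ᵇ-false {m} {n} lt = dec-false (m ℕ.<? n) lt

<ᵇ-cong : ∀ {m n k l} → (m < n → k < l) → (k < l → m < n) → (m ℕ.<ᵇ n) ≡ (k ℕ.<ᵇ l)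
<ᵇ-cong {m} {n} {k} {l} f g with k ℕ.<? l
... | yes lt = trans (<ᵇ-true (g lt)) (sym (<ᵇ-true lt))
... | no ¬lt = trans (<ᵇ-false (¬lt ∘ f)) (sym (<ᵇ-false ¬lt))

floor-sign : ∀ p N n .{{_ : NonZero p}} → ¬ p ℕ.∣ N → N / p ≤ n →
  σ (N / p) ≡ ℤ*.Π (λ j → below (p ℕ.* suc j ℕ.<ᵇ N)) (upTo n)
floor-sign p N n p∤N le = trans (sym (count-below le)) (ℤ*.Π-cong (upTo n) (λ j _ → cong below (<ᵇ-cong (to j) (from j))))
  where
  to : ∀ j → j < N / p → p ℕ.* suc j < N
  to j lt = ℕ.≤∧≢⇒< (ℕ.≤-trans (ℕ.*-monoʳ-≤ p lt) (ℕ.≤-trans (ℕ.≤-reflexive (ℕ.*-comm p (N / p))) (ℕ.m/n*n≤m N p)))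
    (λ e → p∤N (ℕ.divides (suc j) (trans (sym e) (ℕ.*-comm p (suc j)))))
  from : ∀ j → p ℕ.* suc j < N → j < N / p
  from j lt = ℕ.≤-trans (ℕ.≤-reflexive (sym (ℕ.m*n/n≡m (suc j) p))) (ℕ./-monoˡ-≤ p (ℕ.≤-trans (ℕ.≤-reflexive (ℕ.*-comm (suc j) p)) (ℕ.<⇒≤ lt)))

Π-exchange : ∀ (f : ℕ → ℕ → ℤ) xs ys → ℤ*.Π (λ x → ℤ*.Π (f x) ys) xs ≡ ℤ*.Π (λ y → ℤ*.Π (λ x → f x y) xs) ys
Π-exchange f []       ys = sym (ℤ*.Π-ε ys)
Π-exchange f (x ∷ xs) ys = trans (cong (ℤ*.Π (f x) ys *_) (Π-exchange f xs ys))
  (sym (ℤ*.Π-∙ (f x) (λ y → ℤ*.Π (λ x → f x y) xs) ys))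

σ-power : ∀ m n → σ m ^ n ≡ σ (n ℕ.* m)
σ-power m zero    = refl
σ-power m (suc n) = trans (cong (σ m *_) (σ-power m n)) (sym (σ-+ m (n ℕ.* m)))

distinct-primes : ∀ {p q} → Prime p → Prime q → p ≢ q → ¬ p ℕ.∣ q
distinct-primes pp qp p≢q p∣q with prime⇒irreducible qp p∣q
... | inj₁ refl = ¬prime[1] pp
... | inj₂ e    = p≢q e

floor-bound : ∀ h k {i} → i < h → (suc (k ℕ.+ k) ℕ.* suc i) / suc (h ℕ.+ h) ≤ k
floor-bound h k {i} i<h = ℕ.≤-pred (ℕ.m<n*o⇒m/o<n {n = suc k} {o = suc (h ℕ.+ h)}
  (ℕ.≤-<-trans (ℕ.*-monoʳ-≤ (suc (k ℕ.+ k)) i<h) (s≤s bound)))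
  where
  open ℕ.≤-Reasoning
  bound : suc (k ℕ.+ k) ℕ.* h ≤ (h ℕ.+ h) ℕ.+ k ℕ.* suc (h ℕ.+ h)
  bound = begin
    h ℕ.+ (k ℕ.+ k) ℕ.* h                  ≡⟨ cong (h ℕ.+_) (trans (ℕ.*-distribʳ-+ h k k) (sym (ℕ.*-distribˡ-+ k h h))) ⟩
    h ℕ.+ k ℕ.* (h ℕ.+ h)                  ≤⟨ ℕ.+-mono-≤ (ℕ.m≤m+n h h) (ℕ.*-monoʳ-≤ k (ℕ.n≤1+n (h ℕ.+ h))) ⟩
    (h ℕ.+ h) ℕ.+ k ℕ.* suc (h ℕ.+ h) ∎

double-injective : ∀ h k → h ℕ.+ h ≡ k ℕ.+ k → h ≡ k
double-injective h k e = ℕ.*-cancelˡ-≡ h k 2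
  (trans (cong (h ℕ.+_) (ℕ.+-identityʳ h)) (trans e (sym (cong (k ℕ.+_) (ℕ.+-identityʳ k)))))

odd-primes-coprime : ∀ h k → Prime (suc (h ℕ.+ h)) → Prime (suc (k ℕ.+ k)) → h ≢ k → ¬ suc (h ℕ.+ h) ℕ.∣ suc (k ℕ.+ k)
odd-primes-coprime h k p-prime q-prime h≢k =
  distinct-primes p-prime q-prime (λ e → h≢k (double-injective h k (ℕ.suc-injective e)))

off-lattice : ∀ h k → Prime (suc (h ℕ.+ h)) → Prime (suc (k ℕ.+ k)) → h ≢ k →
  ∀ {i} → i < h → ¬ suc (h ℕ.+ h) ℕ.∣ suc (k ℕ.+ k) ℕ.* suc i
off-lattice h k p-prime q-prime h≢k {i} i<h d with euclidsLemma (suc (k ℕ.+ k)) (suc i) p-prime d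
... | inj₁ p∣q = odd-primes-coprime h k p-prime q-prime h≢k p∣q
... | inj₂ p∣i = ℕ.>⇒∤ (s≤s (ℕ.≤-trans i<h (ℕ.m≤m+n h h))) p∣i

-- Eisenstein's count: ⌊q i / p⌋ is the number of j with p j < q i.
legendre-lattice : ∀ h k → Prime (suc (h ℕ.+ h)) → Prime (suc (k ℕ.+ k)) → h ≢ k →
  legendre (suc (k ℕ.+ k)) (suc (h ℕ.+ h))
    ≡ ℤ*.Π (λ i → ℤ*.Π (λ j → below (suc (h ℕ.+ h) ℕ.* suc j ℕ.<ᵇ suc (k ℕ.+ k) ℕ.* suc i)) (upTo k)) (upTo h)
legendre-lattice h k p-prime q-prime h≢k = trans
  (LegendreSymbol.legendre-floor h p-prime k (odd-primes-coprime h k p-prime q-prime h≢k ∘ ∣⇒∣ᵤ))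
  (ℤ*.Π-cong (upTo h) (λ i i∈ → floor-sign p (q ℕ.* suc i) k (off-lattice h k p-prime q-prime h≢k (∈-upTo⁻ i∈)) (floor-bound h k (∈-upTo⁻ i∈))))
  where
  p = suc (h ℕ.+ h)
  q = suc (k ℕ.+ k)

below-swap : ∀ {m n} → m ≢ n → below (m ℕ.<ᵇ n) * below (n ℕ.<ᵇ m) ≡ -1ℤ
below-swap {m} {n} m≢n with ℕ.<-cmp m n
... | tri< lt _ ngt = cong₂ (λ x y → below x * below y) (<ᵇ-true lt) (<ᵇ-false ngt)
... | tri≈ _ e _    = contradiction e m≢n
... | tri> nlt _ gt = cong₂ (λ x y → below x * below y) (<ᵇ-false nlt) (<ᵇ-true gt)

-- No lattice point of the h by k rectangle lies on the line p j = q i, so each point contributes -1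
-- to exactly one of the two symbols. For p = q both symbols are 0.
legendre-reciprocity : ∀ h k → Prime (suc (h ℕ.+ h)) → Prime (suc (k ℕ.+ k)) →
  legendre (suc (k ℕ.+ k)) (suc (h ℕ.+ h)) ≡ σ (h ℕ.* k) * legendre (suc (h ℕ.+ h)) (suc (k ℕ.+ k))
legendre-reciprocity h k p-prime q-prime with h ℕ.≟ k
... | yes refl = trans self (sym (trans (cong (σ (h ℕ.* h) *_) self) (*-zeroʳ (σ (h ℕ.* h)))))
  where
  self : legendre (suc (h ℕ.+ h)) (suc (h ℕ.+ h)) ≡ 0ℤ
  self = legendre-zero (suc (h ℕ.+ h)) (h ℕ.+ h) (ℕ.n%n≡0 (suc (h ℕ.+ h)))
... | no h≢k = begin
  L             ≡⟨ *-identityʳ L ⟨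
  L * 1ℤ        ≡⟨ cong (L *_) M² ⟨
  L * (M * M)   ≡⟨ *-assoc L M M ⟨
  L * M * M     ≡⟨ cong (_* M) joint ⟩
  σ (h ℕ.* k) * M ∎
  where
  open ≡-Reasoning
  p = suc (h ℕ.+ h)
  q = suc (k ℕ.+ k)
  L = legendre q p
  M = legendre p q
  lower upper : ℕ → ℕ → ℤ
  lower i j = below (p ℕ.* suc j ℕ.<ᵇ q ℕ.* suc i)
  upper i j = below (q ℕ.* suc i ℕ.<ᵇ p ℕ.* suc j)
  lattice : M ≡ ℤ*.Π (λ j → ℤ*.Π (λ i → upper i j) (upTo h)) (upTo k)
  lattice = legendre-lattice k h q-prime p-prime (h≢k ∘ sym)
  unit : ∀ b → below b * below b ≡ 1ℤ
  unit true  = refl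
  unit false = refl
  M² : M * M ≡ 1ℤ
  M² = trans (cong₂ _*_ lattice lattice) (Π-square {λ j → ℤ*.Π (λ i → upper i j) (upTo h)} (upTo k)
    (λ j → Π-square {λ i → upper i j} (upTo h) (λ i → unit (q ℕ.* suc i ℕ.<ᵇ p ℕ.* suc j))))
  apart : ∀ {i j} → i < h → p ℕ.* suc j ≢ q ℕ.* suc i
  apart {i} {j} i<h e = off-lattice h k p-prime q-prime h≢k i<h (ℕ.divides (suc j) (trans (sym e) (ℕ.*-comm p (suc j))))
  joint : L * M ≡ σ (h ℕ.* k)
  joint = begin
    L * M
      ≡⟨ cong₂ _*_ (legendre-lattice h k p-prime q-prime h≢k) (trans lattice (Π-exchange (λ j i → upper i j) (upTo k) (upTo h))) ⟩
    ℤ*.Π (λ i → ℤ*.Π (lower i) (upTo k)) (upTo h) * ℤ*.Π (λ i → ℤ*.Π (upper i) (upTo k)) (upTo h)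
      ≡⟨ ℤ*.Π-∙ (λ i → ℤ*.Π (lower i) (upTo k)) (λ i → ℤ*.Π (upper i) (upTo k)) (upTo h) ⟨
    ℤ*.Π (λ i → ℤ*.Π (lower i) (upTo k) * ℤ*.Π (upper i) (upTo k)) (upTo h)
      ≡⟨ ℤ*.Π-cong (upTo h) (λ i i∈ → trans (sym (ℤ*.Π-∙ (lower i) (upper i) (upTo k)))
           (trans (ℤ*.Π-cong {f = λ j → lower i j * upper i j} {g = λ _ → -1ℤ} (upTo k)
             (λ j _ → below-swap (apart {i} {j} (∈-upTo⁻ i∈)))) (Π-const -1ℤ k))) ⟩
    ℤ*.Π (λ _ → -1ℤ ^ k) (upTo h)
      ≡⟨ Π-const (-1ℤ ^ k) h ⟩
    (-1ℤ ^ k) ^ h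
      ≡⟨ cong (_^ h) (trans (σ-power 1 k) (cong σ (ℕ.*-identityʳ k))) ⟩
    σ k ^ h
      ≡⟨ σ-power k h ⟩
    σ (h ℕ.* k) ∎

-- The Jacobi symbol

Odd : ℕ → Set
Odd n = ∃[ x ] n ≡ suc (x ℕ.+ x)

parity : ∀ n → (∃[ x ] n ≡ x ℕ.+ x) ⊎ Odd n
parity zero    = inj₁ (0 , refl)
parity (suc n) with parity n
... | inj₁ (x , e) = inj₂ (x , cong suc e)
... | inj₂ (x , e) = inj₁ (suc x , cong suc (trans e (sym (ℕ.+-suc x x))))

σ-Odd : ∀ {n} → Odd n → σ n ≡ -1ℤ
σ-Odd (x , refl) = cong -_ (σ-double x)

Odd-divisor : ∀ {d n} → Odd n → d ℕ.∣ n → Odd d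
Odd-divisor {d} odd (ℕ.divides q refl) with parity d
... | inj₂ odd-d      = odd-d
... | inj₁ (x , refl) = contradiction (trans (sym (σ-Odd odd)) (trans (cong σ (ℕ.*-distribˡ-+ q x x)) (σ-double (q ℕ.* x)))) λ ()

IsOddPrime : ℕ → Set
IsOddPrime p = ∃[ k ] (p ≡ suc (k ℕ.+ k) × Prime p)

-- Roughness is the invariant of the search: no divisor from 2 to `d` exists, so the first divisor
-- found is prime. When the fuel runs out the bound forces `n ≡ suc d`, and the default `n ∸ 1`
-- stands for the prime `n` itself.
search-prime : ∀ f d n .{{_ : NonTrivial n}} → 1 ≤ d → suc d Rough n → n ≤ suc d ℕ.+ f →
  Prime (suc (smallestFactorPredFrom f d n)) × suc (smallestFactorPredFrom f d n) ℕ.∣ n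
search-prime zero d n 1≤d rough bound =
  found n (ℕ.≤-antisym (ℕ.≤-trans bound (ℕ.≤-reflexive (ℕ.+-identityʳ (suc d)))) (rough⇒≤ rough)) rough
  where
  found : ∀ n → n ≡ suc d → suc d Rough n → Prime (suc (n ∸ 1)) × suc (n ∸ 1) ℕ.∣ n
  found _ refl rough = rough∧∣⇒prime {{ℕ.n>1⇒nonTrivial (s≤s 1≤d)}} rough ℕ.∣-refl , ℕ.∣-refl
search-prime (suc f) d n 1≤d rough bound with n % suc d ℕ.≟ 0
... | yes e = rough∧∣⇒prime {{ℕ.n>1⇒nonTrivial (s≤s 1≤d)}} rough (ℕ.m%n≡0⇒n∣m n (suc d) e) , ℕ.m%n≡0⇒n∣m n (suc d) e
... | no ne = search-prime f (suc d) n (ℕ.m≤n⇒m≤1+n 1≤d)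
  (∤⇒rough-suc (ne ∘ ℕ.n∣m⇒m%n≡0 n (suc d)) rough) (ℕ.≤-trans bound (ℕ.≤-reflexive (ℕ.+-suc (suc d) f)))

spf-prime : ∀ k → Prime (spf (suc (suc k))) × spf (suc (suc k)) ℕ.∣ suc (suc k)
spf-prime k = search-prime (suc (suc k)) 1 (suc (suc k)) ℕ.≤-refl 2-rough (ℕ.m≤n+m (suc (suc k)) 2)

primes : ℕ → ℕ → List ℕ
primes zero    n             = []
primes (suc f) zero          = []
primes (suc f) (suc zero)    = []
primes (suc f) (suc (suc k)) = spf (suc (suc k)) ∷ primes f (suc (suc k) / spf (suc (suc k)))

jac : ℕ → List ℕ → ℤ
jac a = ℤ*.Π (legendre a)

jacobiAux-primes : ∀ f a n → jacobiAux f a n ≡ jac a (primes f n)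
jacobiAux-primes zero    a n             = refl
jacobiAux-primes (suc f) a zero          = refl
jacobiAux-primes (suc f) a (suc zero)    = refl
jacobiAux-primes (suc f) a (suc (suc k)) = cong (legendre a (spf (suc (suc k))) *_) (jacobiAux-primes f a _)

primes-product : ∀ f n → 1 ≤ n → n ≤ f → Odd n → product (primes f n) ≡ n × All IsOddPrime (primes f n)
primes-product (suc f) (suc zero)    _ _         _   = refl , []
primes-product (suc f) (suc (suc k)) _ (s≤s k<f) odd =
  trans (cong (q ℕ.*_) (proj₁ rest)) (ℕ.m*[n/m]≡n q∣n) , (x , e , q-prime) ∷ proj₂ rest
  where
  n = suc (suc k)
  q = spf n
  q-prime = proj₁ (spf-prime k)
  q∣n = proj₂ (spf-prime k)
  x = proj₁ (Odd-divisor odd q∣n)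
  e = proj₂ (Odd-divisor odd q∣n)
  q>1 : 1 < q
  q>1 = ℕ.nonTrivial⇒n>1 q {{prime⇒nonTrivial q-prime}}
  rest = primes-product f (n / q) (ℕ.m≥n⇒m/n>0 (ℕ.∣⇒≤ q∣n))
    (ℕ.≤-pred (ℕ.≤-trans (ℕ.m/n<m n q {{_}} {{_}} q>1) (s≤s k<f)))
    (Odd-divisor odd (ℕ.divides q (sym (ℕ.m*[n/m]≡n q∣n))))

Ternary : ℤ → Set
Ternary u = u ≡ 0ℤ ⊎ u ≡ 1ℤ ⊎ u ≡ -1ℤ

Ternary-* : ∀ {u v} → Ternary u → Ternary v → Ternary (u * v)
Ternary-* (inj₁ refl)        _                  = inj₁ refl
Ternary-* (inj₂ (inj₁ refl)) (inj₁ refl)        = inj₁ refl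
Ternary-* (inj₂ (inj₁ refl)) (inj₂ (inj₁ refl)) = inj₂ (inj₁ refl)
Ternary-* (inj₂ (inj₁ refl)) (inj₂ (inj₂ refl)) = inj₂ (inj₂ refl)
Ternary-* (inj₂ (inj₂ refl)) (inj₁ refl)        = inj₁ refl
Ternary-* (inj₂ (inj₂ refl)) (inj₂ (inj₁ refl)) = inj₂ (inj₂ refl)
Ternary-* (inj₂ (inj₂ refl)) (inj₂ (inj₂ refl)) = inj₂ (inj₁ refl)

legendre-Ternary : ∀ a {p} → IsOddPrime p → Ternary (legendre a p)
legendre-Ternary a (k , refl , p-prime) = by (legendre-spec a)
  where
  open LegendreSymbol k p-prime
  by : ∀ {u} → Spec a u → Ternary u
  by (divisible _)    = inj₁ refl
  by (residue _ _ _)  = inj₂ (inj₁ refl)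
  by (nonresidue _ _) = inj₂ (inj₂ refl)

jac-Ternary : ∀ a {ps} → All IsOddPrime ps → Ternary (jac a ps)
jac-Ternary a []       = inj₂ (inj₁ refl)
jac-Ternary a (p ∷ ps) = Ternary-* (legendre-Ternary a p) (jac-Ternary a ps)

jac-* : ∀ a b {ps} → All IsOddPrime ps → jac (a ℕ.* b) ps ≡ jac a ps * jac b ps
jac-* a b [] = refl
jac-* a b {p ∷ ps} ((k , refl , p-prime) ∷ odd) =
  trans (cong₂ _*_ (LegendreSymbol.legendre-* k p-prime a b) (jac-* a b odd))
    (lem (legendre a p) (legendre b p) (jac a ps) (jac b ps))
  where
  lem : ∀ x y u v → (x * y) * (u * v) ≡ (x * u) * (y * v)
  lem = solve-∀

jac-1 : ∀ {ps} → All IsOddPrime ps → jac 1 ps ≡ 1ℤ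
jac-1 [] = refl
jac-1 ((k , refl , p-prime) ∷ odd) = cong₂ _*_ (LegendreSymbol.legendre-1 k p-prime) (jac-1 odd)

jac-period : ∀ {a b} n .{{_ : NonZero n}} {ps} → All IsOddPrime ps → All (ℕ._∣ n) ps → a % n ≡ b % n → jac a ps ≡ jac b ps
jac-period n [] [] e = refl
jac-period {a} {b} n ((k , refl , _) ∷ odd) (p∣n ∷ div) e = cong₂ _*_
  (legendre-period {a} {b} (k ℕ.+ k) (trans (sym (ℕ.m∣n⇒o%n%m≡o%m _ n a p∣n)) (trans (cong (_% suc (k ℕ.+ k)) e) (ℕ.m∣n⇒o%n%m≡o%m _ n b p∣n))))
  (jac-period n odd div e)

-- For odd arguments this is the reciprocity sign, -1 to the power (m - 1)(n - 1) / 4.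
θ : ℕ → ℕ → ℤ
θ m n = σ (⌊ m /2⌋ ℕ.* ⌊ n /2⌋)

half-odd : ∀ x → ⌊ suc (x ℕ.+ x) /2⌋ ≡ x
half-odd zero    = refl
half-odd (suc x) rewrite ℕ.+-suc x x = cong suc (half-odd x)

θ-comm : ∀ m n → θ m n ≡ θ n m
θ-comm m n = cong σ (ℕ.*-comm ⌊ m /2⌋ ⌊ n /2⌋)

odd-product : ∀ x y → let z = y ℕ.+ x ℕ.* suc (y ℕ.+ y) in suc (x ℕ.+ x) ℕ.* suc (y ℕ.+ y) ≡ suc (z ℕ.+ z)
odd-product = ℕ-Ring.solve-∀

Odd-* : ∀ {m n} → Odd m → Odd n → Odd (m ℕ.* n)
Odd-* (x , refl) (y , refl) = y ℕ.+ x ℕ.* suc (y ℕ.+ y) , odd-product x y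

Odd-product : ∀ {ps} → All IsOddPrime ps → Odd (product ps)
Odd-product []                    = 0 , refl
Odd-product ((k , e , _) ∷ odd) = Odd-* (k , e) (Odd-product odd)

-- For odd a and b, (ab - 1)/2 and (a - 1)/2 + (b - 1)/2 agree modulo 2. With this the reciprocity
-- law for primes extends to products factor by factor.
θ-* : ∀ {a b} c → Odd a → Odd b → θ (a ℕ.* b) c ≡ θ a c * θ b c
θ-* c (x , refl) (y , refl) = begin
  σ (⌊ suc (x ℕ.+ x) ℕ.* suc (y ℕ.+ y) /2⌋ ℕ.* c′)
    ≡⟨ cong (λ z → σ (z ℕ.* c′)) (trans (cong ⌊_/2⌋ (odd-product x y)) (half-odd (y ℕ.+ x ℕ.* suc (y ℕ.+ y)))) ⟩
  σ ((y ℕ.+ x ℕ.* suc (y ℕ.+ y)) ℕ.* c′)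
    ≡⟨ cong σ (lem x y c′) ⟩
  σ (suc (y ℕ.+ y) ℕ.* (x ℕ.* c′) ℕ.+ y ℕ.* c′)
    ≡⟨ σ-+ (suc (y ℕ.+ y) ℕ.* (x ℕ.* c′)) (y ℕ.* c′) ⟩
  σ (suc (y ℕ.+ y) ℕ.* (x ℕ.* c′)) * σ (y ℕ.* c′)
    ≡⟨ cong (_* σ (y ℕ.* c′)) (σ-odd y (x ℕ.* c′)) ⟩
  σ (x ℕ.* c′) * σ (y ℕ.* c′)
    ≡⟨ cong₂ (λ u v → σ (u ℕ.* c′) * σ (v ℕ.* c′)) (half-odd x) (half-odd y) ⟨
  σ (⌊ suc (x ℕ.+ x) /2⌋ ℕ.* c′) * σ (⌊ suc (y ℕ.+ y) /2⌋ ℕ.* c′) ∎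
  where
  open ≡-Reasoning
  c′ = ⌊ c /2⌋
  lem : ∀ x y c → (y ℕ.+ x ℕ.* suc (y ℕ.+ y)) ℕ.* c ≡ suc (y ℕ.+ y) ℕ.* (x ℕ.* c) ℕ.+ y ℕ.* c
  lem = ℕ-Ring.solve-∀

θ-odd : ∀ x y → θ (suc (x ℕ.+ x)) (suc (y ℕ.+ y)) ≡ σ (x ℕ.* y)
θ-odd x y = cong₂ (λ u v → σ (u ℕ.* v)) (half-odd x) (half-odd y)

shuffle : ∀ s l t j → (s * l) * (t * j) ≡ (s * t) * (l * j)
shuffle = solve-∀

legendre-jac : ∀ {p qs} → IsOddPrime p → All IsOddPrime qs → legendre (product qs) p ≡ θ (product qs) p * jac p qs
legendre-jac (k , refl , p-prime) [] = trans (LegendreSymbol.legendre-1 k p-prime) refl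
legendre-jac {p} {q ∷ qs} pp@(k , refl , p-prime) (qq@(l , refl , q-prime) ∷ odd) = begin
  legendre (q ℕ.* product qs) p
    ≡⟨ LegendreSymbol.legendre-* k p-prime q (product qs) ⟩
  legendre q p * legendre (product qs) p
    ≡⟨ cong₂ _*_ (trans (legendre-reciprocity k l p-prime q-prime)
         (cong (_* legendre p q) (trans (cong σ (ℕ.*-comm k l)) (sym (θ-odd l k))))) (legendre-jac pp odd) ⟩
  (θ q p * legendre p q) * (θ (product qs) p * jac p qs)
    ≡⟨ shuffle (θ q p) (legendre p q) (θ (product qs) p) (jac p qs) ⟩
  (θ q p * θ (product qs) p) * (legendre p q * jac p qs)
    ≡⟨ cong (_* (legendre p q * jac p qs)) (θ-* p (l , refl) (Odd-product odd)) ⟨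
  θ (q ℕ.* product qs) p * (legendre p q * jac p qs) ∎
  where open ≡-Reasoning

jac-reciprocity : ∀ {ps qs} → All IsOddPrime ps → All IsOddPrime qs →
  jac (product qs) ps ≡ θ (product qs) (product ps) * jac (product ps) qs
jac-reciprocity {[]} {qs} [] oq = sym (trans (cong₂ _*_ (cong σ (ℕ.*-zeroʳ ⌊ product qs /2⌋)) (jac-1 oq)) refl)
jac-reciprocity {p ∷ ps} {qs} (op@(k , e , _) ∷ ops) oq = begin
  legendre (product qs) p * jac (product qs) ps
    ≡⟨ cong₂ _*_ (legendre-jac op oq) (jac-reciprocity ops oq) ⟩
  (θ (product qs) p * jac p qs) * (θ (product qs) (product ps) * jac (product ps) qs)
    ≡⟨ shuffle (θ (product qs) p) (jac p qs) (θ (product qs) (product ps)) (jac (product ps) qs) ⟩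
  (θ (product qs) p * θ (product qs) (product ps)) * (jac p qs * jac (product ps) qs)
    ≡⟨ cong₂ _*_ (trans (cong₂ _*_ (θ-comm (product qs) p) (θ-comm (product qs) (product ps)))
         (trans (sym (θ-* (product qs) (k , e) (Odd-product ops))) (θ-comm (p ℕ.* product ps) (product qs))))
         (sym (jac-* p (product ps) oq)) ⟩
  θ (product qs) (p ℕ.* product ps) * jac (p ℕ.* product ps) qs ∎
  where open ≡-Reasoning

module OddModulus (k : ℕ) where
  n : ℕ
  n = suc (k ℕ.+ k)

  ps : List ℕ
  ps = primes n n

  factorisation : product ps ≡ n × All IsOddPrime ps
  factorisation = primes-product n n (s≤s z≤n) ℕ.≤-refl (k , refl)

  odd-primes : All IsOddPrime ps
  odd-primes = proj₂ factorisation

  jacobi-jac : ∀ a → jacobi a n ≡ jac a ps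
  jacobi-jac a = jacobiAux-primes n a n

  jacobi-* : ∀ a b → jacobi (a ℕ.* b) n ≡ jacobi a n * jacobi b n
  jacobi-* a b = trans (jacobi-jac (a ℕ.* b)) (trans (jac-* a b odd-primes)
    (sym (cong₂ _*_ (jacobi-jac a) (jacobi-jac b))))

  jacobi-1 : jacobi 1 n ≡ 1ℤ
  jacobi-1 = trans (jacobi-jac 1) (jac-1 odd-primes)

  jacobi-Ternary : ∀ a → Ternary (jacobi a n)
  jacobi-Ternary a = subst Ternary (sym (jacobi-jac a)) (jac-Ternary a odd-primes)

  jacobi-period : ∀ {a b} → a % n ≡ b % n → jacobi a n ≡ jacobi b n
  jacobi-period {a} {b} e = trans (jacobi-jac a)
    (trans (jac-period n odd-primes
      (All.tabulate (λ {q} q∈ → subst (q ℕ.∣_) (proj₁ factorisation) (∈⇒∣product q∈))) e) (sym (jacobi-jac b)))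

jacobi-reciprocity : ∀ l k → jacobi (suc (l ℕ.+ l)) (suc (k ℕ.+ k)) ≡ σ (l ℕ.* k) * jacobi (suc (k ℕ.+ k)) (suc (l ℕ.+ l))
jacobi-reciprocity l k = begin
  jacobi L.n K.n
    ≡⟨ trans (K.jacobi-jac L.n) (cong (λ m → jac m K.ps) (sym (proj₁ L.factorisation))) ⟩
  jac (product L.ps) K.ps
    ≡⟨ jac-reciprocity K.odd-primes L.odd-primes ⟩
  θ (product L.ps) (product K.ps) * jac (product K.ps) L.ps
    ≡⟨ cong₂ (λ u v → θ u v * jac v L.ps) (proj₁ L.factorisation) (proj₁ K.factorisation) ⟩
  θ L.n K.n * jac K.n L.ps
    ≡⟨ cong₂ _*_ (θ-odd l k) (sym (L.jacobi-jac K.n)) ⟩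
  σ (l ℕ.* k) * jacobi K.n L.n ∎
  where
  open ≡-Reasoning
  module L = OddModulus l
  module K = OddModulus k

jacobi-self : ∀ k → 1 ≤ k → jacobi (suc (k ℕ.+ k)) (suc (k ℕ.+ k)) ≡ 0ℤ
jacobi-self (suc k) _ = trans
  (cong (_* rest) (legendre-zero m (smallestFactorPredFrom m 1 m) (ℕ.n∣m⇒m%n≡0 m (spf m) (proj₂ (spf-prime (k ℕ.+ suc k))))))
  (*-zeroˡ rest)
  where
  m = suc (suc (k ℕ.+ suc k))
  rest = jacobiAux (suc (k ℕ.+ suc k)) m (m / spf m)

complement-% : ∀ u v n .{{_ : NonZero n}} → u ℕ.+ v ≡ n → ((n ∸ 1) ℕ.* v) % n ≡ u % n
complement-% u v (suc N) e = begin
  (N ℕ.* v) % suc N                          ≡⟨ ℕ.[m+kn]%n≡m%n (N ℕ.* v) 1 (suc N) ⟨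
  (N ℕ.* v ℕ.+ 1 ℕ.* suc N) % suc N          ≡⟨ cong (λ x → (N ℕ.* v ℕ.+ 1 ℕ.* x) % suc N) (sym e) ⟩
  (N ℕ.* v ℕ.+ 1 ℕ.* (u ℕ.+ v)) % suc N      ≡⟨ cong (_% suc N) (lem N u v) ⟩
  (u ℕ.+ v ℕ.* suc N) % suc N                ≡⟨ ℕ.[m+kn]%n≡m%n u v (suc N) ⟩
  u % suc N ∎
  where
  open ≡-Reasoning
  lem : ∀ N u v → N ℕ.* v ℕ.+ 1 ℕ.* (u ℕ.+ v) ≡ u ℕ.+ v ℕ.* suc N
  lem = ℕ-Ring.solve-∀

square-unit : ∀ {u v} → Ternary u → u * u * v ≡ 1ℤ → v ≡ 1ℤ
square-unit (inj₁ refl)        ()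
square-unit (inj₂ (inj₁ refl)) e = trans (sym (*-identityˡ _)) e
square-unit (inj₂ (inj₂ refl)) e = trans (sym (*-identityˡ _)) e

-- With M = 4n − 1, which is −1 modulo n and 3 modulo 4, reciprocity gives (−1/n) = ±(n/M), and (n/M) = 1
-- because 4n is 1 modulo M.
jacobi-minus-one : ∀ k → jacobi (k ℕ.+ k) (suc (k ℕ.+ k)) ≡ σ k
jacobi-minus-one k = begin
  jacobi (k ℕ.+ k) n
    ≡⟨ OddModulus.jacobi-period k {k ℕ.+ k} {M}
         (sym (trans (cong (_% n) (lem k)) (ℕ.[m+kn]%n≡m%n (k ℕ.+ k) 3 n))) ⟩
  jacobi M n
    ≡⟨ jacobi-reciprocity l k ⟩
  σ (l ℕ.* k) * jacobi n M
    ≡⟨ cong₂ _*_ (σ-odd (k ℕ.+ k) k) trivial ⟩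
  σ k * 1ℤ
    ≡⟨ *-identityʳ (σ k) ⟩
  σ k ∎
  where
  open ≡-Reasoning
  n = suc (k ℕ.+ k)
  l = suc ((k ℕ.+ k) ℕ.+ (k ℕ.+ k))
  M = suc (l ℕ.+ l)
  module M = OddModulus l
  lem : ∀ k → let l = suc ((k ℕ.+ k) ℕ.+ (k ℕ.+ k)) in suc (l ℕ.+ l) ≡ (k ℕ.+ k) ℕ.+ 3 ℕ.* suc (k ℕ.+ k)
  lem = ℕ-Ring.solve-∀
  lem′ : ∀ k → let l = suc ((k ℕ.+ k) ℕ.+ (k ℕ.+ k)) in 4 ℕ.* suc (k ℕ.+ k) ≡ 1 ℕ.+ 1 ℕ.* suc (l ℕ.+ l)
  lem′ = ℕ-Ring.solve-∀
  trivial : jacobi n M ≡ 1ℤ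
  trivial = square-unit (M.jacobi-Ternary 2) (begin
    jacobi 2 M * jacobi 2 M * jacobi n M
      ≡⟨ cong (_* jacobi n M) (M.jacobi-* 2 2) ⟨
    jacobi 4 M * jacobi n M
      ≡⟨ M.jacobi-* 4 n ⟨
    jacobi (4 ℕ.* n) M
      ≡⟨ M.jacobi-period {4 ℕ.* n} {1} (trans (cong (_% M) (lem′ k)) (ℕ.[m+kn]%n≡m%n 1 1 M)) ⟩
    jacobi 1 M
      ≡⟨ M.jacobi-1 ⟩
    1ℤ ∎)

jacobi-complement : ∀ u v k → u ℕ.+ v ≡ suc (k ℕ.+ k) → jacobi u (suc (k ℕ.+ k)) ≡ σ k * jacobi v (suc (k ℕ.+ k))
jacobi-complement u v k e = trans (OddModulus.jacobi-period k (sym (complement-% u v (suc (k ℕ.+ k)) e)))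
  (trans (OddModulus.jacobi-* k (k ℕ.+ k) v) (cong (_* jacobi v (suc (k ℕ.+ k))) (jacobi-minus-one k)))

σ-consecutive : ∀ k → σ (k ℕ.* suc k) ≡ 1ℤ
σ-consecutive zero    = refl
σ-consecutive (suc k) = trans (cong σ (lem k)) (trans (σ-+ (k ℕ.* suc k) (suc k ℕ.+ suc k))
  (cong₂ _*_ (σ-consecutive k) (σ-double (suc k))))
  where
  lem : ∀ k → suc k ℕ.* suc (suc k) ≡ k ℕ.* suc k ℕ.+ (suc k ℕ.+ suc k)
  lem = ℕ-Ring.solve-∀

-- With n′ = n + 2 one has (2/n) = (n′/n) = (n/n′) = (-2/n′). The reciprocity sign is 1 because (n -
-- 1)/2 and (n′ - 1)/2 are consecutive. A recursion in n is the form in which ε can be compared with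
-- (2/n).
jacobi-two-suc : ∀ k → jacobi 2 (suc (suc k ℕ.+ suc k)) ≡ σ (suc k) * jacobi 2 (suc (k ℕ.+ k))
jacobi-two-suc k = σ-cancel (suc k) (begin
  jacobi 2 n
    ≡⟨ OddModulus.jacobi-period k {2} {n′} (sym (trans (cong (_% n) (trans shape (ℕ.+-comm 2 n)))
         (trans (cong (_% n) (ℕ.+-comm n 2)) (ℕ.[m+n]%n≡m%n 2 n)))) ⟩
  jacobi n′ n
    ≡⟨ jacobi-reciprocity (suc k) k ⟩
  σ (suc k ℕ.* k) * jacobi n n′
    ≡⟨ cong (_* jacobi n n′) (trans (cong σ (ℕ.*-comm (suc k) k)) (σ-consecutive k)) ⟩
  1ℤ * jacobi n n′
    ≡⟨ *-identityˡ (jacobi n n′) ⟩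
  jacobi n n′
    ≡⟨ jacobi-complement n 2 (suc k) (trans (ℕ.+-comm n 2) (sym shape)) ⟩
  σ (suc k) * jacobi 2 n′ ∎)
  where
  open ≡-Reasoning
  n  = suc (k ℕ.+ k)
  n′ = suc (suc k ℕ.+ suc k)
  shape : n′ ≡ 2 ℕ.+ n
  shape = cong (λ x → suc (suc x)) (ℕ.+-suc k k)

-- Evaluation of the sums by the Euclidean algorithm

η-double : ∀ k → η (k ℕ.+ k) ≡ σ k
η-double zero    = refl
η-double (suc k) rewrite ℕ.+-suc k k = trans (lem (σ (k ℕ.+ k)) (η (k ℕ.+ k))) (trans
  (cong₂ (λ x y → - (x * x * y)) (σ-double k) (η-double k)) (cong -_ (*-identityˡ (σ k))))
  where
  lem : ∀ s e → - - s * (- s * e) ≡ - (s * s * e)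
  lem = solve-∀

module Grid (k : ℕ) = EvenHeight {k ℕ.+ k} (σ-double k)

-- The width 2k + 2 exceeds the period by 1, so by `F-1` its value at height 2k is ε for k.
-- Transposed, the board has height 2k + 2, and its width 2k mirrors to width 1 with the factor ε
-- for k + 1 times `σ (suc k)`. This is the recursion of `jacobi-two-suc`.
F-double-suc : ∀ k → F (suc (k ℕ.+ k)) (k ℕ.+ k) ≡ jacobi 2 (suc (k ℕ.+ k))
F-double-suc zero    = refl
F-double-suc (suc k) = trans (σ-cancel (suc k) (begin
  Grid.ε k
    ≡⟨ *-identityʳ (Grid.ε k) ⟨
  Grid.ε k * 1ℤ
    ≡⟨ cong (Grid.ε k *_) (F-1 k) ⟨
  Grid.ε k * F 1 (k ℕ.+ k)
    ≡⟨ Grid.F-period k 1 ⟨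
  F (suc (suc (k ℕ.+ k))) (k ℕ.+ k)
    ≡⟨ cong (λ a → F a (k ℕ.+ k)) shape ⟨
  F (suc k ℕ.+ suc k) (k ℕ.+ k)
    ≡⟨ F-reciprocity (suc k) k ⟩
  σ (k ℕ.* suc k) * F (k ℕ.+ k) (suc k ℕ.+ suc k)
    ≡⟨ cong₂ _*_ (σ-consecutive k) (Grid.F-mirror (suc k) 1 (k ℕ.+ k) (sym shape)) ⟩
  1ℤ * (Grid.ε (suc k) * η (suc k ℕ.+ suc k) * F 1 (suc k ℕ.+ suc k))
    ≡⟨ cong₂ (λ x y → 1ℤ * (Grid.ε (suc k) * x * y)) (η-double (suc k)) (F-1 (suc k)) ⟩
  1ℤ * (Grid.ε (suc k) * σ (suc k) * 1ℤ)
    ≡⟨ lem (Grid.ε (suc k)) (σ (suc k)) ⟩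
  σ (suc k) * Grid.ε (suc k) ∎))
  (trans (cong (σ (suc k) *_) (F-double-suc k)) (sym (jacobi-two-suc k)))
  where
  open ≡-Reasoning
  shape : suc k ℕ.+ suc k ≡ suc (suc (k ℕ.+ k))
  shape = cong suc (ℕ.+-suc k k)
  lem : ∀ x y → 1ℤ * (x * y * 1ℤ) ≡ y * x
  lem = solve-∀

jacobi-two² : ∀ k → jacobi 2 (suc (k ℕ.+ k)) * jacobi 2 (suc (k ℕ.+ k)) ≡ 1ℤ
jacobi-two² zero    = refl
jacobi-two² (suc k) = begin
  χ′ * χ′                            ≡⟨ cong₂ _*_ (jacobi-two-suc k) (jacobi-two-suc k) ⟩
  (σ (suc k) * χ) * (σ (suc k) * χ)  ≡⟨ shuffle (σ (suc k)) χ (σ (suc k)) χ ⟩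
  (σ (suc k) * σ (suc k)) * (χ * χ)  ≡⟨ cong₂ _*_ (σ² (suc k)) (jacobi-two² k) ⟩
  1ℤ ∎
  where
  open ≡-Reasoning
  χ = jacobi 2 (suc (k ℕ.+ k))
  χ′ = jacobi 2 (suc (suc k ℕ.+ suc k))

-- For even m the value (m/2 over n) is (2/n)(m/n), since (2/n) is its own inverse.
twist : ℕ → ℕ → ℤ
twist k a with parity a
... | inj₁ _ = 1ℤ
... | inj₂ _ = jacobi 2 (suc (k ℕ.+ k))

twist-even : ∀ k l → twist k (l ℕ.+ l) ≡ 1ℤ
twist-even k l with parity (l ℕ.+ l)
... | inj₁ _ = refl
... | inj₂ odd = contradiction (trans (sym (σ-double l)) (σ-Odd odd)) λ ()

twist-odd : ∀ k l → twist k (suc (l ℕ.+ l)) ≡ jacobi 2 (suc (k ℕ.+ k))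
twist-odd k l with parity (suc (l ℕ.+ l))
... | inj₂ _ = refl
... | inj₁ (x , e) = contradiction (trans (sym (cong -_ (σ-double l))) (trans (cong σ e) (σ-double x))) λ ()

-- The period is odd, so it exchanges the two values of the twist; they differ by the factor (2/n),
-- whose square is 1.
twist-period : ∀ k a → twist k (a ℕ.+ suc (k ℕ.+ k)) ≡ jacobi 2 (suc (k ℕ.+ k)) * twist k a
twist-period k a = by (parity a)
  where
  by : (∃[ x ] a ≡ x ℕ.+ x) ⊎ Odd a → twist k (a ℕ.+ suc (k ℕ.+ k)) ≡ jacobi 2 (suc (k ℕ.+ k)) * twist k a
  by (inj₁ (x , refl)) = trans (cong (twist k) (lem x k)) (trans (twist-odd k (x ℕ.+ k))
    (sym (trans (cong (jacobi 2 (suc (k ℕ.+ k)) *_) (twist-even k x)) (*-identityʳ _))))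
    where
    lem : ∀ x k → x ℕ.+ x ℕ.+ suc (k ℕ.+ k) ≡ suc (x ℕ.+ k ℕ.+ (x ℕ.+ k))
    lem = ℕ-Ring.solve-∀
  by (inj₂ (x , refl)) = trans (cong (twist k) (lem x k)) (trans (twist-even k (suc (x ℕ.+ k)))
    (sym (trans (cong (jacobi 2 (suc (k ℕ.+ k)) *_) (twist-odd k x)) (jacobi-two² k))))
    where
    lem : ∀ x k → suc (x ℕ.+ x) ℕ.+ suc (k ℕ.+ k) ≡ suc (x ℕ.+ k) ℕ.+ suc (x ℕ.+ k)
    lem = ℕ-Ring.solve-∀

Evaluates : ℕ → Set
Evaluates k = ∀ a → F a (k ℕ.+ k) ≡ twist k a * jacobi (suc a) (suc (k ℕ.+ k))

double-<-cancel : ∀ {l k} → l ℕ.+ l < k ℕ.+ k → l < k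
double-<-cancel {l} {k} lt = ℕ.≰⇒> (λ k≤l → ℕ.<-irrefl refl (ℕ.<-≤-trans lt (ℕ.+-mono-≤ k≤l k≤l)))

module EuclidStep (k : ℕ) (smaller : ∀ {l} → l < k → Evaluates l) where
  open Grid k
  n = suc (k ℕ.+ k)
  χ = jacobi 2 n

  -- The Euclidean step: transposition leads to the smaller height 2l and the larger width 2k, and
  -- both sides acquire the same reciprocity sign.
  even-width : ∀ l → l ℕ.+ l < k ℕ.+ k → F (l ℕ.+ l) (k ℕ.+ k) ≡ jacobi (suc (l ℕ.+ l)) n
  even-width l lt = begin
    F (l ℕ.+ l) (k ℕ.+ k)
      ≡⟨ F-reciprocity l k ⟩
    σ (k ℕ.* l) * F (k ℕ.+ k) (l ℕ.+ l)
      ≡⟨ cong₂ _*_ (cong σ (ℕ.*-comm k l)) (smaller (double-<-cancel lt) (k ℕ.+ k)) ⟩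
    σ (l ℕ.* k) * (twist l (k ℕ.+ k) * jacobi n (suc (l ℕ.+ l)))
      ≡⟨ cong (λ x → σ (l ℕ.* k) * (x * jacobi n (suc (l ℕ.+ l)))) (twist-even l k) ⟩
    σ (l ℕ.* k) * (1ℤ * jacobi n (suc (l ℕ.+ l)))
      ≡⟨ cong (σ (l ℕ.* k) *_) (*-identityˡ (jacobi n (suc (l ℕ.+ l)))) ⟩
    σ (l ℕ.* k) * jacobi n (suc (l ℕ.+ l))
      ≡⟨ jacobi-reciprocity l k ⟨
    jacobi (suc (l ℕ.+ l)) n ∎
    where open ≡-Reasoning

  -- Transposition needs an even width, and the mirrored width `b` is even. Of the mirror factor,
  -- `σ k` is (-1/n) and turns the symbol of n - (a + 1) into that of a + 1, while ε is the twist.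
  odd-width : ∀ l → suc (l ℕ.+ l) < k ℕ.+ k → F (suc (l ℕ.+ l)) (k ℕ.+ k) ≡ χ * jacobi (suc (suc (l ℕ.+ l))) n
  odd-width l lt = by (parity b)
    where
    open ≡-Reasoning
    a = suc (l ℕ.+ l)
    b = k ℕ.+ k ∸ suc a
    total : suc (a ℕ.+ b) ≡ k ℕ.+ k
    total = ℕ.m+[n∸m]≡n lt
    by : (∃[ x ] b ≡ x ℕ.+ x) ⊎ Odd b → F a (k ℕ.+ k) ≡ χ * jacobi (suc a) n
    by (inj₂ (x , e)) = contradiction
      (trans (sym (cong -_ (σ-double (suc (l ℕ.+ x))))) (trans (cong σ (trans (lem l x) (trans (cong (λ z → suc (a ℕ.+ z)) (sym e)) total))) (σ-double k))) λ ()
      where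
      lem : ∀ l x → suc (suc (l ℕ.+ x) ℕ.+ suc (l ℕ.+ x)) ≡ suc (suc (l ℕ.+ l) ℕ.+ suc (x ℕ.+ x))
      lem = ℕ-Ring.solve-∀
    by (inj₁ (x , e)) = begin
      F a (k ℕ.+ k)
        ≡⟨ F-mirror b a (trans (cong suc (ℕ.+-comm b a)) total) ⟩
      ε * η (k ℕ.+ k) * F b (k ℕ.+ k)
        ≡⟨ cong₂ (λ u v → u * v * F b (k ℕ.+ k)) (F-double-suc k) (η-double k) ⟩
      χ * σ k * F b (k ℕ.+ k)
        ≡⟨ cong (λ u → χ * σ k * F u (k ℕ.+ k)) e ⟩
      χ * σ k * F (x ℕ.+ x) (k ℕ.+ k)
        ≡⟨ cong (χ * σ k *_) (even-width x (subst (ℕ._< k ℕ.+ k) e b<)) ⟩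
      χ * σ k * jacobi (suc (x ℕ.+ x)) n
        ≡⟨ *-assoc χ (σ k) _ ⟩
      χ * (σ k * jacobi (suc (x ℕ.+ x)) n)
        ≡⟨ cong (χ *_) (jacobi-complement (suc a) (suc (x ℕ.+ x)) k
             (trans (cong (λ z → suc a ℕ.+ suc z) (sym e)) (trans (cong suc (ℕ.+-suc a b)) (cong suc total)))) ⟨
      χ * jacobi (suc a) n ∎
      where
      b< : b < k ℕ.+ k
      b< = ℕ.≤-trans (s≤s (ℕ.m≤n+m b a)) (ℕ.≤-reflexive total)

  -- Here m = n, and both sides vanish unless n = 1, when both are 1.
  square-width : F (k ℕ.+ k) (k ℕ.+ k) ≡ jacobi n n
  square-width with k ℕ.≟ 0
  ... | yes refl = refl
  ... | no k≢0   = trans (F-zero (ℕ.≤-trans k>0 (ℕ.m≤m+n k k))) (sym (jacobi-self k k>0))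
    where k>0 = ℕ.n≢0⇒n>0 k≢0

  narrow : ∀ a → a < n → F a (k ℕ.+ k) ≡ twist k a * jacobi (suc a) n
  narrow a (s≤s a≤) with ℕ.m≤n⇒m<n∨m≡n a≤
  ... | inj₂ refl = trans square-width (trans (sym (*-identityˡ (jacobi n n))) (cong (_* jacobi n n) (sym (twist-even k k))))
  ... | inj₁ a<   = by (parity a)
    where
    by : (∃[ x ] a ≡ x ℕ.+ x) ⊎ Odd a → F a (k ℕ.+ k) ≡ twist k a * jacobi (suc a) n
    by (inj₁ (x , refl)) = trans (even-width x a<) (trans (sym (*-identityˡ (jacobi (suc a) n))) (cong (_* jacobi (suc a) n) (sym (twist-even k x))))
    by (inj₂ (x , refl)) = trans (odd-width x a<) (cong (_* jacobi (suc a) n) (sym (twist-odd k x)))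

  shifted : ∀ a → F a (k ℕ.+ k) ≡ twist k a * jacobi (suc a) n →
    F (a ℕ.+ n) (k ℕ.+ k) ≡ twist k (a ℕ.+ n) * jacobi (suc (a ℕ.+ n)) n
  shifted a e = begin
    F (a ℕ.+ n) (k ℕ.+ k)                        ≡⟨ F-period a ⟩
    ε * F a (k ℕ.+ k)                            ≡⟨ cong₂ _*_ (F-double-suc k) e ⟩
    χ * (twist k a * jacobi (suc a) n)           ≡⟨ *-assoc χ (twist k a) _ ⟨
    χ * twist k a * jacobi (suc a) n             ≡⟨ cong₂ _*_ (sym (twist-period k a))
                                                      (OddModulus.jacobi-period k {suc a} {suc (a ℕ.+ n)} (sym (ℕ.[m+n]%n≡m%n (suc a) n))) ⟩
    twist k (a ℕ.+ n) * jacobi (suc (a ℕ.+ n)) n ∎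
    where open ≡-Reasoning

  wide : ∀ q r → r < n → F (r ℕ.+ q ℕ.* n) (k ℕ.+ k) ≡ twist k (r ℕ.+ q ℕ.* n) * jacobi (suc (r ℕ.+ q ℕ.* n)) n
  wide zero    r r<n rewrite ℕ.+-identityʳ r = narrow r r<n
  wide (suc q) r r<n = subst (λ a → F a (k ℕ.+ k) ≡ twist k a * jacobi (suc a) n) (lem r (q ℕ.* n) n)
    (shifted (r ℕ.+ q ℕ.* n) (wide q r r<n))
    where
    lem : ∀ r x n → r ℕ.+ x ℕ.+ n ≡ r ℕ.+ (n ℕ.+ x)
    lem = ℕ-Ring.solve-∀

  evaluates : Evaluates k
  evaluates a = subst (λ a → F a (k ℕ.+ k) ≡ twist k a * jacobi (suc a) n)
    (sym (ℕ.m≡m%n+[m/n]*n a n)) (wide (a / n) (a % n) (ℕ.m%n<n a n))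

F-jacobi : ∀ k → Evaluates k
F-jacobi = <-rec Evaluates (λ k smaller → EuclidStep.evaluates k smaller)

odd-form : ∀ n → n % 2 ≡ 1 → Odd n
odd-form n e = by (parity n)
  where
  by : (∃[ x ] n ≡ x ℕ.+ x) ⊎ Odd n → Odd n
  by (inj₂ odd)        = odd
  by (inj₁ (x , refl)) = contradiction (trans (sym e) (even x)) λ ()
    where
    even : ∀ x → (x ℕ.+ x) % 2 ≡ 0
    even x = trans (cong (_% 2) (lem x)) (ℕ.m*n%n≡0 x 2)
      where
      lem : ∀ x → x ℕ.+ x ≡ x ℕ.* 2
      lem = ℕ-Ring.solve-∀

F-odd : ∀ l k → F (l ℕ.+ l) (k ℕ.+ k) ≡ jacobi (suc (l ℕ.+ l)) (suc (k ℕ.+ k))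
F-odd l k = trans (F-jacobi k (l ℕ.+ l))
  (trans (cong (_* jacobi (suc (l ℕ.+ l)) (suc (k ℕ.+ k))) (twist-even k l)) (*-identityˡ _))

F-even : ∀ l k → F (suc (l ℕ.+ l)) (k ℕ.+ k) ≡ jacobi (suc l) (suc (k ℕ.+ k))
F-even l k = begin
  F (suc (l ℕ.+ l)) (k ℕ.+ k)
    ≡⟨ F-jacobi k (suc (l ℕ.+ l)) ⟩
  twist k (suc (l ℕ.+ l)) * jacobi (suc (suc (l ℕ.+ l))) n
    ≡⟨ cong₂ (λ x m → x * jacobi m n) (twist-odd k l) (lem l) ⟩
  jacobi 2 n * jacobi (2 ℕ.* suc l) n
    ≡⟨ cong (jacobi 2 n *_) (OddModulus.jacobi-* k 2 (suc l)) ⟩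
  jacobi 2 n * (jacobi 2 n * jacobi (suc l) n)
    ≡⟨ *-assoc (jacobi 2 n) (jacobi 2 n) _ ⟨
  jacobi 2 n * jacobi 2 n * jacobi (suc l) n
    ≡⟨ cong (_* jacobi (suc l) n) (jacobi-two² k) ⟩
  1ℤ * jacobi (suc l) n
    ≡⟨ *-identityˡ (jacobi (suc l) n) ⟩
  jacobi (suc l) n ∎
  where
  open ≡-Reasoning
  n = suc (k ℕ.+ k)
  lem : ∀ l → suc (suc (l ℕ.+ l)) ≡ 2 ℕ.* suc l
  lem = ℕ-Ring.solve-∀

theorem1p1 : (m n : ℕ) → 1 ≤ m → 1 ≤ n → n % 2 ≡ 1 →
    (m % 2 ≡ 1 → dominoSum (m ∸ 1) (n ∸ 1) ≡ toℤi (jacobi m n))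
    × (m % 2 ≡ 0 → dominoSum (m ∸ 1) (n ∸ 1) ≡ toℤi (jacobi (m / 2) n))
theorem1p1 m n 1≤m _ n-odd with k , refl ← odd-form n n-odd = odd-case , even-case
  where
  odd-case : m % 2 ≡ 1 → dominoSum (m ∸ 1) (k ℕ.+ k) ≡ toℤi (jacobi m (suc (k ℕ.+ k)))
  odd-case m-odd with l , refl ← odd-form m m-odd = trans (dominoSum-F (l ℕ.+ l) k) (cong toℤi (F-odd l k))
  even-case : m % 2 ≡ 0 → dominoSum (m ∸ 1) (k ℕ.+ k) ≡ toℤi (jacobi (m / 2) (suc (k ℕ.+ k)))
  even-case m-even = by (m / 2) (ℕ.m/n*n≡m (ℕ.m%n≡0⇒n∣m m 2 m-even)) 1≤m
    where
    -- The quotient is generalised to `t` so that the equation `t * 2 ≡ m` can be matched; `t = 0`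
    -- is excluded by `1 ≤ m`.
    by : ∀ t {m} → t ℕ.* 2 ≡ m → 1 ≤ m → dominoSum (m ∸ 1) (k ℕ.+ k) ≡ toℤi (jacobi t (suc (k ℕ.+ k)))
    by (suc l) refl _ = trans (cong (λ a → dominoSum a (k ℕ.+ k)) (cong suc (lem l)))
      (trans (dominoSum-F (suc (l ℕ.+ l)) k) (cong toℤi (F-even l k)))
      where
      lem : ∀ l → l ℕ.* 2 ≡ l ℕ.+ l
      lem = ℕ-Ring.solve-∀
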